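{- Let $k$ be a nonnegative integer. Then for every integer $n\ge 0$, $$\sum_{|\lambda|=n}\frac{2^{|\lambda|-\ell(\lambda)}f_{\lambda}}{H_{\lambda}}\sum_{\square\in\lambda}\binom{c_{\square}+k-1}{2k}=\frac{2^k}{(k+1)!}\binom{n}{k+1},$$ where the outer sum ranges over all strict partitions $\lambda$ of size $n$.
   Context: A strict partition is a finite strictly decreasing sequence of positive integers $\lambda=(\lambda_1>\lambda_2>\cdots>\lambda_\ell)$ (the empty sequence is allowed); $|\lambda|=\sum_i\lambda_i$ is its size, $\ell(\lambda)=\ell$ its length, and $\lambda_i=0$ for $i>\ell(\lambda)$. The (shifted Young) diagram of $\lambda$ is the set of boxes $(i,j)$ with $1\le i\le \ell(\lambda)$ and $i+1\le j\le i+\lambda_i$ (row $i$, column $j$); $\lambda$ is identified with its diagram. The content of a box $\square=(i,j)$ is $c_\square=j-i$. The hook length $h_\square$ of $\square=(i,j)\in\lambda$ is the number of boxes of $\lambda$ in row $i$ strictly to the right of $\square$, plus the number of boxes $(i',j)\in\lambda$ with $i'>i$, plus $1$, plus $\lambda_j$. $H_\lambda=\prod_{\square\in\lambda}h_\square$. $f_\lambda$ is the number of standard shifted Young tableaux of shape $\lambda$, i.e. bijective fillings of the boxes of $\lambda$ with $1,\dots,|\lambda|$ increasing from left to right along rows and from top to bottom along columns. $\binom{z}{2k}=z(z-1)\cdots(z-2k+1)/(2k)!$. -}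

module Defs where

open import Data.Empty using (⊥)
open import Data.Fin.Base as Fin using (Fin; finToFun)
import Data.Fin.Properties as Fin
open import Data.List.Base
  using (List; []; _∷_; _++_; map; concatMap; filter; foldr; length; lookup; upTo; allFin)
open import Data.List.Membership.Propositional using (_∈_)
open import Data.List.Membership.Propositional.Properties
  using (∈-map⁺; ∈-map⁻; ∈-++⁺ˡ; ∈-++⁺ʳ; ∈-++⁻; ∈-filter⁺; ∈-filter⁻)
open import Data.List.Relation.Unary.All as All using (All; []; _∷_)
import Data.List.Relation.Unary.All.Properties as All
open import Data.List.Relation.Unary.AllPairs using (AllPairs; []; _∷_)
open import Data.List.Relation.Unary.Any using (here)
open import Data.List.Relation.Unary.Linked using (Linked)
open import Data.List.Relation.Unary.Linked.Properties
  using (Linked⇒AllPairs; AllPairs⇒Linked)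
open import Data.List.Relation.Unary.Unique.Propositional using (Unique)
import Data.List.Relation.Unary.Unique.Propositional.Properties as Unique
open import Data.Nat.Base
  using (ℕ; zero; suc; _+_; _∸_; _^_; _≤_; _<_; _>_; z≤n; s≤s; NonZero)
open import Data.Nat.ListAction using (sum; product)
open import Data.Nat.ListAction.Properties using (product≢0)
open import Data.Nat.Properties
open import Data.Product.Base using (_×_; _,_; proj₁; proj₂)
open import Data.Rational.Base as ℚ using (ℚ; 0ℚ)
open import Data.Sum.Base using (inj₁; inj₂)
open import Function.Base using (flip)
open import Function.Bundles using (_⇔_; mk⇔)
open import Function.Definitions using (Bijective)
open import Relation.Binary.PropositionalEquality using (_≡_; refl)
open import Relation.Nullary.Decidable using (Dec; map′; _×-dec_; _→-dec_)

∑ℚ : {A : Set} → List A → (A → ℚ) → ℚ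
∑ℚ xs g = foldr ℚ._+_ 0ℚ (map g xs)

IsStrictPartition : List ℕ → Set
IsStrictPartition λs = Linked _>_ λs × All (0 <_) λs

-- all strictly decreasing lists with entries in {1, …, m}
decreasing : ℕ → List (List ℕ)
decreasing zero    = [] ∷ []
decreasing (suc m) = map (suc m ∷_) (decreasing m) ++ decreasing m

-- Each strict partition of n occurs exactly once: see ∈-strictPartitions and
-- strictPartitions-unique.
strictPartitions : ℕ → List (List ℕ)
strictPartitions n = filter (λ λs → sum λs ≟ n) (decreasing n)

-- Shifted diagrams; rows and columns are numbered from 1.

Box : Set
Box = ℕ × ℕ

row col content : Box → ℕ
row = proj₁
col = proj₂
-- every box of a shifted diagram satisfies row < col, so nothing is truncated
content (i , j) = j ∸ i

-- part λs i is λᵢ for i ≥ 1, and is 0 beyond the length (λ₀ is never used)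
part : List ℕ → ℕ → ℕ
part []       _             = 0
part (_ ∷ _)  zero          = 0
part (x ∷ _)  (suc zero)    = x
part (_ ∷ xs) (suc (suc i)) = part xs (suc i)

diagramRow : List ℕ → ℕ → List Box
diagramRow λs i = map (λ d → i , i + suc d) (upTo (part λs i))

diagram : List ℕ → List Box
diagram λs = concatMap (diagramRow λs) (map suc (upTo (length λs)))

arm leg : List ℕ → Box → ℕ
arm λs b = length (filter (λ b′ → (row b′ ≟ row b) ×-dec (col b <? col b′)) (diagram λs))
leg λs b = length (filter (λ b′ → (col b′ ≟ col b) ×-dec (row b <? row b′)) (diagram λs))

-- the last summand is the part λⱼ whose index is the column j of the box
hook : List ℕ → Box → ℕ
hook λs b = suc (arm λs b + leg λs b + part λs (col b))

hookProduct : List ℕ → ℕ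
hookProduct λs = product (map (hook λs) (diagram λs))

hookProduct≢0 : ∀ λs → NonZero (hookProduct λs)
hookProduct≢0 λs = product≢0 (All.map⁺ (All.universal (λ _ → _) (diagram λs)))

-- A filling assigns to (the position in the list diagram λs of) each box an
-- element of Fin (sum λs); t : Fin (sum λs) stands for the label t + 1.
Filling : List ℕ → Set
Filling λs = Fin (length (diagram λs)) → Fin (sum λs)

record IsStandard (λs : List ℕ) (T : Filling λs) : Set where
  constructor standard
  box : Fin (length (diagram λs)) → Box
  box = lookup (diagram λs)
  field
    bijective : Bijective _≡_ _≡_ T
    rows      : ∀ p q → row (box p) ≡ row (box q) → col (box p) < col (box q) → T p Fin.< T q
    columns   : ∀ p q → col (box p) ≡ col (box q) → row (box p) < row (box q) → T p Fin.< T q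

bijective? : ∀ {m n} (f : Fin m → Fin n) → Dec (Bijective _≡_ _≡_ f)
bijective? f = map′
  (λ (i , s) → (λ {x} {y} → i x y) , λ y → proj₁ (s y) , λ { refl → proj₂ (s y) })
  (λ (i , s) → (λ x y → i {x} {y}) , λ y → proj₁ (s y) , proj₂ (s y) refl)
  (Fin.all? (λ x → Fin.all? (λ y → (f x Fin.≟ f y) →-dec (x Fin.≟ y)))
    ×-dec Fin.all? (λ y → Fin.any? (λ x → f x Fin.≟ y)))

isStandard? : ∀ λs (T : Filling λs) → Dec (IsStandard λs T)
isStandard? λs T = map′
  (λ (b , r , c) → standard b r c)
  (λ (standard b r c) → b , r , c)
  (bijective? T
    ×-dec Fin.all? (λ p → Fin.all? (λ q →
      (row (box p) ≟ row (box q)) →-dec ((col (box p) <? col (box q)) →-dec (T p Fin.<? T q))))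
    ×-dec Fin.all? (λ p → Fin.all? (λ q →
      (col (box p) ≟ col (box q)) →-dec ((row (box p) <? row (box q)) →-dec (T p Fin.<? T q)))))
  where
  box : Fin (length (diagram λs)) → Box
  box = lookup (diagram λs)

-- finToFun runs through all functions Fin b → Fin a exactly once as its
-- argument runs through Fin (a ^ b).
#standardTableaux : List ℕ → ℕ
#standardTableaux λs =
  length (filter (λ t → isStandard? λs (finToFun t)) (allFin (sum λs ^ length (diagram λs))))

private
  decreasing-sound : ∀ m {λs} → λs ∈ decreasing m →
                     AllPairs _>_ λs × All (0 <_) λs × All (_≤ m) λs
  decreasing-sound zero (here refl) = [] , [] , []
  decreasing-sound (suc m) λs∈ with ∈-++⁻ (map (suc m ∷_) (decreasing m)) λs∈
  ... | inj₂ λs∈′ = let d , p , b = decreasing-sound m λs∈′ in d , p , All.map m≤n⇒m≤1+n b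
  ... | inj₁ λs∈′ with ∈-map⁻ (suc m ∷_) λs∈′
  ...   | _ , μ∈ , refl = let d , p , b = decreasing-sound m μ∈ in
    All.map s≤s b ∷ d , s≤s z≤n ∷ p , ≤-refl ∷ All.map m≤n⇒m≤1+n b

  []∈decreasing : ∀ m → [] ∈ decreasing m
  []∈decreasing zero    = here refl
  []∈decreasing (suc m) = ∈-++⁺ʳ (map (suc m ∷_) (decreasing m)) ([]∈decreasing m)

  decreasing-complete : ∀ m {λs} → AllPairs _>_ λs → All (0 <_) λs → All (_≤ m) λs →
                        λs ∈ decreasing m
  decreasing-complete m [] _ _ = []∈decreasing m
  decreasing-complete zero (_ ∷ _) (() ∷ _) (z≤n ∷ _)
  decreasing-complete (suc m) (x>xs ∷ d) (0<x ∷ p) (x≤ ∷ _) with m≤n⇒m<n∨m≡n x≤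
  ... | inj₂ refl = ∈-++⁺ˡ (∈-map⁺ (suc m ∷_)
          (decreasing-complete m d p (All.map ≤-pred x>xs)))
  ... | inj₁ (s≤s x≤m) = ∈-++⁺ʳ (map (suc m ∷_) (decreasing m))
          (decreasing-complete m (x>xs ∷ d) (0<x ∷ p)
            (x≤m ∷ All.map (λ y<x → ≤-trans (<⇒≤ y<x) x≤m) x>xs))

  decreasing-unique : ∀ m → Unique (decreasing m)
  decreasing-unique zero    = [] ∷ []
  decreasing-unique (suc m) =
    Unique.++⁺ (Unique.map⁺ (λ { refl → refl }) (decreasing-unique m)) (decreasing-unique m) disjoint
    where
    disjoint : ∀ {λs} → λs ∈ map (suc m ∷_) (decreasing m) × λs ∈ decreasing m → ⊥
    disjoint (∈₁ , ∈₂) with ∈-map⁻ (suc m ∷_) ∈₁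
    ... | _ , _ , refl with decreasing-sound m ∈₂
    ...   | _ , _ , 1+m≤m ∷ _ = 1+n≰n 1+m≤m

  parts≤sum : ∀ λs → All (_≤ sum λs) λs
  parts≤sum []       = []
  parts≤sum (x ∷ xs) =
    m≤m+n x (sum xs) ∷ All.map (λ y≤ → ≤-trans y≤ (m≤n+m (sum xs) x)) (parts≤sum xs)

∈-strictPartitions : ∀ n {λs} →
  λs ∈ strictPartitions n ⇔ (IsStrictPartition λs × sum λs ≡ n)
∈-strictPartitions n {λs} = mk⇔ to from
  where
  to : λs ∈ strictPartitions n → IsStrictPartition λs × sum λs ≡ n
  to λs∈ = let λs∈′ , eq = ∈-filter⁻ (λ μ → sum μ ≟ n) {xs = decreasing n} λs∈
               d , p , _ = decreasing-sound n λs∈′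
           in (AllPairs⇒Linked d , p) , eq
  from : IsStrictPartition λs × sum λs ≡ n → λs ∈ strictPartitions n
  from ((d , p) , refl) = ∈-filter⁺ (λ μ → sum μ ≟ n)
    (decreasing-complete n (Linked⇒AllPairs (flip <-trans) d) p (parts≤sum λs)) refl

strictPartitions-unique : ∀ n → Unique (strictPartitions n)
strictPartitions-unique n = Unique.filter⁺ (λ μ → sum μ ≟ n) (decreasing-unique n)

-- Write f λ for the number of standard tableaux of λ.  Give the addition of a box
-- of content x the weight 2 g(x), or g(1) if x = 1, that is, if a new row starts.
-- Additions and removals of different boxes commute, so the commutator of the
-- weighted addition with the removal of a box is multiplication by
--   g(1) + 2 Σᵢ (g(λᵢ + 1) − g(λᵢ)).
-- For g = 1 this is 1.  For g(x) = C(x + k − 1, 2k) with k ≥ 1 it is twice the sum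
-- over the boxes for k − 1, because C(c + k − 2, 2k − 2) summed over the boxes of a
-- row telescopes to C(λᵢ + k − 1, 2k − 1) = g(λᵢ + 1) − g(λᵢ).  Hence
--   Xₖ(n) = Σ_{|λ| = n} 2^(n − ℓ(λ)) f(λ)² Σ_□ C(c_□ + k − 1, 2k)
-- satisfies a recursion in n whose inhomogeneity is 2 Xₖ₋₁, and
-- Xₖ(n) (k + 1)! = 2^k n! C(n, k + 1) follows by induction on k and n.
--
-- It remains to divide by n! and to use the hook formula f(λ) = n! / H(λ).  Both
-- sides obey the branching rule; for the right-hand side this is the identity
-- Σ_{λ⁻} H(λ) / H(λ⁻) = |λ|, which is read off from the partial fractions of
-- ∏ᵢ (1 + 2 λᵢ / (λᵢ (λᵢ − 1) − z)).

module Submission where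

open import Defs
open import Data.Fin.Base as Fin
  using (Fin; zero; suc; toℕ; fromℕ; inject₁; lower₁; punchIn; punchOut; finToFun; funToFin; cast; combine)
import Data.Fin.Properties as Fin
import Data.Integer.Base as ℤ
import Data.Integer.Properties as ℤ
open import Data.List.Base
  using (List; []; _∷_; _++_; map; concatMap; filter; length; lookup; tabulate; allFin; upTo; applyUpTo)
open import Data.List.Membership.Propositional using (_∈_)
open import Data.List.Membership.Propositional.Properties
open import Data.List.Membership.Propositional.Properties.WithK using (unique∧set⇒bag)
open import Data.List.Properties hiding (sum-++; product≢0; ∈⇒∣product)
open import Data.List.Relation.Binary.BagAndSetEquality using (∼bag⇒↭)
open import Data.List.Relation.Binary.Permutation.Propositional using (_↭_)
open import Data.List.Relation.Binary.Permutation.Propositional.Properties using (map⁺; ↭-length)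
open import Data.List.Relation.Unary.All as All using (All; []; _∷_)
import Data.List.Relation.Unary.All.Properties as All
open import Data.List.Relation.Unary.AllPairs using ([]; _∷_)
open import Data.List.Relation.Unary.Any using (here; there)
open import Data.List.Relation.Unary.Linked using ([]; [-]; _∷_)
open import Data.List.Relation.Unary.Unique.Propositional using (Unique)
import Data.List.Relation.Unary.Unique.Propositional.Properties as Unique
open import Data.Nat.Base
  using (ℕ; zero; suc; pred; _+_; _*_; _∸_; _^_; _!; _≤_; _<_; z≤n; s≤s; NonZero; >-nonZero⁻¹)
open import Data.Nat.Combinatorics
  using (_C_; nCn≡1; nC1≡n; nCk≡nC[n∸k]; nCk+nC[k+1]≡[n+1]C[k+1]; k>n⇒nCk≡0)
open import Data.Nat.ListAction using (sum; product)
open import Data.Nat.ListAction.Properties using (sum-++; sum-↭; product-++)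
open import Data.Nat.Properties
open import Data.Nat.Tactic.RingSolver using (solve-∀)
open import Data.Product.Base as Product using (_×_; _,_; proj₁; proj₂; map₂; ∃)
open import Data.Rational.Base as ℚ using (ℚ; 0ℚ; 1ℚ; _/_)
import Data.Rational.Properties as ℚ
import Data.Rational.Unnormalised.Base as ℚᵘ
import Data.Rational.Unnormalised.Properties as ℚᵘ
open import Data.Sum.Base using (_⊎_; inj₁; inj₂)
open import Data.Vec.Functional using (insertAt)
open import Data.Vec.Functional.Properties using (insertAt-lookup; insertAt-punchIn)
open import Function.Base using (_∘_; id)
open import Function.Bundles using (mk⇔; module Equivalence)
open import Function.Definitions using (Bijective)
open import Level using (0ℓ)
open import Relation.Binary.PropositionalEquality
open import Relation.Nullary using (Dec; yes; no; ¬_; contradiction)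
open import Relation.Nullary.Decidable using (_×-dec_; _⊎-dec_; _→-dec_; ¬?; dec⇒maybe)
open import Relation.Unary using (Decidable)
import Tactic.RingSolver as RingSolver
import Tactic.RingSolver.Core.AlmostCommutativeRing as ACR

-- For the weight 2^(n - ℓ(λ)), addition with g = 1 is adjoint to removal. One factor `f` of f² is
-- expanded by the branching rule and the other absorbs the adjoint operation, which gives two
-- nested recursions: X(n+1) = (n+1) X(n) + Y(n) and Y(n+1) = (n+1) Y(n) + Z(n+1), where Y is the
-- moment of the addition with weight g and Z that of the commutator. All of this stays in ℕ, so
-- negative terms stand on the opposite side of each identity. The obstacle to an induction on the
-- parts is that a row may grow only if the row above leaves room. Additions therefore carry a bound
-- `b`, and the bounded outer corners acquire a boundary term that cancels between neighbouring
-- rows. In the hook formula the nodes p (p - 1) are forced: node p - node q = (p - q)(p + q - 1),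
-- and 1 + 2 p / (node p - node q) is the factor by which (p - q) / (p + q) changes when q drops to
-- q - 1. The pole at node p thus belongs to the shortening of the row p, a forbidden shortening has
-- residue 0, and -2 |λ| is the coefficient of 1/z at infinity.

private variable
  A B E : Set

-- Finite sums

∑ : List A → (A → ℕ) → ℕ
∑ xs f = sum (map f xs)

∑-++ : ∀ (xs ys : List A) (f : A → ℕ) → ∑ (xs ++ ys) f ≡ ∑ xs f + ∑ ys f
∑-++ xs ys f = trans (cong sum (map-++ f xs ys)) (sum-++ (map f xs) (map f ys))

∑-map : ∀ (g : A → B) xs (f : B → ℕ) → ∑ (map g xs) f ≡ ∑ xs (f ∘ g)
∑-map g xs f = cong sum (sym (map-∘ xs))

∑-cong : ∀ (xs : List A) {f g : A → ℕ} → (∀ {x} → x ∈ xs → f x ≡ g x) → ∑ xs f ≡ ∑ xs g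
∑-cong []       f≗g = refl
∑-cong (x ∷ xs) f≗g = cong₂ _+_ (f≗g (here refl)) (∑-cong xs (f≗g ∘ there))

∑-+ : ∀ (xs : List A) (f g : A → ℕ) → ∑ xs (λ x → f x + g x) ≡ ∑ xs f + ∑ xs g
∑-+ []       f g = refl
∑-+ (x ∷ xs) f g rewrite ∑-+ xs f g = lemma (f x) (g x) (∑ xs f) (∑ xs g)
  where
  lemma : ∀ a b c d → (a + b) + (c + d) ≡ (a + c) + (b + d)
  lemma = solve-∀

∑-*ˡ : ∀ (xs : List A) k (f : A → ℕ) → ∑ xs (λ x → k * f x) ≡ k * ∑ xs f
∑-*ˡ []       k f = sym (*-zeroʳ k)
∑-*ˡ (x ∷ xs) k f rewrite ∑-*ˡ xs k f = sym (*-distribˡ-+ k (f x) (∑ xs f))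

∑-*ʳ : ∀ (xs : List A) k (f : A → ℕ) → ∑ xs (λ x → f x * k) ≡ ∑ xs f * k
∑-*ʳ []       k f = refl
∑-*ʳ (x ∷ xs) k f rewrite ∑-*ʳ xs k f = sym (*-distribʳ-+ k (f x) (∑ xs f))

∑-concatMap : ∀ (g : A → List B) xs (f : B → ℕ) → ∑ (concatMap g xs) f ≡ ∑ xs (λ x → ∑ (g x) f)
∑-concatMap g []       f = refl
∑-concatMap g (x ∷ xs) f =
  trans (∑-++ (g x) (concatMap g xs) f) (cong (∑ (g x) f +_) (∑-concatMap g xs f))

-- Adding and removing a box

guard : ∀ {P : Set} → Dec P → A → List A
guard (yes _) x = x ∷ []
guard (no _)  x = []

-- Strict partitions with parts below `b`, where each tail is bounded by the part before it. This is
-- the hypothesis that an induction on the list can hand on.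
data StrictBelow : ℕ → List ℕ → Set where
  []  : ∀ {b} → StrictBelow b []
  _∷_ : ∀ {b a ν} → 0 < a × a < b → StrictBelow a ν → StrictBelow b (a ∷ ν)

-- The phantom part 0 of the empty list lets the last row be tested like any other.
head : List ℕ → ℕ
head []      = 0
head (a ∷ _) = a

-- A pair (x , μ) records the content x of the box by which two strict
-- partitions differ.  The bound b on the parts turns ups into a recursion on the list.

lower : ℕ → List ℕ → List (ℕ × List ℕ)
lower zero          ν = []
-- Under `StrictBelow` a part 1 is the last one, so the row disappears with its box.
lower (suc zero)    ν = (1 , ν) ∷ []
lower (suc (suc a)) ν = guard (head ν <? suc a) (suc (suc a) , suc a ∷ ν)

raise : ℕ → ℕ → List ℕ → List (ℕ × List ℕ)
raise b a ν = guard (suc a <? b) (suc a , suc a ∷ ν)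

downs : List ℕ → List (ℕ × List ℕ)
downs []      = []
downs (a ∷ ν) = lower a ν ++ map (map₂ (a ∷_)) (downs ν)

ups : ℕ → List ℕ → List (ℕ × List ℕ)
-- A new row is a phantom part 0 raised to 1. Deeper rows are bounded by the part just above them,
-- which keeps the result strict.
ups b []      = raise b 0 []
ups b (a ∷ ν) = raise b a ν ++ map (map₂ (a ∷_)) (ups a ν)

downSum : (List ℕ → ℕ) → List ℕ → ℕ
downSum Φ λs = ∑ (downs λs) (Φ ∘ proj₂)

upSum : ℕ → (ℕ → ℕ) → (List ℕ → ℕ) → List ℕ → ℕ
upSum b c Φ λs = ∑ (ups b λs) (λ (x , κ) → c x * Φ κ)

-- Here the inner corners are the removable boxes; in `outerSum` the outer corners are the places
-- for a new box. Both sums are diagonal coefficients in `commutation`.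
innerSum : (ℕ → ℕ) → List ℕ → ℕ
innerSum c λs = ∑ (downs λs) (c ∘ proj₁)

outerSum : ℕ → (ℕ → ℕ) → List ℕ → ℕ
outerSum b c λs = ∑ (ups b λs) (c ∘ proj₁)

∑-downs-∷ : ∀ a ν (h : ℕ × List ℕ → ℕ) →
            ∑ (downs (a ∷ ν)) h ≡ ∑ (lower a ν) h + ∑ (downs ν) (h ∘ map₂ (a ∷_))
∑-downs-∷ a ν h = trans (∑-++ (lower a ν) _ h) (cong (∑ (lower a ν) h +_) (∑-map _ (downs ν) h))

∑-ups-∷ : ∀ b a ν (h : ℕ × List ℕ → ℕ) →
          ∑ (ups b (a ∷ ν)) h ≡ ∑ (raise b a ν) h + ∑ (ups a ν) (h ∘ map₂ (a ∷_))
∑-ups-∷ b a ν h = trans (∑-++ (raise b a ν) _ h) (cong (∑ (raise b a ν) h +_) (∑-map _ (ups a ν) h))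

head-< : ∀ {b λs} → 0 < b → StrictBelow b λs → head λs < b
head-< 0<b []             = 0<b
head-< _   ((_ , a<b) ∷ _) = a<b

tighten : ∀ {a b λs} → head λs < a → StrictBelow b λs → StrictBelow a λs
tighten _   []               = []
tighten h<a ((0<a , _) ∷ s) = (0<a , h<a) ∷ s

private
  lowerSum : (List ℕ → ℕ) → ℕ → List ℕ → ℕ
  lowerSum Φ a ν = ∑ (lower a ν) (Φ ∘ proj₂)

  -- Lowering a part commutes with additions below it. The larger bound on the left admits one more
  -- addition, raising the head of `ν` to 1 + a, but that addition blocks the lowering and
  -- contributes 0.
  upSum-lowerSum : ∀ c Φ a ν → StrictBelow (suc a) ν →
            upSum (suc (suc a)) c (lowerSum Φ (suc (suc a))) ν ≡ upSum (suc a) c (Φ ∘ (suc a ∷_)) ν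
  upSum-lowerSum c Φ a [] _ with 1 <? suc a
  ... | yes _ = cong (λ y → c 1 * y + 0) (+-identityʳ _)
  ... | no _ = cong (_+ 0) (*-zeroʳ (c 1))
  upSum-lowerSum c Φ a (d ∷ ρ) ((0<d , d<1+a) ∷ s) = begin
    upSum (2 + a) c (lowerSum Φ (2 + a)) (d ∷ ρ)
      ≡⟨ ∑-ups-∷ (2 + a) d ρ (λ (x , κ) → c x * lowerSum Φ (2 + a) κ) ⟩
    ∑ (raise (2 + a) d ρ) (λ (x , κ) → c x * lowerSum Φ (2 + a) κ)
      + ∑ (ups d ρ) (λ (x , κ) → c x * lowerSum Φ (2 + a) (d ∷ κ))
      ≡⟨ cong₂ _+_ first (∑-cong (ups d ρ) λ {p} _ → cong (c (proj₁ p) *_) (rest (proj₂ p))) ⟩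
    ∑ (raise (1 + a) d ρ) (λ (x , κ) → c x * Φ (suc a ∷ κ))
      + ∑ (ups d ρ) (λ (x , κ) → c x * Φ (suc a ∷ d ∷ κ))
      ≡⟨ ∑-ups-∷ (1 + a) d ρ (λ (x , κ) → c x * Φ (suc a ∷ κ)) ⟨
    upSum (1 + a) c (Φ ∘ (suc a ∷_)) (d ∷ ρ) ∎
    where
    open ≡-Reasoning
    rest : ∀ κ → lowerSum Φ (2 + a) (d ∷ κ) ≡ Φ (suc a ∷ d ∷ κ)
    rest κ with d <? suc a
    ... | yes _ = +-identityʳ _
    ... | no d≮ = contradiction d<1+a d≮
    first : ∑ (raise (2 + a) d ρ) (λ (x , κ) → c x * lowerSum Φ (2 + a) κ)
          ≡ ∑ (raise (1 + a) d ρ) (λ (x , κ) → c x * Φ (suc a ∷ κ))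
    first with suc d <? suc (suc a)
    ... | no d≮ = contradiction (s≤s d<1+a) d≮
    ... | yes _ with suc d <? suc a
    ...   | yes _ = cong (λ y → c (suc d) * y + 0) (+-identityʳ _)
    ...   | no _ = cong (_+ 0) (*-zeroʳ (c (suc d)))

  -- The part 1 + a directly beneath blocks the lowering of 2 + a, and no addition makes it smaller.
  upSum-lowerSum-blocked : ∀ c Φ a ρ → upSum (suc (suc a)) c (lowerSum Φ (suc (suc a))) (suc a ∷ ρ) ≡ 0
  upSum-lowerSum-blocked c Φ a ρ = begin
    upSum (2 + a) c (lowerSum Φ (2 + a)) (suc a ∷ ρ)
      ≡⟨ ∑-ups-∷ (2 + a) (suc a) ρ (λ (x , κ) → c x * lowerSum Φ (2 + a) κ) ⟩
    ∑ (raise (2 + a) (suc a) ρ) (λ (x , κ) → c x * lowerSum Φ (2 + a) κ)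
      + ∑ (ups (suc a) ρ) (λ (x , κ) → c x * lowerSum Φ (2 + a) (suc a ∷ κ))
      ≡⟨ cong₂ _+_ first (∑-cong (ups (suc a) ρ) λ {p} _ → cong (c (proj₁ p) *_) (rest (proj₂ p))) ⟩
    0 + ∑ (ups (suc a) ρ) (λ (x , κ) → c x * 0)
      ≡⟨ ∑-*ʳ (ups (suc a) ρ) 0 (c ∘ proj₁) ⟩
    ∑ (ups (suc a) ρ) (c ∘ proj₁) * 0
      ≡⟨ *-zeroʳ (outerSum (suc a) c ρ) ⟩
    0 ∎
    where
    open ≡-Reasoning
    rest : ∀ κ → lowerSum Φ (2 + a) (suc a ∷ κ) ≡ 0
    rest κ with suc a <? suc a
    ... | yes a<a = contradiction a<a (<-irrefl refl)
    ... | no _ = refl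
    first : ∑ (raise (2 + a) (suc a) ρ) (λ (x , κ) → c x * lowerSum Φ (2 + a) κ) ≡ 0
    first with suc (suc a) <? suc (suc a)
    ... | yes a<a = contradiction a<a (<-irrefl refl)
    ... | no _ = refl

  -- After the first part has been lowered, a box is added either back to it, which gives the
  -- diagonal term and is permitted by `a < b`, or to the tail, where `upSum-lowerSum` applies.
  lower-raise : ∀ {b} c Φ a ν → 0 < a → a < b → StrictBelow a ν →
                upSum a c (lowerSum Φ a) ν + ∑ (lower a ν) (c ∘ proj₁) * Φ (a ∷ ν) ≡ lowerSum (upSum b c Φ) a ν
  lower-raise {b} c Φ (suc zero) [] 0<a a<b [] with 1 <? b
  ... | yes _ = lemma (c 1) (Φ (1 ∷ []))
    where
    lemma : ∀ x y → (x + 0) * y ≡ x * y + 0 + 0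
    lemma = solve-∀
  ... | no 1≮b = contradiction a<b 1≮b
  lower-raise c Φ (suc zero) (_ ∷ _) _ _ ((s≤s _ , s≤s ()) ∷ _)
  lower-raise {b} c Φ (suc (suc a)) ν 0<a a<b s with head ν <? suc a
  ... | yes h<a rewrite upSum-lowerSum c Φ a ν (tighten h<a s)
                      | ∑-ups-∷ b (suc a) ν (λ (x , κ) → c x * Φ κ)
      with 2 + a <? b
  ...   | yes _ = lemma (upSum (suc a) c (Φ ∘ (suc a ∷_)) ν) (c (2 + a)) (Φ (2 + a ∷ ν))
    where
    lemma : ∀ d x y → d + (x + 0) * y ≡ x * y + 0 + d + 0
    lemma = solve-∀
  ...   | no a≮b = contradiction a<b a≮b
  lower-raise c Φ (suc (suc a)) [] _ _ _ | no h≮a = contradiction (s≤s z≤n) h≮a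
  lower-raise c Φ (suc (suc a)) (d ∷ ρ) _ _ ((_ , s≤s d≤1+a) ∷ s) | no h≮a
    rewrite ≤-antisym d≤1+a (≮⇒≥ h≮a) = trans (+-identityʳ _) (upSum-lowerSum-blocked c Φ a ρ)

downSum-cong : ∀ {Φ Ψ} λs → (∀ μ → Φ μ ≡ Ψ μ) → downSum Φ λs ≡ downSum Ψ λs
downSum-cong λs eq = ∑-cong (downs λs) (λ {p} _ → eq (proj₂ p))

-- Adding and then removing the same box contributes `outerSum`, the reverse order `innerSum`. For
-- different boxes the induction separates the rows: `lower-raise` treats a lowered first part,
-- `raise-lower` a raised one, and the hypothesis the case of two boxes in the tail. It is valid for
-- the truncated additions with any bound `b` above the parts.
commutation : ∀ {b λs} c Φ → StrictBelow b λs →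
              upSum b c (downSum Φ) λs + innerSum c λs * Φ λs ≡ downSum (upSum b c Φ) λs + outerSum b c λs * Φ λs
commutation {b} c Φ [] with 1 <? b
... | yes _ = lemma (c 1) (Φ [])
  where
  lemma : ∀ x y → x * (y + 0) + 0 + 0 ≡ (x + 0) * y
  lemma = solve-∀
... | no _ = refl
commutation {b} {a ∷ ν} c Φ ((0<a , a<b) ∷ s) = begin
  upSum b c (downSum Φ) (a ∷ ν) + innerSum c (a ∷ ν) * Φ (a ∷ ν)
    ≡⟨ cong₂ (λ x y → x + y * Φ (a ∷ ν)) lhs (∑-downs-∷ a ν (c ∘ proj₁)) ⟩
  (∑ (raise b a ν) (c ∘ proj₁) * Φ (a ∷ ν) + R + (upSum a c (lowerSum Φ a) ν + upSum a c (downSum Φa) ν)) +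
      (i₁ + innerSum c ν) * Φ (a ∷ ν)
    ≡⟨ lemma₁ (∑ (raise b a ν) (c ∘ proj₁)) (Φ (a ∷ ν)) R (upSum a c (lowerSum Φ a) ν)
         (upSum a c (downSum Φa) ν) i₁ (innerSum c ν) ⟩
  ∑ (raise b a ν) (c ∘ proj₁) * Φ (a ∷ ν) + R + (upSum a c (lowerSum Φ a) ν + i₁ * Φ (a ∷ ν)) +
      (upSum a c (downSum Φa) ν + innerSum c ν * Φ (a ∷ ν))
    ≡⟨ cong₂ (λ x y → ∑ (raise b a ν) (c ∘ proj₁) * Φ (a ∷ ν) + R + x + y) (lower-raise c Φ a ν 0<a a<b s)
         (commutation c Φa s) ⟩
  ∑ (raise b a ν) (c ∘ proj₁) * Φ (a ∷ ν) + R + lowerSum (upSum b c Φ) a ν +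
      (downSum (upSum a c Φa) ν + outerSum a c ν * Φ (a ∷ ν))
    ≡⟨ lemma₂ (∑ (raise b a ν) (c ∘ proj₁)) (Φ (a ∷ ν)) R (lowerSum (upSum b c Φ) a ν)
         (downSum (upSum a c Φa) ν) (outerSum a c ν) ⟩
  lowerSum (upSum b c Φ) a ν + (R + downSum (upSum a c Φa) ν) +
      (∑ (raise b a ν) (c ∘ proj₁) + outerSum a c ν) * Φ (a ∷ ν)
    ≡⟨ cong₂ (λ x y → x + y * Φ (a ∷ ν)) rhs (∑-ups-∷ b a ν (c ∘ proj₁)) ⟨
  downSum (upSum b c Φ) (a ∷ ν) + outerSum b c (a ∷ ν) * Φ (a ∷ ν) ∎
  where
  open ≡-Reasoning
  Φa : List ℕ → ℕ
  Φa = Φ ∘ (a ∷_)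
  i₁ R : ℕ
  i₁ = ∑ (lower a ν) (c ∘ proj₁)
  R = downSum (λ μ → ∑ (raise b a μ) (λ (x , κ) → c x * Φ κ)) ν
  lemma₁ : ∀ r φ R d₁ d₂ i j → (r * φ + R + (d₁ + d₂)) + (i + j) * φ ≡ r * φ + R + (d₁ + i * φ) + (d₂ + j * φ)
  lemma₁ = solve-∀
  lemma₂ : ∀ r φ R l u o → r * φ + R + l + (u + o * φ) ≡ l + (R + u) + (r + o) * φ
  lemma₂ = solve-∀
  -- From a raised first part one removes either the new box, which `head ν < a` permits and which
  -- gives the diagonal term, or a box of the tail. The latter terms are `R`, which both orders of
  -- composition share.
  raise-lower : ∀ ν → head ν < a → ∑ (raise b a ν) (λ (x , κ) → c x * downSum Φ κ)
              ≡ ∑ (raise b a ν) (c ∘ proj₁) * Φ (a ∷ ν) + downSum (λ μ → ∑ (raise b a μ) (λ (x , κ) → c x * Φ κ)) ν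
  raise-lower ν h<a with suc a <? b
  ... | no _ = sym (trans (∑-*ʳ (downs ν) 0 (λ _ → 0)) (*-zeroʳ (∑ (downs ν) (λ _ → 0))))
  ... | yes _ rewrite ∑-downs-∷ (suc a) ν (Φ ∘ proj₂) = begin
    c (suc a) * (lowerSum Φ (suc a) ν + downSum (Φ ∘ (suc a ∷_)) ν) + 0
      ≡⟨ cong (λ l → c (suc a) * (l + downSum (Φ ∘ (suc a ∷_)) ν) + 0) (removable ν 0<a h<a) ⟩
    c (suc a) * (Φ (a ∷ ν) + downSum (Φ ∘ (suc a ∷_)) ν) + 0
      ≡⟨ lemma (c (suc a)) (Φ (a ∷ ν)) (downSum (Φ ∘ (suc a ∷_)) ν) ⟩
    (c (suc a) + 0) * Φ (a ∷ ν) + c (suc a) * downSum (Φ ∘ (suc a ∷_)) ν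
      ≡⟨ cong ((c (suc a) + 0) * Φ (a ∷ ν) +_) (∑-*ˡ (downs ν) (c (suc a)) (λ p → Φ (suc a ∷ proj₂ p))) ⟨
    (c (suc a) + 0) * Φ (a ∷ ν) + downSum (λ μ → c (suc a) * Φ (suc a ∷ μ)) ν
      ≡⟨ cong ((c (suc a) + 0) * Φ (a ∷ ν) +_) (downSum-cong ν (λ μ → sym (+-identityʳ _))) ⟩
    (c (suc a) + 0) * Φ (a ∷ ν) + downSum (λ μ → c (suc a) * Φ (suc a ∷ μ) + 0) ν ∎
    where
    lemma : ∀ x y z → x * (y + z) + 0 ≡ (x + 0) * y + x * z
    lemma = solve-∀
    removable : ∀ {a} ν → 0 < a → head ν < a → lowerSum Φ (suc a) ν ≡ Φ (a ∷ ν)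
    removable {suc a} ν _ h<a with head ν <? suc a
    ... | yes _ = +-identityʳ _
    ... | no h≮a = contradiction h<a h≮a
  lhs : upSum b c (downSum Φ) (a ∷ ν) ≡ ∑ (raise b a ν) (c ∘ proj₁) * Φ (a ∷ ν) + R +
      (upSum a c (lowerSum Φ a) ν + upSum a c (downSum Φa) ν)
  lhs = begin
    upSum b c (downSum Φ) (a ∷ ν)
      ≡⟨ ∑-ups-∷ b a ν (λ (x , κ) → c x * downSum Φ κ) ⟩
    ∑ (raise b a ν) (λ (x , κ) → c x * downSum Φ κ) + ∑ (ups a ν) (λ (x , κ) → c x * downSum Φ (a ∷ κ))
      ≡⟨ cong₂ _+_ (raise-lower ν (head-< 0<a s))
           (∑-cong (ups a ν) λ {p} _ → trans (cong (c (proj₁ p) *_) (∑-downs-∷ a (proj₂ p) (Φ ∘ proj₂)))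
               (*-distribˡ-+ (c (proj₁ p)) _ _)) ⟩
    ∑ (raise b a ν) (c ∘ proj₁) * Φ (a ∷ ν) + R
      + ∑ (ups a ν) (λ (x , κ) → c x * lowerSum Φ a κ + c x * downSum Φa κ)
      ≡⟨ cong (∑ (raise b a ν) (c ∘ proj₁) * Φ (a ∷ ν) + R +_) (∑-+ (ups a ν) _ _) ⟩
    ∑ (raise b a ν) (c ∘ proj₁) * Φ (a ∷ ν) + R + (upSum a c (lowerSum Φ a) ν + upSum a c (downSum Φa) ν) ∎
  rhs : downSum (upSum b c Φ) (a ∷ ν) ≡ lowerSum (upSum b c Φ) a ν + (R + downSum (upSum a c Φa) ν)
  rhs = begin
    downSum (upSum b c Φ) (a ∷ ν)
      ≡⟨ ∑-downs-∷ a ν (upSum b c Φ ∘ proj₂) ⟩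
    lowerSum (upSum b c Φ) a ν + downSum (λ μ → upSum b c Φ (a ∷ μ)) ν
      ≡⟨ cong (lowerSum (upSum b c Φ) a ν +_) (trans
           (downSum-cong ν λ μ → ∑-ups-∷ b a μ (λ (x , κ) → c x * Φ κ)) (∑-+ (downs ν) _ _)) ⟩
    lowerSum (upSum b c Φ) a ν + (R + downSum (upSum a c Φa) ν) ∎

-- Double counting of pairs of partitions that differ by one box

Unique-set⇒↭ : ∀ {xs ys : List A} → Unique xs → Unique ys →
               (∀ {x} → x ∈ xs → x ∈ ys) → (∀ {x} → x ∈ ys → x ∈ xs) → xs ↭ ys
Unique-set⇒↭ uxs uys to from = ∼bag⇒↭ (unique∧set⇒bag uxs uys (mk⇔ to from))

∑-↭ : ∀ {xs ys : List A} (f : A → ℕ) → xs ↭ ys → ∑ xs f ≡ ∑ ys f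
∑-↭ f xs↭ys = sum-↭ (map⁺ f xs↭ys)

fibres : (A → List B) → List A → List (A × B)
fibres f = concatMap (λ x → map (x ,_) (f x))

∈-fibres⁺ : ∀ (f : A → List B) {xs x y} → x ∈ xs → y ∈ f x → (x , y) ∈ fibres f xs
∈-fibres⁺ f {x ∷ xs} (here refl) y∈ = ∈-++⁺ˡ (∈-map⁺ (x ,_) y∈)
∈-fibres⁺ f {x ∷ xs} (there x∈)  y∈ = ∈-++⁺ʳ (map (x ,_) (f x)) (∈-fibres⁺ f x∈ y∈)

∈-fibres⁻ : ∀ (f : A → List B) xs {x y} → (x , y) ∈ fibres f xs → x ∈ xs × y ∈ f x
∈-fibres⁻ f (x ∷ xs) xy∈ with ∈-++⁻ (map (x ,_) (f x)) xy∈
... | inj₂ xy∈′ = let x∈ , y∈ = ∈-fibres⁻ f xs xy∈′ in there x∈ , y∈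
... | inj₁ xy∈′ with ∈-map⁻ (x ,_) xy∈′
...   | _ , y∈ , refl = here refl , y∈

Unique-fibres : ∀ (f : A → List B) {xs} → Unique xs → (∀ {x} → x ∈ xs → Unique (f x)) →
                Unique (fibres f xs)
Unique-fibres f []            uf = []
Unique-fibres f {x ∷ xs} (x∉ ∷ uxs) uf =
  Unique.++⁺ (Unique.map⁺ (λ { refl → refl }) (uf (here refl))) (Unique-fibres f uxs (uf ∘ there)) disjoint
  where
  disjoint : ∀ {p} → ¬ (p ∈ map (x ,_) (f x) × p ∈ fibres f xs)
  disjoint (∈₁ , ∈₂) with ∈-map⁻ (x ,_) ∈₁
  ... | _ , _ , refl = All.lookup x∉ (proj₁ (∈-fibres⁻ f xs ∈₂)) refl

∑-fibres : ∀ (f : A → List B) xs (h : A × B → ℕ) → ∑ (fibres f xs) h ≡ ∑ xs (λ x → ∑ (f x) (λ y → h (x , y)))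
∑-fibres f xs h = trans (∑-concatMap (λ x → map (x ,_) (f x)) xs h) (∑-cong xs (λ {x} _ → ∑-map (x ,_) (f x) h))

-- Both sides sum over the edges, labelled in `E`, of one bipartite graph: the two enumerations have
-- the same members and no repetitions, so one is a permutation of the other.
∑-swap : ∀ {xs : List A} {ys : List B} {f : A → List (E × B)} {g : B → List (E × A)} (h : A → E → B → ℕ) →
         Unique xs → Unique ys → (∀ {x} → x ∈ xs → Unique (f x)) → (∀ {y} → y ∈ ys → Unique (g y)) →
         (∀ {x p y} → x ∈ xs → (p , y) ∈ f x → y ∈ ys × (p , x) ∈ g y) →
         (∀ {x p y} → y ∈ ys → (p , x) ∈ g y → x ∈ xs × (p , y) ∈ f x) →
         ∑ xs (λ x → ∑ (f x) (λ (p , y) → h x p y)) ≡ ∑ ys (λ y → ∑ (g y) (λ (p , x) → h x p y))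
∑-swap {xs = xs} {ys} {f} {g} h uxs uys uf ug to from = begin
  ∑ xs (λ x → ∑ (f x) (λ (p , y) → h x p y))
    ≡⟨ ∑-fibres f xs (λ (x , p , y) → h x p y) ⟨
  ∑ (fibres f xs) (λ (x , p , y) → h x p y)
    ≡⟨ ∑-↭ _ (Unique-set⇒↭ (Unique-fibres f uxs uf) (Unique.map⁺ flip-injective (Unique-fibres g uys ug)) to′ from′) ⟩
  ∑ (map flip (fibres g ys)) (λ (x , p , y) → h x p y)
    ≡⟨ ∑-map flip (fibres g ys) (λ (x , p , y) → h x p y) ⟩
  ∑ (fibres g ys) (λ (y , p , x) → h x p y)
    ≡⟨ ∑-fibres g ys (λ (y , p , x) → h x p y) ⟩
  ∑ ys (λ y → ∑ (g y) (λ (p , x) → h x p y)) ∎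
  where
  open ≡-Reasoning
  flip : _ × _ × _ → _ × _ × _
  flip (y , p , x) = x , p , y
  flip-injective : ∀ {s t} → flip s ≡ flip t → s ≡ t
  flip-injective refl = refl
  to′ : ∀ {t} → t ∈ fibres f xs → t ∈ map flip (fibres g ys)
  to′ t∈ = let x∈ , y∈ = ∈-fibres⁻ f xs t∈ ; y∈′ , x∈′ = to x∈ y∈ in ∈-map⁺ flip (∈-fibres⁺ g y∈′ x∈′)
  from′ : ∀ {t} → t ∈ map flip (fibres g ys) → t ∈ fibres f xs
  from′ t∈ with ∈-map⁻ flip t∈
  ... | _ , s∈ , refl = let y∈ , x∈ = ∈-fibres⁻ g ys s∈ ; x∈′ , y∈′ = from y∈ x∈ in ∈-fibres⁺ f x∈′ y∈′

∈-guard⁺ : ∀ {P : Set} (P? : Dec P) {x : A} → P → x ∈ guard P? x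
∈-guard⁺ (yes _) _ = here refl
∈-guard⁺ (no ¬p) p = contradiction p ¬p

∈-guard⁻ : ∀ {P : Set} (P? : Dec P) {x y : A} → y ∈ guard P? x → P × y ≡ x
∈-guard⁻ (yes p) (here eq) = p , eq

Unique-guard : ∀ {P : Set} (P? : Dec P) {x : A} → Unique (guard P? x)
Unique-guard (yes _) = [] ∷ []
Unique-guard (no _)  = []

private
  ∷-injective₂ : ∀ {a} {s t : ℕ × List ℕ} → map₂ (a ∷_) s ≡ map₂ (a ∷_) t → s ≡ t
  ∷-injective₂ refl = refl

downs-unique : ∀ {b λs} → StrictBelow b λs → Unique (downs λs)
downs-unique [] = []
downs-unique {λs = suc zero ∷ []} (_ ∷ []) = [] ∷ []
downs-unique {λs = suc zero ∷ _ ∷ _} (_ ∷ ((s≤s _ , s≤s ()) ∷ _))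
downs-unique {λs = suc (suc a) ∷ ν} (_ ∷ s) =
  Unique.++⁺ (Unique-guard (head ν <? suc a)) (Unique.map⁺ ∷-injective₂ (downs-unique s)) disjoint
  where
  disjoint : ∀ {p} → ¬ (p ∈ lower (2 + a) ν × p ∈ map (map₂ (2 + a ∷_)) (downs ν))
  disjoint (∈₁ , ∈₂) with ∈-guard⁻ (head ν <? suc a) ∈₁ | ∈-map⁻ (map₂ (2 + a ∷_)) ∈₂
  ... | _ , refl | _ , _ , ()

ups-unique : ∀ b λs → Unique (ups b λs)
ups-unique b [] = Unique-guard (1 <? b)
ups-unique b (a ∷ ν) =
  Unique.++⁺ (Unique-guard (suc a <? b)) (Unique.map⁺ ∷-injective₂ (ups-unique a ν)) disjoint
  where
  disjoint : ∀ {p} → ¬ (p ∈ raise b a ν × p ∈ map (map₂ (a ∷_)) (ups a ν))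
  disjoint (∈₁ , ∈₂) with ∈-guard⁻ (suc a <? b) ∈₁ | ∈-map⁻ (map₂ (a ∷_)) ∈₂
  ... | _ , refl | _ , _ , ()

-- The relation that `downs` lists from the larger partition and `ups` from the smaller one. It
-- carries no bound, so the two enumerations are matched through it.
data Box-removal : ℕ → List ℕ → List ℕ → Set where
  single  : Box-removal 1 (1 ∷ []) []
  here  : ∀ {a ν} → head ν < suc a → Box-removal (2 + a) (2 + a ∷ ν) (suc a ∷ ν)
  there : ∀ {x a ν μ} → Box-removal x ν μ → Box-removal x (a ∷ ν) (a ∷ μ)

downs-removal : ∀ {b λs x μ} → StrictBelow b λs → (x , μ) ∈ downs λs → Box-removal x λs μ
downs-removal {λs = suc zero ∷ []} (_ ∷ []) (here refl) = single
downs-removal {λs = suc zero ∷ _ ∷ _} (_ ∷ ((s≤s _ , s≤s ()) ∷ _)) _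
downs-removal {λs = suc (suc a) ∷ ν} (_ ∷ s) p∈ with ∈-++⁻ (lower (2 + a) ν) p∈
... | inj₁ p∈′ with ∈-guard⁻ (head ν <? suc a) p∈′
...   | h< , refl = here h<
downs-removal {λs = suc (suc a) ∷ ν} (_ ∷ s) p∈ | inj₂ p∈′ with ∈-map⁻ (map₂ (2 + a ∷_)) p∈′
... | _ , q∈ , refl = there (downs-removal s q∈)

removal-downs : ∀ {λs x μ} → Box-removal x λs μ → (x , μ) ∈ downs λs
removal-downs single = here refl
removal-downs (here {a} {ν} h<) = ∈-++⁺ˡ (∈-guard⁺ (head ν <? suc a) h<)
removal-downs (there {a = a} {ν} r) = ∈-++⁺ʳ (lower a ν) (∈-map⁺ (map₂ (a ∷_)) (removal-downs r))

ups-removal : ∀ {b μ x λs} → StrictBelow b μ → (x , λs) ∈ ups b μ → Box-removal x λs μ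
ups-removal {b} [] p∈ with ∈-guard⁻ (1 <? b) p∈
... | _ , refl = single
ups-removal {b} {suc a ∷ ν} (_ ∷ s) p∈ with ∈-++⁻ (raise b (suc a) ν) p∈
... | inj₁ p∈′ with ∈-guard⁻ (2 + a <? b) p∈′
...   | _ , refl = here (head-< (s≤s z≤n) s)
ups-removal {b} {suc a ∷ ν} (_ ∷ s) p∈ | inj₂ p∈′ with ∈-map⁻ (map₂ (suc a ∷_)) p∈′
... | _ , q∈ , refl = there (ups-removal s q∈)

-- The bound is required of the larger partition, since this is what prevents `ups b` from cutting
-- off the addition.
removal-ups : ∀ {b x λs μ} → StrictBelow b λs → Box-removal x λs μ → (x , λs) ∈ ups b μ
removal-ups {b} ((_ , 1<b) ∷ []) single = ∈-guard⁺ (1 <? b) 1<b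
removal-ups {b} ((_ , a<b) ∷ s) (here {a} h<) = ∈-++⁺ˡ (∈-guard⁺ (2 + a <? b) a<b)
removal-ups {b} (_ ∷ s) (there {a = a} {μ = μ} r) =
  ∈-++⁺ʳ (raise b a μ) (∈-map⁺ (map₂ (a ∷_)) (removal-ups s r))

removal-strict : ∀ {b x λs μ} → StrictBelow b λs → Box-removal x λs μ → StrictBelow b μ
removal-strict _ single = []
removal-strict ((_ , a<b) ∷ s) (here h<) = (s≤s z≤n , <-trans (n<1+n _) a<b) ∷ tighten h< s
removal-strict (a< ∷ s) (there r) = a< ∷ removal-strict s r

ups-strict : ∀ {b μ x λs} → StrictBelow b μ → (x , λs) ∈ ups b μ → StrictBelow b λs
ups-strict {b} [] p∈ with ∈-guard⁻ (1 <? b) p∈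
... | 1<b , refl = (s≤s z≤n , 1<b) ∷ []
ups-strict {b} {a ∷ ν} (a< ∷ s) p∈ with ∈-++⁻ (raise b a ν) p∈
... | inj₁ p∈′ with ∈-guard⁻ (suc a <? b) p∈′
...   | a<b , refl = (s≤s z≤n , a<b) ∷ tighten (<-trans (head-< (proj₁ a<) s) (n<1+n _)) s
ups-strict {b} {a ∷ ν} (a< ∷ s) p∈ | inj₂ p∈′ with ∈-map⁻ (map₂ (a ∷_)) p∈′
... | _ , q∈ , refl = a< ∷ ups-strict s q∈

-- The box turns a part x - 1 into x, so the sum of a discrete antiderivative `Γ` of `g` over the
-- parts grows by `g x`. For x = 1 the old part is absent, whence the condition on `Γ 0`.
∑-removal : ∀ {Γ g : ℕ → ℕ} → Γ 0 ≡ 0 → (∀ a → Γ (suc a) ≡ Γ a + g (suc a)) →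
            ∀ {x λs μ} → Box-removal x λs μ → ∑ λs Γ ≡ ∑ μ Γ + g x
∑-removal {Γ} {g} Γ0 Γ+ single = trans (+-identityʳ (Γ 1)) (trans (Γ+ 0) (cong (_+ g 1) Γ0))
∑-removal {Γ} {g} Γ0 Γ+ (here {a} {ν} _) rewrite Γ+ (suc a) = lemma (Γ (suc a)) (g (2 + a)) (∑ ν Γ)
  where
  lemma : ∀ x y z → x + y + z ≡ x + z + y
  lemma = solve-∀
∑-removal {Γ} {g} Γ0 Γ+ {x} (there {a = a} {μ = μ} r) rewrite ∑-removal {Γ} {g} Γ0 Γ+ r = sym
    (+-assoc (Γ a) (∑ μ Γ) (g x))

removal-sum : ∀ {x λs μ} → Box-removal x λs μ → sum λs ≡ suc (sum μ)
removal-sum single = refl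
removal-sum (here _) = refl
removal-sum (there {a = a} {μ = μ} r) rewrite removal-sum r = +-suc a (sum μ)

strictBelow : ∀ {b λs} → IsStrictPartition λs → head λs < b → StrictBelow b λs
strictBelow {λs = []} _ _ = []
strictBelow {λs = a ∷ []} (_ , 0<a ∷ _) a<b = (0<a , a<b) ∷ []
strictBelow {λs = a ∷ a′ ∷ _} (a>a′ ∷ l , 0<a ∷ p) a<b = (0<a , a<b) ∷ strictBelow (l , p) a>a′

isStrictPartition : ∀ {b λs} → StrictBelow b λs → IsStrictPartition λs
isStrictPartition [] = [] , []
isStrictPartition ((0<a , _) ∷ []) = [-] , 0<a ∷ []
isStrictPartition ((0<a , _) ∷ s@((_ , a>a′) ∷ _)) = let l , p = isStrictPartition s in a>a′ ∷ l , 0<a ∷ p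

head≤sum : ∀ λs → head λs ≤ sum λs
head≤sum []      = z≤n
head≤sum (a ∷ ν) = m≤m+n a (sum ν)

∈-strictPartitions⁻ : ∀ {b n λs} → n < b → λs ∈ strictPartitions n → StrictBelow b λs × sum λs ≡ n
∈-strictPartitions⁻ {b} {n} {λs} n<b λs∈ with Equivalence.to (∈-strictPartitions n) λs∈
... | strict , refl = strictBelow strict (≤-<-trans (head≤sum λs) n<b) , refl

∈-strictPartitions⁺ : ∀ {b n λs} → StrictBelow b λs → sum λs ≡ n → λs ∈ strictPartitions n
∈-strictPartitions⁺ {n = n} s eq = Equivalence.from (∈-strictPartitions n) (isStrictPartition s , eq)

-- The pairs are counted once from above and once from below. With `suc n < b` the bound cuts off no
-- addition to a partition of `n`.
downs-ups-adjoint : ∀ {b n} (h : List ℕ → ℕ → List ℕ → ℕ) → suc n < b →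
  ∑ (strictPartitions (suc n)) (λ λs → ∑ (downs λs) (λ (x , μ) → h λs x μ)) ≡
  ∑ (strictPartitions n) (λ μ → ∑ (ups b μ) (λ (x , λs) → h λs x μ))
downs-ups-adjoint {b} {n} h 1+n<b =
  ∑-swap h (strictPartitions-unique (suc n)) (strictPartitions-unique n)
    (λ λs∈ → downs-unique (proj₁ (∈-strictPartitions⁻ 1+n<b λs∈))) (λ {μ} _ → ups-unique b μ) to from
  where
  n<b : n < b
  n<b = <-trans (n<1+n n) 1+n<b
  to : ∀ {λs x μ} → λs ∈ strictPartitions (suc n) → (x , μ) ∈ downs λs →
       μ ∈ strictPartitions n × (x , λs) ∈ ups b μ
  to λs∈ p∈ with ∈-strictPartitions⁻ 1+n<b λs∈
  ... | s , eq = let r = downs-removal s p∈ in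
    ∈-strictPartitions⁺ (removal-strict s r) (suc-injective (trans (sym (removal-sum r)) eq)) , removal-ups s r
  from : ∀ {λs x μ} → μ ∈ strictPartitions n → (x , λs) ∈ ups b μ →
         λs ∈ strictPartitions (suc n) × (x , μ) ∈ downs λs
  from μ∈ p∈ with ∈-strictPartitions⁻ n<b μ∈
  ... | s , refl = let r = ups-removal s p∈ in
    ∈-strictPartitions⁺ (ups-strict s p∈) (removal-sum r) , removal-downs r

-- Standard tableaux

infix 4 _◁_ _◁?_

_◁_ : Box → Box → Set
b ◁ b′ = (row b ≡ row b′ × col b < col b′) ⊎ (col b ≡ col b′ × row b < row b′)

_◁?_ : ∀ b b′ → Dec (b ◁ b′)
b ◁? b′ = ((row b ≟ row b′) ×-dec (col b <? col b′)) ⊎-dec ((col b ≟ col b′) ×-dec (row b <? row b′))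

◁-irrefl : ∀ b → ¬ b ◁ b
◁-irrefl b (inj₁ (_ , b<b)) = <-irrefl refl b<b
◁-irrefl b (inj₂ (_ , b<b)) = <-irrefl refl b<b

-- The boxes form an arbitrary family rather than a diagram, so that deleting any position leaves a
-- problem of the same kind.
Labelling : ∀ {m n} → (Fin m → Box) → (Fin m → Fin n) → Set
Labelling box T = Bijective _≡_ _≡_ T × (∀ p q → box p ◁ box q → T p Fin.< T q)

labelling? : ∀ {m n} (box : Fin m → Box) (T : Fin m → Fin n) → Dec (Labelling box T)
labelling? box T = bijective? T ×-dec Fin.all? (λ p → Fin.all? (λ q → (box p ◁? box q) →-dec (T p Fin.<? T q)))

labelling-cong : ∀ {m n} {box : Fin m → Box} {S T : Fin m → Fin n} → S ≗ T → Labelling box S → Labelling box T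
labelling-cong {box = box} {S} {T} S≗T ((inj , surj) , mono) = (inj′ , surj′) , mono′
  where
  inj′ : ∀ {p q} → T p ≡ T q → p ≡ q
  inj′ {p} {q} eq = inj (trans (S≗T p) (trans eq (sym (S≗T q))))
  surj′ : ∀ y → ∃ λ p → ∀ {z} → z ≡ p → T z ≡ y
  surj′ y = proj₁ (surj y) , λ { refl → trans (sym (S≗T _)) (proj₂ (surj y) refl) }
  mono′ : ∀ p q → box p ◁ box q → T p Fin.< T q
  mono′ p q p◁q = subst₂ Fin._<_ (S≗T p) (S≗T q) (mono p q p◁q)

labellings : ∀ {m} n → (Fin m → Box) → List (Fin (n ^ m))
labellings {m} n box = filter (λ t → labelling? box (finToFun t)) (allFin (n ^ m))

#labellings : ∀ {m} → ℕ → (Fin m → Box) → ℕ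
#labellings n box = length (labellings n box)

-- These are the positions that the largest label may occupy.
MaximalAt : ∀ {m} → (Fin (suc m) → Box) → Fin (suc m) → Set
MaximalAt box p = All (λ b → ¬ box p ◁ b) (tabulate (box ∘ punchIn p))

maximalAt? : ∀ {m} (box : Fin (suc m) → Box) → Decidable (MaximalAt box)
maximalAt? box p = All.all? (λ b → ¬? (box p ◁? b)) (tabulate (box ∘ punchIn p))

funToFin-cong : ∀ {m n} {f g : Fin m → Fin n} → f ≗ g → funToFin f ≡ funToFin g
funToFin-cong {zero}  f≗g = refl
funToFin-cong {suc m} f≗g = cong₂ combine (f≗g zero) (funToFin-cong (f≗g ∘ suc))

data PunchView {m} (p : Fin (suc m)) : Fin (suc m) → Set where
  at   : PunchView p p
  away : ∀ j → PunchView p (punchIn p j)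

punchView : ∀ {m} (p q : Fin (suc m)) → PunchView p q
punchView p q with p Fin.≟ q
... | yes refl = at
... | no p≢q = subst (PunchView p) (Fin.punchIn-punchOut p≢q) (away (punchOut p≢q))

extend : ∀ {m n} → Fin (suc m) → (Fin m → Fin n) → Fin (suc m) → Fin (suc n)
extend {n = n} p T = insertAt (inject₁ ∘ T) p (fromℕ n)

extend-at : ∀ {m n} p (T : Fin m → Fin n) → extend p T p ≡ fromℕ n
extend-at {n = n} p T = insertAt-lookup (inject₁ ∘ T) p (fromℕ n)

extend-away : ∀ {m n} p (T : Fin m → Fin n) j → extend p T (punchIn p j) ≡ inject₁ (T j)
extend-away {n = n} p T j = insertAt-punchIn (inject₁ ∘ T) p (fromℕ n) j

inject₁<fromℕ : ∀ {n} (i : Fin n) → inject₁ i Fin.< fromℕ n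
inject₁<fromℕ {n} i = subst (toℕ (inject₁ i) <_) (sym (Fin.toℕ-fromℕ n)) (Fin.inject₁ℕ< i)

inject₁-mono-< : ∀ {n} {i j : Fin n} → i Fin.< j → inject₁ i Fin.< inject₁ j
inject₁-mono-< {i = i} {j} i<j = subst₂ _<_ (sym (Fin.toℕ-inject₁ i)) (sym (Fin.toℕ-inject₁ j)) i<j

inject₁-cancel-< : ∀ {n} {i j : Fin n} → inject₁ i Fin.< inject₁ j → i Fin.< j
inject₁-cancel-< {i = i} {j} i<j = subst₂ _<_ (Fin.toℕ-inject₁ i) (Fin.toℕ-inject₁ j) i<j

extend-injective : ∀ {m n p q} {S T : Fin m → Fin n} → extend p S ≗ extend q T → p ≡ q × S ≗ T
extend-injective {p = p} {q} {S} {T} eq with punchView q p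
... | at = refl , λ j → Fin.inject₁-injective (trans (sym (extend-away p S j))
    (trans (eq (punchIn p j)) (extend-away p T j)))
... | away j = contradiction (trans (sym (extend-at p S)) (trans (eq p) (extend-away q T j))) Fin.fromℕ≢inject₁

extend-labelling : ∀ {m n} {box : Fin (suc m) → Box} {p} {T : Fin m → Fin n} →
                   MaximalAt box p → Labelling (box ∘ punchIn p) T → Labelling box (extend p T)
extend-labelling {n = n} {box} {p} {T} max ((inj , surj) , mono) = (inj′ , surj′) , mono′
  where
  inj′ : ∀ {i j} → extend p T i ≡ extend p T j → i ≡ j
  inj′ {i} {j} eq with punchView p i | punchView p j
  ... | at | at = refl
  ... | at | away j′ = contradiction (trans (sym (extend-at p T)) (trans eq (extend-away p T j′))) Fin.fromℕ≢inject₁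
  ... | away i′ | at = contradiction (trans (sym (extend-at p T)) (trans (sym eq) (extend-away p T i′)))
      Fin.fromℕ≢inject₁
  ... | away i′ | away j′ = cong (punchIn p) (inj (Fin.inject₁-injective
          (trans (sym (extend-away p T i′)) (trans eq (extend-away p T j′)))))
  surj′ : ∀ y → ∃ λ i → ∀ {z} → z ≡ i → extend p T z ≡ y
  surj′ y with n ≟ toℕ y
  ... | yes n≡y = p , λ { refl → trans (extend-at p T) (Fin.toℕ-injective (trans (Fin.toℕ-fromℕ n) n≡y)) }
  ... | no n≢y = let i , Ti = surj (lower₁ y n≢y) in
    punchIn p i , λ { refl → trans (extend-away p T i) (trans (cong inject₁ (Ti refl)) (Fin.inject₁-lower₁ y n≢y)) }
  mono′ : ∀ i j → box i ◁ box j → extend p T i Fin.< extend p T j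
  mono′ i j i◁j with punchView p i | punchView p j
  ... | at | at = contradiction i◁j (◁-irrefl (box p))
  ... | at | away j′ = contradiction i◁j (All.tabulate⁻ max j′)
  ... | away i′ | at = subst₂ Fin._<_ (sym (extend-away p T i′)) (sym (extend-at p T)) (inject₁<fromℕ (T i′))
  ... | away i′ | away j′ =
    subst₂ Fin._<_ (sym (extend-away p T i′)) (sym (extend-away p T j′)) (inject₁-mono-< (mono i′ j′ i◁j))

-- The box with the largest label is maximal, since a successor would need a larger one. By
-- injectivity all other labels are smaller, so `lower₁` applies to them.
labelling-extend : ∀ {m n} {box : Fin (suc m) → Box} {T : Fin (suc m) → Fin (suc n)} → Labelling box T →
                   ∃ λ p → MaximalAt box p × ∃ λ S → Labelling (box ∘ punchIn p) S × extend p S ≗ T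
labelling-extend {m} {n} {box} {T} ((inj , surj) , mono) = p , max , S , ((inj′ , surj′) , mono′) , extend≗
  where
  p : Fin (suc m)
  p = proj₁ (surj (fromℕ n))
  Tp : T p ≡ fromℕ n
  Tp = proj₂ (surj (fromℕ n)) refl
  max : MaximalAt box p
  max = All.tabulate⁺ λ j p◁j →
    <⇒≱ (subst (Fin._< T (punchIn p j)) Tp (mono p (punchIn p j) p◁j))
        (subst (toℕ (T (punchIn p j)) ≤_) (sym (Fin.toℕ-fromℕ n)) (≤-pred (Fin.toℕ<n (T (punchIn p j)))))
  n≢T : ∀ j → n ≢ toℕ (T (punchIn p j))
  n≢T j eq = Fin.punchInᵢ≢i p j (inj (trans (Fin.toℕ-injective (trans (sym eq) (sym (Fin.toℕ-fromℕ n)))) (sym Tp)))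
  S : Fin m → Fin n
  S j = lower₁ (T (punchIn p j)) (n≢T j)
  inject₁-S : ∀ j → inject₁ (S j) ≡ T (punchIn p j)
  inject₁-S j = Fin.inject₁-lower₁ (T (punchIn p j)) (n≢T j)
  inj′ : ∀ {i j} → S i ≡ S j → i ≡ j
  inj′ {i} {j} eq = Fin.punchIn-injective p i j (inj
      (trans (sym (inject₁-S i)) (trans (cong inject₁ eq) (inject₁-S j))))
  surj′ : ∀ y → ∃ λ i → ∀ {z} → z ≡ i → S z ≡ y
  surj′ y with surj (inject₁ y)
  ... | i , Ti with punchView p i
  ...   | at = contradiction (trans (sym Tp) (Ti refl)) Fin.fromℕ≢inject₁
  ...   | away j = j , λ { refl → Fin.inject₁-injective (trans (inject₁-S j) (Ti refl)) }
  mono′ : ∀ i j → box (punchIn p i) ◁ box (punchIn p j) → S i Fin.< S j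
  mono′ i j i◁j = inject₁-cancel-< (subst₂ Fin._<_ (sym (inject₁-S i)) (sym (inject₁-S j)) (mono _ _ i◁j))
  extend≗ : extend p S ≗ T
  extend≗ i with punchView p i
  ... | at = trans (extend-at p S) (sym Tp)
  ... | away j = trans (extend-away p S j) (inject₁-S j)

length≡∑ : ∀ (xs : List A) → length xs ≡ ∑ xs (λ _ → 1)
length≡∑ []       = refl
length≡∑ (x ∷ xs) = cong suc (length≡∑ xs)

∈-labellings⁻ : ∀ {m n} (box : Fin m → Box) {t} → t ∈ labellings n box → Labelling box (finToFun t)
∈-labellings⁻ {m} {n} box t∈ = proj₂ (∈-filter⁻ (λ t → labelling? box (finToFun t)) {xs = allFin (n ^ m)} t∈)

∈-labellings⁺ : ∀ {m n} (box : Fin m → Box) {t} → Labelling box (finToFun t) → t ∈ labellings n box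
∈-labellings⁺ {m} {n} box {t} l = ∈-filter⁺ (λ t → labelling? box (finToFun t)) (∈-allFin t) l

labellings-unique : ∀ {m} n (box : Fin m → Box) → Unique (labellings n box)
labellings-unique {m} n box = Unique.filter⁺ (λ t → labelling? box (finToFun t)) (Unique.allFin⁺ (n ^ m))

-- Labellings are sorted by the position of the largest label; what remains is an arbitrary
-- labelling of the other boxes.
#labellings-suc : ∀ {m} n (box : Fin (suc m) → Box) →
  #labellings (suc n) box ≡ ∑ (filter (maximalAt? box) (allFin (suc m))) (λ p → #labellings n (box ∘ punchIn p))
#labellings-suc {m} n box = begin
  length (labellings (suc n) box)
    ≡⟨ ↭-length (Unique-set⇒↭ (labellings-unique (suc n) box)
         (Unique.map⁺ (λ {x} {y} → ext-injective {x} {y})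
             (Unique-fibres rest (Unique.filter⁺ (maximalAt? box) (Unique.allFin⁺ (suc m)))
           (λ {p} _ → labellings-unique n (box ∘ punchIn p)))) to from) ⟩
  length (map ext (fibres rest maxima))
    ≡⟨ trans (length-map ext (fibres rest maxima)) (length≡∑ (fibres rest maxima)) ⟩
  ∑ (fibres rest maxima) (λ _ → 1)
    ≡⟨ ∑-fibres rest maxima (λ _ → 1) ⟩
  ∑ maxima (λ p → ∑ (rest p) (λ _ → 1))
    ≡⟨ ∑-cong maxima (λ {p} _ → sym (length≡∑ (rest p))) ⟩
  ∑ maxima (λ p → #labellings n (box ∘ punchIn p)) ∎
  where
  open ≡-Reasoning
  maxima : List (Fin (suc m))
  maxima = filter (maximalAt? box) (allFin (suc m))
  rest : Fin (suc m) → List (Fin (n ^ m))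
  rest p = labellings n (box ∘ punchIn p)
  ext : Fin (suc m) × Fin (n ^ m) → Fin (suc n ^ suc m)
  ext (p , t) = funToFin (extend p (finToFun {n} {m} t))
  finToFun-injective : ∀ {k l} (s t : Fin (k ^ l)) → finToFun {k} {l} s ≗ finToFun t → s ≡ t
  finToFun-injective {k} {l} s t eq =
    trans (sym (Fin.funToFin-finToFin {l} {k} s)) (trans (funToFin-cong eq) (Fin.funToFin-finToFin {l} {k} t))
  ext-injective : ∀ {x y} → ext x ≡ ext y → x ≡ y
  ext-injective {p , s} {q , t} eq with extend-injective {p = p} {q} {finToFun {n} {m} s} {finToFun t}
    (λ i → trans (sym (Fin.finToFun-funToFin (extend p (finToFun {n} {m} s)) i))
      (trans (cong (λ u → finToFun {suc n} {suc m} u i) eq)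
          (Fin.finToFun-funToFin (extend q (finToFun {n} {m} t)) i)))
  ... | refl , s≗t = cong (p ,_) (finToFun-injective s t s≗t)
  extend-cong : ∀ p {S S′ : Fin m → Fin n} → S′ ≗ S → extend p S′ ≗ extend p S
  extend-cong p {S} {S′} eq i with punchView p i
  ... | at = trans (extend-at p S′) (sym (extend-at p S))
  ... | away j = trans (extend-away p S′ j) (trans (cong inject₁ (eq j)) (sym (extend-away p S j)))
  ext-onto : ∀ {t} → (∃ λ p → MaximalAt box p × ∃ λ S → Labelling (box ∘ punchIn p) S × extend p S ≗ finToFun t) →
             t ∈ map ext (fibres rest maxima)
  ext-onto {t} (p , max , S , l , S≗t) = subst (_∈ map ext (fibres rest maxima)) ext≡t
    (∈-map⁺ ext (∈-fibres⁺ rest (∈-filter⁺ (maximalAt? box) (∈-allFin p) max)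
      (∈-labellings⁺ (box ∘ punchIn p) (labelling-cong (λ i → sym (Fin.finToFun-funToFin S i)) l))))
    where
    ext≡t : ext (p , funToFin S) ≡ t
    ext≡t = finToFun-injective (ext (p , funToFin S)) t λ i →
      trans (Fin.finToFun-funToFin (extend p (finToFun (funToFin S))) i)
        (trans (extend-cong p (Fin.finToFun-funToFin S) i) (S≗t i))
  to : ∀ {t} → t ∈ labellings (suc n) box → t ∈ map ext (fibres rest maxima)
  to t∈ = ext-onto (labelling-extend (∈-labellings⁻ box t∈))
  from : ∀ {t} → t ∈ map ext (fibres rest maxima) → t ∈ labellings (suc n) box
  from t∈ with ∈-map⁻ ext t∈
  ... | (p , s) , ps∈ , refl with ∈-fibres⁻ rest maxima ps∈
  ...   | p∈ , s∈ = ∈-labellings⁺ box (labelling-cong (λ i → sym (Fin.finToFun-funToFin (extend p (finToFun s)) i))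
            (extend-labelling (proj₂ (∈-filter⁻ (maximalAt? box) {xs = allFin (suc m)} p∈))
                (∈-labellings⁻ (box ∘ punchIn p) s∈)))

filter-map : ∀ {P : B → Set} {Q : A → Set} (P? : Decidable P) (Q? : Decidable Q) (g : A → B) xs →
             (∀ {x} → x ∈ xs → P (g x) → Q x) → (∀ {x} → x ∈ xs → Q x → P (g x)) →
             filter P? (map g xs) ≡ map g (filter Q? xs)
filter-map P? Q? g []       to from = refl
filter-map P? Q? g (x ∷ xs) to from with P? (g x) | Q? x
... | yes _ | yes _ = cong (g x ∷_) (filter-map P? Q? g xs (to ∘ there) (from ∘ there))
... | no _ | no _ = filter-map P? Q? g xs (to ∘ there) (from ∘ there)
... | yes p | no ¬q = contradiction (to (here refl) p) ¬q
... | no ¬p | yes q = contradiction (from (here refl) q) ¬p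

-- The list counterpart of deleting the position `p` with `punchIn p`. Unlike positions, lists
-- follow the decomposition of a diagram into rows through `++` and `map`.
picks : List A → List (A × List A)
picks []       = []
picks (x ∷ xs) = (x , xs) ∷ map (map₂ (x ∷_)) (picks xs)

picks-tabulate : ∀ {m} (box : Fin (suc m) → A) →
                 picks (tabulate box) ≡ map (λ p → box p , tabulate (box ∘ punchIn p)) (allFin (suc m))
picks-tabulate {m = zero} box = refl
picks-tabulate {m = suc m} box = cong ((box zero , tabulate (box ∘ suc)) ∷_) (begin
  map (map₂ (box zero ∷_)) (picks (tabulate (box ∘ suc)))
    ≡⟨ cong (map (map₂ (box zero ∷_))) (picks-tabulate (box ∘ suc)) ⟩
  map (map₂ (box zero ∷_)) (map (λ p → box (suc p) , tabulate (box ∘ suc ∘ punchIn p)) (allFin (suc m)))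
    ≡⟨ map-∘ (allFin (suc m)) ⟨
  map (λ p → box (suc p) , tabulate (box ∘ punchIn (suc p))) (allFin (suc m))
    ≡⟨ map-tabulate id (λ p → box (suc p) , tabulate (box ∘ punchIn (suc p))) ⟩
  tabulate (λ p → box (suc p) , tabulate (box ∘ punchIn (suc p)))
    ≡⟨ map-tabulate suc (λ p → box p , tabulate (box ∘ punchIn p)) ⟨
  map (λ p → box p , tabulate (box ∘ punchIn p)) (tabulate suc) ∎)
  where open ≡-Reasoning

picks-++ : ∀ (xs ys : List A) →
           picks (xs ++ ys) ≡ map (map₂ (_++ ys)) (picks xs) ++ map (map₂ (xs ++_)) (picks ys)
picks-++ []       ys = sym (map-id (picks ys))
picks-++ (x ∷ xs) ys = cong ((x , xs ++ ys) ∷_) (begin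
  map (map₂ (x ∷_)) (picks (xs ++ ys))
    ≡⟨ cong (map (map₂ (x ∷_))) (picks-++ xs ys) ⟩
  map (map₂ (x ∷_)) (map (map₂ (_++ ys)) (picks xs) ++ map (map₂ (xs ++_)) (picks ys))
    ≡⟨ map-++ (map₂ (x ∷_)) (map (map₂ (_++ ys)) (picks xs)) _ ⟩
  map (map₂ (x ∷_)) (map (map₂ (_++ ys)) (picks xs)) ++ map (map₂ (x ∷_)) (map (map₂ (xs ++_)) (picks ys))
    ≡⟨ cong₂ _++_ (trans (sym (map-∘ (picks xs))) (map-∘ (picks xs))) (sym (map-∘ (picks ys))) ⟩
  map (map₂ (_++ ys)) (map (map₂ (x ∷_)) (picks xs)) ++ map (map₂ ((x ∷ xs) ++_)) (picks ys) ∎)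
  where open ≡-Reasoning

picks-map : ∀ (g : A → B) xs → picks (map g xs) ≡ map (Product.map g (map g)) (picks xs)
picks-map g []       = refl
picks-map g (x ∷ xs) = cong ((g x , map g xs) ∷_) (begin
  map (map₂ (g x ∷_)) (picks (map g xs))                         ≡⟨ cong (map (map₂ (g x ∷_))) (picks-map g xs) ⟩
  map (map₂ (g x ∷_)) (map (Product.map g (map g)) (picks xs))
      ≡⟨ trans (sym (map-∘ (picks xs))) (map-∘ (picks xs)) ⟩
  map (Product.map g (map g)) (map (map₂ (x ∷_)) (picks xs))     ∎)
  where open ≡-Reasoning

∈-picks⇒∈ : ∀ (xs : List A) {y ys} → (y , ys) ∈ picks xs → y ∈ xs
∈-picks⇒∈ (x ∷ xs) (here refl) = here refl
∈-picks⇒∈ (x ∷ xs) (there y∈) with ∈-map⁻ (map₂ (x ∷_)) y∈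
... | _ , y∈′ , refl = there (∈-picks⇒∈ xs y∈′)

Maximal : Box × List Box → Set
Maximal (b , bs) = All (λ b′ → ¬ b ◁ b′) bs

maximal? : Decidable Maximal
maximal? (b , bs) = All.all? (λ b′ → ¬? (b ◁? b′)) bs

removals : List Box → List (List Box)
removals bs = map proj₂ (filter maximal? (picks bs))

#labellings-cong : ∀ {m m′} n {box : Fin m → Box} {box′ : Fin m′ → Box} (eq : m ≡ m′) →
                   (∀ i → box i ≡ box′ (cast eq i)) → #labellings n box ≡ #labellings n box′
#labellings-cong {m} n {box} {box′} refl eq = cong length (filter-≐ _ _ (to , from) (allFin (n ^ m)))
  where
  box≗ : box ≗ box′
  box≗ i = trans (eq i) (cong box′ (Fin.cast-is-id refl i))
  to : ∀ {t} → Labelling box (finToFun {n} {m} t) → Labelling box′ (finToFun t)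
  to (bij , mono) = bij , λ p q p◁q → mono p q (subst₂ _◁_ (sym (box≗ p)) (sym (box≗ q)) p◁q)
  from : ∀ {t} → Labelling box′ (finToFun {n} {m} t) → Labelling box (finToFun t)
  from (bij , mono) = bij , λ p q p◁q → mono p q (subst₂ _◁_ (box≗ p) (box≗ q) p◁q)

#labellings-tabulate : ∀ {m} n (box : Fin m → Box) → #labellings n (lookup (tabulate box)) ≡ #labellings n box
#labellings-tabulate n box = sym (#labellings-cong n (sym (length-tabulate box)) (λ i → sym (lookup-tabulate box i)))

#labellings-removals : ∀ n bs → 0 < length bs → #labellings (suc n) (lookup bs) ≡ ∑ (removals bs)
    (#labellings n ∘ lookup)
#labellings-removals n (b ∷ bs) _ = begin
  #labellings (suc n) box
    ≡⟨ #labellings-suc n box ⟩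
  ∑ (filter (maximalAt? box) (allFin _)) (λ p → #labellings n (box ∘ punchIn p))
    ≡⟨ ∑-cong (filter (maximalAt? box) (allFin _)) (λ {p} _ → sym (#labellings-tabulate n (box ∘ punchIn p))) ⟩
  ∑ (filter (maximalAt? box) (allFin _)) (#labellings n ∘ lookup ∘ proj₂ ∘ pick)
    ≡⟨ ∑-map pick (filter (maximalAt? box) (allFin _)) (#labellings n ∘ lookup ∘ proj₂) ⟨
  ∑ (map pick (filter (maximalAt? box) (allFin _))) (#labellings n ∘ lookup ∘ proj₂)
    ≡⟨ cong (λ xs → ∑ xs (#labellings n ∘ lookup ∘ proj₂))
         (filter-map maximal? (maximalAt? box) pick (allFin _) (λ _ → id) (λ _ → id)) ⟨
  ∑ (filter maximal? (map pick (allFin _))) (#labellings n ∘ lookup ∘ proj₂)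
    ≡⟨ cong (λ xs → ∑ (filter maximal? xs) (#labellings n ∘ lookup ∘ proj₂))
         (trans (sym (picks-tabulate box)) (cong picks (tabulate-lookup (b ∷ bs)))) ⟩
  ∑ (filter maximal? (picks (b ∷ bs))) (#labellings n ∘ lookup ∘ proj₂)
    ≡⟨ ∑-map proj₂ (filter maximal? (picks (b ∷ bs))) (#labellings n ∘ lookup) ⟨
  ∑ (removals (b ∷ bs)) (#labellings n ∘ lookup) ∎
  where
  open ≡-Reasoning
  box : Fin (suc (length bs)) → Box
  box = lookup (b ∷ bs)
  pick : Fin (suc (length bs)) → Box × List Box
  pick p = box p , tabulate (box ∘ punchIn p)

-- Maximal boxes of a shifted diagram

shift : Box → Box
shift (i , j) = suc i , suc j

firstBox : ℕ → Box
firstBox d = 1 , suc (suc d)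

firstRow : ℕ → List Box
firstRow a = map firstBox (upTo a)

-- When a part is prepended, the row index and the starting column of every old row grow by one, so
-- the old diagram moves along the diagonal and its contents are preserved.
diagram-∷ : ∀ a ν → diagram (a ∷ ν) ≡ firstRow a ++ map shift (diagram ν)
diagram-∷ a ν = cong (firstRow a ++_) (begin
  concatMap (diagramRow (a ∷ ν)) (map suc (applyUpTo suc (length ν)))
    ≡⟨ cong (concatMap (diagramRow (a ∷ ν)) ∘ map suc) (sym (map-upTo suc (length ν))) ⟩
  concatMap (diagramRow (a ∷ ν)) (map suc (map suc (upTo (length ν))))
    ≡⟨ concatMap-map (diagramRow (a ∷ ν)) suc (map suc (upTo (length ν))) ⟩
  concatMap (diagramRow (a ∷ ν) ∘ suc) (map suc (upTo (length ν)))
    ≡⟨ concatMap-map (λ i → diagramRow (a ∷ ν) (suc i)) suc (upTo (length ν)) ⟩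
  concatMap (diagramRow (a ∷ ν) ∘ (λ i → suc (suc i))) (upTo (length ν))
    ≡⟨ concatMap-cong (λ i → map-∘ (upTo (part ν (suc i)))) (upTo (length ν)) ⟩
  concatMap (map shift ∘ diagramRow ν ∘ suc) (upTo (length ν))
    ≡⟨ map-concatMap shift (diagramRow ν ∘ suc) (upTo (length ν)) ⟨
  map shift (concatMap (diagramRow ν ∘ suc) (upTo (length ν)))
    ≡⟨ cong (map shift) (concatMap-map (diagramRow ν) suc (upTo (length ν))) ⟨
  map shift (diagram ν) ∎)
  where open ≡-Reasoning

firstRow-suc : ∀ a → firstRow (suc a) ≡ firstRow a ++ firstBox a ∷ []
firstRow-suc a = trans (cong (map firstBox) (sym (upTo-∷ʳ a))) (map-++ firstBox (upTo a) (a ∷ []))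

∈-firstRow⁻ : ∀ {a b} → b ∈ firstRow a → ∃ λ d → d < a × b ≡ firstBox d
∈-firstRow⁻ b∈ with ∈-map⁻ firstBox b∈
... | d , d∈ , eq = d , ∈-upTo⁻ d∈ , eq

-- A row starts one column later than the row above but is shorter by at least one box, so no row
-- reaches past the first.
diagram-bounds : ∀ {c λs b} → StrictBelow c λs → b ∈ diagram λs → 0 < row b × 1 < col b × col b ≤ suc (head λs)
diagram-bounds {λs = a ∷ ν} ((0<a , _) ∷ s) b∈ with ∈-++⁻ (firstRow a) (subst (_ ∈_) (diagram-∷ a ν) b∈)
... | inj₁ b∈′ with ∈-firstRow⁻ b∈′
...   | d , d<a , refl = s≤s z≤n , s≤s (s≤s z≤n) , s≤s d<a
diagram-bounds {λs = a ∷ ν} ((0<a , _) ∷ s) b∈ | inj₂ b∈′ with ∈-map⁻ shift b∈′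
... | _ , b∈″ , refl = let _ , 1<col , col≤ = diagram-bounds s b∈″ in
  s≤s z≤n , ≤-trans 1<col (n≤1+n _) , s≤s (≤-trans col≤ (head-< 0<a s))

private
  shift-◁⁺ : ∀ {b b′} → b ◁ b′ → shift b ◁ shift b′
  shift-◁⁺ (inj₁ (r , c)) = inj₁ (cong suc r , s≤s c)
  shift-◁⁺ (inj₂ (c , r)) = inj₂ (cong suc c , s≤s r)

  shift-◁⁻ : ∀ {b b′} → shift b ◁ shift b′ → b ◁ b′
  shift-◁⁻ (inj₁ (r , s≤s c)) = inj₁ (suc-injective r , c)
  shift-◁⁻ (inj₂ (c , s≤s r)) = inj₂ (suc-injective c , r)

  shift⋪firstBox : ∀ {b} d → 0 < row b → ¬ shift b ◁ firstBox d
  shift⋪firstBox d 0<r (inj₁ (r≡ , _)) = <-irrefl (sym (suc-injective r≡)) 0<r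
  shift⋪firstBox d 0<r (inj₂ (_ , s≤s ()))

-- The relation `_◁_` points right or down, never up, so the first row has no influence on which
-- lower boxes are maximal.
removals-below : ∀ a ν → (∀ {b} → b ∈ diagram ν → 0 < row b) →
  map proj₂ (filter maximal? (map (map₂ (firstRow a ++_)) (picks (map shift (diagram ν))))) ≡
  map (λ bs → firstRow a ++ map shift bs) (removals (diagram ν))
removals-below a ν 0<row = begin
  map proj₂ (filter maximal? (map (map₂ (firstRow a ++_)) (picks (map shift (diagram ν)))))
    ≡⟨ cong (λ xs → map proj₂ (filter maximal? (map (map₂ (firstRow a ++_)) xs))) (picks-map shift (diagram ν)) ⟩
  map proj₂ (filter maximal? (map (map₂ (firstRow a ++_)) (map (Product.map shift (map shift)) (picks (diagram ν)))))
    ≡⟨ cong (map proj₂ ∘ filter maximal?) (sym (map-∘ (picks (diagram ν)))) ⟩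
  map proj₂ (filter maximal? (map below (picks (diagram ν))))
    ≡⟨ cong (map proj₂) (filter-map maximal? maximal? below (picks (diagram ν)) (λ {p} → to {p}) from) ⟩
  map proj₂ (map below (filter maximal? (picks (diagram ν))))
    ≡⟨ trans (sym (map-∘ (filter maximal? (picks (diagram ν))))) (map-∘ (filter maximal? (picks (diagram ν)))) ⟩
  map (λ bs → firstRow a ++ map shift bs) (removals (diagram ν)) ∎
  where
  open ≡-Reasoning
  below : Box × List Box → Box × List Box
  below (b , bs) = shift b , firstRow a ++ map shift bs
  to : ∀ {p} → p ∈ picks (diagram ν) → Maximal (below p) → Maximal p
  to _ max = All.map (_∘ shift-◁⁺) (All.map⁻ (All.++⁻ʳ (firstRow a) max))
  from : ∀ {p} → p ∈ picks (diagram ν) → Maximal p → Maximal (below p)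
  from p∈ max = All.++⁺
    (All.map⁺ (All.universal (λ d → shift⋪firstBox d (0<row (∈-picks⇒∈ (diagram ν) p∈))) (upTo a)))
    (All.map⁺ (All.map (_∘ shift-◁⁻) max))

filter-empty : ∀ {P : A → Set} (P? : Decidable P) xs → (∀ {x} → x ∈ xs → ¬ P x) → filter P? xs ≡ []
filter-empty P? xs ¬P = filter-none P? (All.tabulate ¬P)

-- Every other box of the first row precedes the last one. The last box is maximal unless the next
-- row ends directly beneath it, which is exactly when `lower` is empty.
removals-first : ∀ {a} ν → 0 < a → StrictBelow a ν →
  map proj₂ (filter maximal? (map (map₂ (_++ map shift (diagram ν))) (picks (firstRow a)))) ≡
  map (diagram ∘ proj₂) (lower a ν)
removals-first {suc a} ν _ s = begin
  map proj₂ (filter maximal? (map (map₂ (_++ sh)) (picks (firstRow (suc a)))))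
    ≡⟨ cong (λ xs → map proj₂ (filter maximal? (map (map₂ (_++ sh)) xs)))
         (trans (cong picks (firstRow-suc a)) (picks-++ (firstRow a) (firstBox a ∷ []))) ⟩
  map proj₂ (filter maximal? (map (map₂ (_++ sh)) (map (map₂ (_++ firstBox a ∷ [])) (picks (firstRow a)) ++
      (firstBox a , firstRow a ++ []) ∷ [])))
    ≡⟨ cong (map proj₂ ∘ filter maximal?) (map-++ (map₂ (_++ sh))
         (map (map₂ (_++ firstBox a ∷ [])) (picks (firstRow a))) _) ⟩
  map proj₂ (filter maximal? (map (map₂ (_++ sh)) (map (map₂ (_++ firstBox a ∷ [])) (picks (firstRow a))) ++
      corner ∷ []))
    ≡⟨ cong (map proj₂) (filter-++ maximal? (map (map₂ (_++ sh))
         (map (map₂ (_++ firstBox a ∷ [])) (picks (firstRow a)))) (corner ∷ [])) ⟩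
  map proj₂ (filter maximal? (map (map₂ (_++ sh)) (map (map₂ (_++ firstBox a ∷ [])) (picks (firstRow a))))
      ++ filter maximal? (corner ∷ []))
    ≡⟨ cong (λ xs → map proj₂ (xs ++ filter maximal? (corner ∷ []))) (filter-empty maximal? _ notLast) ⟩
  map proj₂ (filter maximal? (corner ∷ []))
    ≡⟨ lastBox a ν s ⟩
  map (diagram ∘ proj₂) (lower (suc a) ν) ∎
  where
  open ≡-Reasoning
  sh : List Box
  sh = map shift (diagram ν)
  corner : Box × List Box
  corner = firstBox a , (firstRow a ++ []) ++ sh
  notLast : ∀ {p} → p ∈ map (map₂ (_++ sh)) (map (map₂ (_++ firstBox a ∷ [])) (picks (firstRow a))) → ¬ Maximal p
  notLast p∈ max with ∈-map⁻ (map₂ (_++ sh)) p∈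
  ... | _ , p∈′ , refl with ∈-map⁻ (map₂ (_++ firstBox a ∷ [])) p∈′
  ...   | (b , bs) , p∈″ , refl with ∈-firstRow⁻ (∈-picks⇒∈ (firstRow a) p∈″)
  ...     | d , d<a , refl = All.lookup max (∈-++⁺ˡ (∈-++⁺ʳ bs (here refl))) (inj₁ (refl , s≤s (s≤s d<a)))
  ⋪firstRow : ∀ a → All (λ b → ¬ firstBox a ◁ b) (firstRow a)
  ⋪firstRow a = All.tabulate λ b∈ → ⋪ (∈-firstRow⁻ b∈)
    where
    ⋪ : ∀ {b} → (∃ λ d → d < a × b ≡ firstBox d) → ¬ firstBox a ◁ b
    ⋪ (d , d<a , refl) (inj₁ (_ , s≤s (s≤s a<d))) = <-asym d<a a<d
    ⋪ (d , d<a , refl) (inj₂ (_ , s≤s ()))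
  lastBox : ∀ a ν → StrictBelow (suc a) ν →
    map proj₂ (filter maximal? ((firstBox a , (firstRow a ++ []) ++ map shift (diagram ν)) ∷ [])) ≡
    map (diagram ∘ proj₂) (lower (suc a) ν)
  lastBox zero [] [] = refl
  lastBox zero (_ ∷ _) ((s≤s _ , s≤s ()) ∷ _)
  lastBox (suc a) ν s with head ν <? suc a
  ... | yes h< = trans (cong (map proj₂) (filter-accept maximal? max))
      (cong (_∷ []) (trans (cong (_++ map shift (diagram ν)) (++-identityʳ (firstRow (suc a))))
          (sym (diagram-∷ (suc a) ν))))
    where
    ⋪below : ∀ {b} → b ∈ diagram ν → ¬ firstBox (suc a) ◁ shift b
    ⋪below b∈ (inj₁ (r≡ , _)) = <-irrefl (suc-injective r≡) (proj₁ (diagram-bounds s b∈))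
    ⋪below b∈ (inj₂ (c≡ , _)) = <-irrefl (sym (suc-injective c≡))
        (≤-<-trans (proj₂ (proj₂ (diagram-bounds s b∈))) (s≤s h<))
    max : Maximal (firstBox (suc a) , (firstRow (suc a) ++ []) ++ map shift (diagram ν))
    max = All.++⁺ (All.++⁺ (⋪firstRow (suc a)) []) (All.map⁺ (All.tabulate ⋪below))
  ... | no h≮ = cong (map proj₂) (filter-reject maximal? (¬max ν s h≮))
    where
    -- Here the next row is just one box shorter, and the diagonal shift puts its last box directly
    -- under the corner.
    ¬max : ∀ ν → StrictBelow (2 + a) ν → ¬ head ν < suc a →
           ¬ Maximal (firstBox (suc a) , (firstRow (suc a) ++ []) ++ map shift (diagram ν))
    ¬max [] _ h≮ _ = h≮ (s≤s z≤n)
    ¬max (d ∷ ρ) ((_ , s≤s d≤) ∷ _) d≮ max with ≤-antisym d≤ (≮⇒≥ d≮)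
    ... | refl = All.lookup max (∈-++⁺ʳ (firstRow (suc a) ++ [])
        (∈-map⁺ shift (subst (firstBox a ∈_) (sym (diagram-∷ (suc a) ρ))
      (∈-++⁺ˡ (∈-map⁺ firstBox (∈-upTo⁺ (n<1+n a))))))) (inj₂ (refl , s≤s (s≤s z≤n)))

-- A box is maximal exactly when its removal leaves a strict partition. Both sides list these boxes
-- from the top row down, so they agree as lists.
removals-diagram : ∀ {b λs} → StrictBelow b λs → removals (diagram λs) ≡ map (diagram ∘ proj₂) (downs λs)
removals-diagram [] = refl
removals-diagram {λs = a ∷ ν} ((0<a , _) ∷ s) = begin
  removals (diagram (a ∷ ν))
    ≡⟨ cong (map proj₂ ∘ filter maximal?) (trans (cong picks (diagram-∷ a ν)) (picks-++ (firstRow a) sh)) ⟩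
  map proj₂ (filter maximal? (map (map₂ (_++ sh)) (picks (firstRow a)) ++ map (map₂ (firstRow a ++_)) (picks sh)))
    ≡⟨ trans (cong (map proj₂) (filter-++ maximal? (map (map₂ (_++ sh)) (picks (firstRow a))) _))
         (map-++ proj₂ (filter maximal? (map (map₂ (_++ sh)) (picks (firstRow a)))) _) ⟩
  map proj₂ (filter maximal? (map (map₂ (_++ sh)) (picks (firstRow a)))) ++ map proj₂
      (filter maximal? (map (map₂ (firstRow a ++_)) (picks sh)))
    ≡⟨ cong₂ _++_ (removals-first ν 0<a s) (removals-below a ν (proj₁ ∘ diagram-bounds s)) ⟩
  map (diagram ∘ proj₂) (lower a ν) ++ map (λ bs → firstRow a ++ map shift bs) (removals (diagram ν))
    ≡⟨ cong (λ xs → map (diagram ∘ proj₂) (lower a ν) ++ map (λ bs → firstRow a ++ map shift bs) xs)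
         (removals-diagram s) ⟩
  map (diagram ∘ proj₂) (lower a ν) ++ map (λ bs → firstRow a ++ map shift bs) (map (diagram ∘ proj₂) (downs ν))
    ≡⟨ cong (map (diagram ∘ proj₂) (lower a ν) ++_)
         (trans (sym (map-∘ (downs ν))) (trans (map-cong (λ p → sym (diagram-∷ a (proj₂ p))) (downs ν))
         (map-∘ (downs ν)))) ⟩
  map (diagram ∘ proj₂) (lower a ν) ++ map (diagram ∘ proj₂) (map (map₂ (a ∷_)) (downs ν))
    ≡⟨ map-++ (diagram ∘ proj₂) (lower a ν) _ ⟨
  map (diagram ∘ proj₂) (downs (a ∷ ν)) ∎
  where
  open ≡-Reasoning
  sh : List Box
  sh = map shift (diagram ν)

#standardTableaux≡#labellings : ∀ λs → #standardTableaux λs ≡ #labellings (sum λs) (lookup (diagram λs))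
#standardTableaux≡#labellings λs = cong length (filter-≐ _ _ (to , from) (allFin (sum λs ^ length (diagram λs))))
  where
  to : ∀ {t} → IsStandard λs (finToFun t) → Labelling (lookup (diagram λs)) (finToFun t)
  to (standard bij rows columns) = bij , λ { p q (inj₁ (r , c)) → rows p q r c ; p q (inj₂ (c , r)) →
      columns p q c r }
  from : ∀ {t} → Labelling (lookup (diagram λs)) (finToFun t) → IsStandard λs (finToFun t)
  from (bij , mono) = standard bij (λ p q r c → mono p q (inj₁ (r , c))) (λ p q c r → mono p q (inj₂ (c , r)))

-- The branching rule, read off from the position of the largest label. The shape must be nonempty:
-- `downSum` vanishes at `[]`, which has one tableau.
#standardTableaux-downs : ∀ {b a ν} → StrictBelow b (a ∷ ν) → #standardTableaux (a ∷ ν) ≡ downSum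
    #standardTableaux (a ∷ ν)
#standardTableaux-downs {a = zero} ((() , _) ∷ _)
#standardTableaux-downs {a = suc a} {ν} s = begin
  #standardTableaux (suc a ∷ ν)
    ≡⟨ #standardTableaux≡#labellings (suc a ∷ ν) ⟩
  #labellings (sum (suc a ∷ ν)) (lookup (diagram (suc a ∷ ν)))
    ≡⟨ #labellings-removals (a + sum ν) (diagram (suc a ∷ ν)) (s≤s z≤n) ⟩
  ∑ (removals (diagram (suc a ∷ ν))) (#labellings (a + sum ν) ∘ lookup)
    ≡⟨ cong (λ xs → ∑ xs (#labellings (a + sum ν) ∘ lookup)) (removals-diagram s) ⟩
  ∑ (map (diagram ∘ proj₂) (downs (suc a ∷ ν))) (#labellings (a + sum ν) ∘ lookup)
    ≡⟨ ∑-map (diagram ∘ proj₂) (downs (suc a ∷ ν)) (#labellings (a + sum ν) ∘ lookup) ⟩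
  ∑ (downs (suc a ∷ ν)) (λ p → #labellings (a + sum ν) (lookup (diagram (proj₂ p))))
    ≡⟨ ∑-cong (downs (suc a ∷ ν)) (λ {p} p∈ → trans
         (cong (λ n → #labellings n (lookup (diagram (proj₂ p)))) (suc-injective (removal-sum (downs-removal s p∈))))
         (sym (#standardTableaux≡#labellings (proj₂ p)))) ⟩
  downSum #standardTableaux (suc a ∷ ν) ∎
  where open ≡-Reasoning

#standardTableaux-[] : #standardTableaux [] ≡ 1
#standardTableaux-[] = refl

-- Moments of the growth process

-- Adding a box of content x multiplies 2 ^ (|λ| − ℓ(λ)) by 2 ^ ε x.
ε : ℕ → ℕ
ε zero          = 0
ε (suc zero)    = 0
ε (suc (suc _)) = 1

rate : (ℕ → ℕ) → ℕ → ℕ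
rate g x = 2 ^ ε x * g x

-- The term of the one addition, in the first row, that the bound `b` cuts off.
wall : ℕ → (ℕ → ℕ) → List ℕ → ℕ
wall b c λs = ∑ (guard (suc (head λs) ≟ b) b) c

private
  raise-wall : ∀ {b} c a ν → a < b → ∑ (raise b a ν) (c ∘ proj₁) + ∑ (guard (suc a ≟ b) b) c ≡ c (suc a)
  raise-wall {b} c a ν a<b with suc a <? b | suc a ≟ b
  ... | yes 1+a<b | yes refl = contradiction 1+a<b (<-irrefl refl)
  ... | yes _ | no _ = trans (+-identityʳ _) (+-identityʳ _)
  ... | no _ | yes refl = +-identityʳ _
  ... | no 1+a≮b | no 1+a≢b = contradiction (≤-antisym a<b (≮⇒≥ 1+a≮b)) 1+a≢b

  -- The part 2 + a cannot be lowered exactly when the next part, then 1 + a, cannot be raised. Both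
  -- missing boxes have content 2 + a, so the same term is absent from the inner and from the outer
  -- sum.
  lower-wall : ∀ c a ν → head ν < 2 + a → ∑ (lower (2 + a) ν) (c ∘ proj₁) + wall (2 + a) c ν ≡ c (2 + a)
  lower-wall c a ν h< with head ν <? suc a | suc (head ν) ≟ 2 + a
  ... | yes h<1+a | yes h≡ = contradiction h<1+a (<-irrefl (suc-injective h≡))
  ... | yes _ | no _ = trans (+-identityʳ _) (+-identityʳ _)
  ... | no _ | yes _ = +-identityʳ _
  ... | no h≮ | no h≢ = contradiction (≤-antisym h< (s≤s (≮⇒≥ h≮))) h≢

-- Once the blocked corners have been restored, a part a contributes its outer corner of content a +
-- 1 against its inner corner of content a, that is 2 δ(a), and the empty row at the bottom
-- contributes `g 1`.
outer-wall : ∀ {g δ : ℕ → ℕ} → (∀ a → g (2 + a) ≡ g (1 + a) + δ (1 + a)) →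
             ∀ {b λs} → 0 < b → StrictBelow b λs →
             outerSum b (rate g) λs + wall b (rate g) λs ≡ innerSum (rate g) λs + (g 1 + 2 * ∑ λs δ)
outer-wall {g} g+ 0<b [] = trans (raise-wall (rate g) 0 [] 0<b) (lemma (g 1))
  where
  lemma : ∀ x → 1 * x ≡ 0 + (x + 2 * 0)
  lemma = solve-∀
-- Below a part 1 no row can start, but its inner corner counts `g 1` instead of twice that; the
-- other half of 2 g(1) takes the place of the constant.
outer-wall {g} {δ} g+ {b} {suc zero ∷ []} _ ((_ , 1<b) ∷ []) = begin
  outerSum b (rate g) (1 ∷ []) + wall b (rate g) (1 ∷ [])
    ≡⟨ cong (_+ wall b (rate g) (1 ∷ [])) (trans (∑-ups-∷ b 1 [] (rate g ∘ proj₁)) (+-identityʳ _)) ⟩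
  ∑ (raise b 1 []) (rate g ∘ proj₁) + wall b (rate g) (1 ∷ [])
    ≡⟨ raise-wall (rate g) 1 [] 1<b ⟩
  2 * g 2
    ≡⟨ cong (2 *_) (g+ 0) ⟩
  2 * (g 1 + δ 1)
    ≡⟨ lemma (g 1) (δ 1) ⟩
  1 * g 1 + 0 + (g 1 + 2 * (δ 1 + 0)) ∎
  where
  open ≡-Reasoning
  lemma : ∀ x y → 2 * (x + y) ≡ 1 * x + 0 + (x + 2 * (y + 0))
  lemma = solve-∀
outer-wall g+ {b} {suc zero ∷ _ ∷ _} _ (_ ∷ ((s≤s _ , s≤s ()) ∷ _))
-- The boundary term `w` of the tail is added to both sides: the induction hypothesis uses it up
-- among the outer corners, `lower-wall` among the inner ones.
outer-wall {g} {δ} g+ {b} {suc (suc a) ∷ ν} _ ((_ , a<b) ∷ s) = +-cancelʳ-≡ w _ _ (begin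
  outerSum b c (2 + a ∷ ν) + wall b c (2 + a ∷ ν) + w
    ≡⟨ cong (λ x → x + wall b c (2 + a ∷ ν) + w) (∑-ups-∷ b (2 + a) ν (c ∘ proj₁)) ⟩
  ∑ (raise b (2 + a) ν) (c ∘ proj₁) + outerSum (2 + a) c ν + wall b c (2 + a ∷ ν) + w
    ≡⟨ lemma₁ (∑ (raise b (2 + a) ν) (c ∘ proj₁)) (outerSum (2 + a) c ν) (wall b c (2 + a ∷ ν)) w ⟩
  (∑ (raise b (2 + a) ν) (c ∘ proj₁) + wall b c (2 + a ∷ ν)) + (outerSum (2 + a) c ν + w)
    ≡⟨ cong₂ _+_ (raise-wall c (2 + a) ν a<b) (outer-wall g+ (s≤s z≤n) s) ⟩
  2 * g (3 + a) + (innerSum c ν + (g 1 + 2 * ∑ ν δ))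
    ≡⟨ cong (λ x → 2 * x + (innerSum c ν + (g 1 + 2 * ∑ ν δ))) (g+ (suc a)) ⟩
  2 * (g (2 + a) + δ (2 + a)) + (innerSum c ν + (g 1 + 2 * ∑ ν δ))
    ≡⟨ lemma₂ (g (2 + a)) (δ (2 + a)) (innerSum c ν) (g 1) (∑ ν δ) ⟩
  2 * g (2 + a) + (innerSum c ν + (g 1 + 2 * (δ (2 + a) + ∑ ν δ)))
    ≡⟨ cong (_+ (innerSum c ν + (g 1 + 2 * (δ (2 + a) + ∑ ν δ)))) (lower-wall c a ν (head-< (s≤s z≤n) s)) ⟨
  ∑ (lower (2 + a) ν) (c ∘ proj₁) + w + (innerSum c ν + (g 1 + 2 * (δ (2 + a) + ∑ ν δ)))
    ≡⟨ lemma₃ (∑ (lower (2 + a) ν) (c ∘ proj₁)) w (innerSum c ν) (g 1 + 2 * (δ (2 + a) + ∑ ν δ)) ⟩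
  ∑ (lower (2 + a) ν) (c ∘ proj₁) + innerSum c ν + (g 1 + 2 * (δ (2 + a) + ∑ ν δ)) + w
    ≡⟨ cong (λ x → x + (g 1 + 2 * (δ (2 + a) + ∑ ν δ)) + w) (∑-downs-∷ (2 + a) ν (c ∘ proj₁)) ⟨
  innerSum c (2 + a ∷ ν) + (g 1 + 2 * (δ (2 + a) + ∑ ν δ)) + w ∎)
  where
  open ≡-Reasoning
  c : ℕ → ℕ
  c = rate g
  w : ℕ
  w = wall (2 + a) c ν
  lemma₁ : ∀ x y z w → x + y + z + w ≡ (x + z) + (y + w)
  lemma₁ = solve-∀
  lemma₂ : ∀ x y z u v → 2 * (x + y) + (z + (u + 2 * v)) ≡ 2 * x + (z + (u + 2 * (y + v)))
  lemma₂ = solve-∀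
  lemma₃ : ∀ x y z u → x + y + (z + u) ≡ x + z + u + y
  lemma₃ = solve-∀

outer-inner : ∀ {g δ : ℕ → ℕ} → (∀ a → g (2 + a) ≡ g (1 + a) + δ (1 + a)) →
              ∀ {b λs} → suc (head λs) < b → StrictBelow b λs →
              outerSum b (rate g) λs ≡ innerSum (rate g) λs + (g 1 + 2 * ∑ λs δ)
outer-inner {g} {δ} g+ {b} {λs} h< s = begin
  outerSum b (rate g) λs
    ≡⟨ +-identityʳ _ ⟨
  outerSum b (rate g) λs + 0
    ≡⟨ cong (outerSum b (rate g) λs +_) (sym wall≡0) ⟩
  outerSum b (rate g) λs + wall b (rate g) λs
    ≡⟨ outer-wall {g} {δ} g+ (≤-trans (s≤s z≤n) h<) s ⟩
  innerSum (rate g) λs + (g 1 + 2 * ∑ λs δ) ∎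
  where
  open ≡-Reasoning
  wall≡0 : wall b (rate g) λs ≡ 0
  wall≡0 with suc (head λs) ≟ b
  ... | yes refl = contradiction h< (<-irrefl refl)
  ... | no _ = refl

∑-zero : ∀ {A : Set} (xs : List A) → ∑ xs (λ _ → 0) ≡ 0
∑-zero []       = refl
∑-zero (_ ∷ xs) = ∑-zero xs

-- This is 2^(|λ| - ℓ(λ)), as `weight-strict` confirms. The exponent is a sum over the parts so that
-- `∑-removal` governs its change.
weight : List ℕ → ℕ
weight λs = 2 ^ ∑ λs pred

weight-removal : ∀ {x λs μ} → Box-removal x λs μ → weight λs ≡ 2 ^ ε x * weight μ
weight-removal {x} {λs} {μ} r = begin
  2 ^ ∑ λs pred           ≡⟨ cong (2 ^_) (∑-removal {pred} {ε} refl (λ { zero → refl ; (suc a) → +-comm 1 a }) r) ⟩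
  2 ^ (∑ μ pred + ε x)    ≡⟨ cong (2 ^_) (+-comm (∑ μ pred) (ε x)) ⟩
  2 ^ (ε x + ∑ μ pred)    ≡⟨ ^-distribˡ-+-* 2 (ε x) (∑ μ pred) ⟩
  2 ^ ε x * weight μ      ∎
  where open ≡-Reasoning

-- Binomial coefficients along a row

nC0≡1 : ∀ n → n C 0 ≡ 1
nC0≡1 n = trans (nCk≡nC[n∸k] {0} {n} z≤n) (nCn≡1 n)

-- The absorption identity: Pascal's rule on the left reduces it to the instances for k and k + 1
-- one row higher in the triangle.
[k+1]*[n+1]C[k+1]≡[n+1]*nCk : ∀ n k → suc k * (suc n C suc k) ≡ suc n * (n C k)
[k+1]*[n+1]C[k+1]≡[n+1]*nCk zero zero = refl
[k+1]*[n+1]C[k+1]≡[n+1]*nCk zero (suc k) =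
  trans (cong (suc (suc k) *_) (k>n⇒nCk≡0 {1} {2 + k} (s≤s (s≤s z≤n))))
      (trans (*-zeroʳ (suc (suc k))) (sym (cong (1 *_) (k>n⇒nCk≡0 {0} {suc k} (s≤s z≤n)))))
[k+1]*[n+1]C[k+1]≡[n+1]*nCk (suc n) zero = begin
  1 * ((2 + n) C 1)        ≡⟨ cong (1 *_) (nC1≡n (2 + n)) ⟩
  1 * (2 + n)              ≡⟨ *-comm 1 (2 + n) ⟩
  (2 + n) * 1              ≡⟨ cong ((2 + n) *_) (nC0≡1 (suc n)) ⟨
  (2 + n) * (suc n C 0)    ∎
  where open ≡-Reasoning
[k+1]*[n+1]C[k+1]≡[n+1]*nCk (suc n) (suc k) = begin
  (2 + k) * ((2 + n) C (2 + k))
    ≡⟨ cong ((2 + k) *_) (nCk+nC[k+1]≡[n+1]C[k+1] (suc n) (suc k)) ⟨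
  (2 + k) * ((suc n C suc k) + (suc n C (2 + k)))
    ≡⟨ lemma₁ k (suc n C suc k) (suc n C (2 + k)) ⟩
  (suc n C suc k) + (suc k * (suc n C suc k) + (2 + k) * (suc n C (2 + k)))
    ≡⟨ cong ((suc n C suc k) +_) (cong₂ _+_ ([k+1]*[n+1]C[k+1]≡[n+1]*nCk n k)
         ([k+1]*[n+1]C[k+1]≡[n+1]*nCk n (suc k))) ⟩
  (suc n C suc k) + (suc n * (n C k) + suc n * (n C suc k))
    ≡⟨ cong ((suc n C suc k) +_) (*-distribˡ-+ (suc n) (n C k) (n C suc k)) ⟨
  (suc n C suc k) + suc n * ((n C k) + (n C suc k))
    ≡⟨ cong (λ c → (suc n C suc k) + suc n * c) (nCk+nC[k+1]≡[n+1]C[k+1] n k) ⟩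
  (2 + n) * (suc n C suc k) ∎
  where
  open ≡-Reasoning
  lemma₁ : ∀ k x y → (2 + k) * (x + y) ≡ x + ((1 + k) * x + (2 + k) * y)
  lemma₁ = solve-∀

-- `rowTerm k` is the discrete antiderivative of `boxTerm k`, and `rowDifference k` the discrete
-- derivative; the latter is 0 for k = 0, where `boxTerm` is constant. Contents are at least 1, so
-- the truncated subtraction is exact wherever it matters.
boxTerm rowTerm rowDifference : ℕ → ℕ → ℕ
boxTerm k x = (x + k ∸ 1) C (2 * k)
rowTerm k a = (a + k) C suc (2 * k)
rowDifference zero    _ = 0
rowDifference (suc k)   = rowTerm k

rowTerm-zero : ∀ k → rowTerm k 0 ≡ 0
rowTerm-zero k = k>n⇒nCk≡0 (s≤s (m≤m+n k (k + 0)))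

rowTerm-suc : ∀ k a → rowTerm k (suc a) ≡ rowTerm k a + boxTerm k (suc a)
rowTerm-suc k a = trans (sym (nCk+nC[k+1]≡[n+1]C[k+1] (a + k) (2 * k))) (+-comm ((a + k) C (2 * k)) _)

private
  2*[1+k] : ∀ k → 2 * suc k ≡ suc (suc (2 * k))
  2*[1+k] = solve-∀

boxTerm-suc : ∀ k a → boxTerm k (2 + a) ≡ boxTerm k (1 + a) + rowDifference k (1 + a)
boxTerm-suc zero a = trans (nC0≡1 (suc a + 0)) (sym (trans (+-identityʳ _) (nC0≡1 (a + 0))))
boxTerm-suc (suc k) a = begin
  (suc a + suc k) C (2 * suc k)
    ≡⟨ cong₂ (λ n j → suc n C j) (+-suc a k) (2*[1+k] k) ⟩
  suc (suc (a + k)) C suc (suc (2 * k))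
    ≡⟨ nCk+nC[k+1]≡[n+1]C[k+1] (suc (a + k)) (suc (2 * k)) ⟨
  (suc (a + k) C suc (2 * k)) + (suc (a + k) C suc (suc (2 * k)))
    ≡⟨ +-comm (suc (a + k) C suc (2 * k)) _ ⟩
  (suc (a + k) C suc (suc (2 * k))) + rowTerm k (suc a)
    ≡⟨ cong₂ (λ n j → (n C j) + rowTerm k (suc a)) (+-suc a k) (2*[1+k] k) ⟨
  boxTerm (suc k) (suc a) + rowTerm k (suc a) ∎
  where open ≡-Reasoning

-- Since k + 1 < 2 k + 2, the constant `g 1` of the commutator survives only for k = 0.
boxTerm-suc-one : ∀ k → boxTerm (suc k) 1 ≡ 0
boxTerm-suc-one k = k>n⇒nCk≡0 (s≤s (≤-trans (s≤s (m≤m+n k 0)) (m≤n+m (suc (k + 0)) k)))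

-- The branching rule and its initial value are all that the moments use about tableaux.
module Growth (f : List ℕ → ℕ) (f-[] : f [] ≡ 1)
  (f-downs : ∀ {b a ν} → StrictBelow b (a ∷ ν) → f (a ∷ ν) ≡ downSum f (a ∷ ν)) where

  -- After one step up no argument of f is empty, so f may be replaced by downSum f.
  upSum-f : ∀ {b} c {λs} → StrictBelow b λs → upSum b c f λs ≡ upSum b c (downSum f) λs
  upSum-f {b} c {λs} s = ∑-cong (ups b λs) λ {p} p∈ → cong (c (proj₁ p) *_)
      (step (ups-strict s p∈) (ups-removal s p∈))
    where
    step : ∀ {x κ μ} → StrictBelow b κ → Box-removal x κ μ → f κ ≡ downSum f κ
    step s@(_ ∷ _) _ = f-downs s

  -- On nonempty partitions `f` is fixed by `downSum`, so `commutation` applied to `f` becomes a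
  -- recursion that expresses the weighted addition at `λs` by its values one box lower.
  upSum-f-recursion : ∀ {g δ : ℕ → ℕ} → (∀ a → g (2 + a) ≡ g (1 + a) + δ (1 + a)) →
                  ∀ {b λs} → suc (head λs) < b → StrictBelow b λs →
                  upSum b (rate g) f λs ≡ downSum (upSum b (rate g) f) λs + (g 1 + 2 * ∑ λs δ) * f λs
  upSum-f-recursion {g} {δ} g+ {b} {λs} h< s = +-cancelʳ-≡ (innerSum c λs * f λs) _ _ (begin
    upSum b c f λs + innerSum c λs * f λs
      ≡⟨ cong (_+ innerSum c λs * f λs) (upSum-f c s) ⟩
    upSum b c (downSum f) λs + innerSum c λs * f λs
      ≡⟨ commutation c f s ⟩
    downSum (upSum b c f) λs + outerSum b c λs * f λs
      ≡⟨ cong (λ o → downSum (upSum b c f) λs + o * f λs) (outer-inner {g} {δ} g+ h< s) ⟩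
    downSum (upSum b c f) λs + (innerSum c λs + (g 1 + 2 * ∑ λs δ)) * f λs
      ≡⟨ lemma (downSum (upSum b c f) λs) (innerSum c λs) (g 1 + 2 * ∑ λs δ) (f λs) ⟩
    downSum (upSum b c f) λs + (g 1 + 2 * ∑ λs δ) * f λs + innerSum c λs * f λs ∎)
    where
    open ≡-Reasoning
    c : ℕ → ℕ
    c = rate g
    lemma : ∀ x y z w → x + (y + z) * w ≡ x + z * w + y * w
    lemma = solve-∀

  -- The dual branching rule. For g = 1 the commutator is 1, so each removed box adds one copy of
  -- `f λs`, and the start at `[]` adds one more.
  upSum-f-one : ∀ n {b λs} → StrictBelow b λs → sum λs ≡ n → suc n < b → upSum b (rate (λ _ → 1)) f λs ≡ suc n * f λs
  upSum-f-one zero {b} [] _ 1<b with 1 <? b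
  ... | yes _ rewrite f-downs {b} {1} {[]} ((s≤s z≤n , 1<b) ∷ []) = lemma (f [])
    where
    lemma : ∀ x → 1 * 1 * (x + 0) + 0 ≡ 1 * x
    lemma = solve-∀
  ... | no 1≮b = contradiction 1<b 1≮b
  upSum-f-one zero {λs = suc _ ∷ _} _ ()
  upSum-f-one zero {λs = zero ∷ _} ((() , _) ∷ _)
  upSum-f-one (suc n) {b} {λs@(_ ∷ _)} s eq 1+n<b = begin
    upSum b (rate (λ _ → 1)) f λs
      ≡⟨ upSum-f-recursion {λ _ → 1} {λ _ → 0} (λ _ → refl)
           (≤-<-trans (s≤s (≤-trans (head≤sum λs) (≤-reflexive eq))) 1+n<b) s ⟩
    downSum (upSum b (rate (λ _ → 1)) f) λs + (1 + 2 * ∑ λs (λ _ → 0)) * f λs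
      ≡⟨ cong₂ (λ x y → x + (1 + 2 * y) * f λs) (∑-cong (downs λs) below) (∑-zero λs) ⟩
    ∑ (downs λs) (λ p → suc n * f (proj₂ p)) + 1 * f λs
      ≡⟨ cong (_+ 1 * f λs) (trans (∑-*ˡ (downs λs) (suc n) (f ∘ proj₂)) (cong (suc n *_) (sym (f-downs s)))) ⟩
    suc n * f λs + 1 * f λs
      ≡⟨ lemma (suc n) (f λs) ⟩
    suc (suc n) * f λs ∎
    where
    open ≡-Reasoning
    lemma : ∀ x y → x * y + 1 * y ≡ (1 + x) * y
    lemma = solve-∀
    below : ∀ {p} → p ∈ downs λs → upSum b (rate (λ _ → 1)) f (proj₂ p) ≡ suc n * f (proj₂ p)
    below p∈ = let r = downs-removal s p∈ in
      upSum-f-one n (removal-strict s r) (suc-injective (trans (sym (removal-sum r)) eq)) (<-trans (n<1+n _) 1+n<b)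

  -- Only one factor of f² is built in. The other is part of `G`, where the branching rule and the
  -- operators can act on it.
  moment : ℕ → (List ℕ → ℕ) → ℕ
  moment n G = ∑ (strictPartitions n) (λ λs → weight λs * f λs * G λs)

  -- Moved across the pairing, the removal becomes the addition with rate 2^ε(x) acting on the
  -- built-in `f`, and `upSum-f-one` evaluates it.
  moment-downSum : ∀ n Ψ → moment (suc n) (downSum Ψ) ≡ suc n * moment n Ψ
  moment-downSum n Ψ = begin
    ∑ (strictPartitions (suc n)) (λ λs → weight λs * f λs * downSum Ψ λs)
      ≡⟨ ∑-cong (strictPartitions (suc n)) (λ {λs} _ → sym (∑-*ˡ (downs λs) (weight λs * f λs) (Ψ ∘ proj₂))) ⟩
    ∑ (strictPartitions (suc n)) (λ λs → ∑ (downs λs) (λ (x , μ) → weight λs * f λs * Ψ μ))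
      ≡⟨ downs-ups-adjoint (λ λs x μ → weight λs * f λs * Ψ μ) (n<1+n (suc n)) ⟩
    ∑ (strictPartitions n) (λ μ → ∑ (ups b μ) (λ (x , λs) → weight λs * f λs * Ψ μ))
      ≡⟨ ∑-cong (strictPartitions n) step ⟩
    ∑ (strictPartitions n) (λ μ → suc n * (weight μ * f μ * Ψ μ))
      ≡⟨ ∑-*ˡ (strictPartitions n) (suc n) _ ⟩
    suc n * moment n Ψ ∎
    where
    open ≡-Reasoning
    b : ℕ
    b = 2 + n
    step : ∀ {μ} → μ ∈ strictPartitions n →
           ∑ (ups b μ) (λ (x , λs) → weight λs * f λs * Ψ μ) ≡ suc n * (weight μ * f μ * Ψ μ)
    step {μ} μ∈ with ∈-strictPartitions⁻ (≤-trans (n<1+n n) (n≤1+n _)) μ∈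
    ... | s , eq = begin
      ∑ (ups b μ) (λ (x , λs) → weight λs * f λs * Ψ μ)
        ≡⟨ ∑-cong (ups b μ) (λ {p} p∈ → trans (cong (λ w → w * f (proj₂ p) * Ψ μ) (weight-removal (ups-removal s p∈)))
             (lemma₁ (2 ^ ε (proj₁ p)) (weight μ) (f (proj₂ p)) (Ψ μ))) ⟩
      ∑ (ups b μ) (λ (x , λs) → rate (λ _ → 1) x * f λs * (weight μ * Ψ μ))
        ≡⟨ ∑-*ʳ (ups b μ) (weight μ * Ψ μ) _ ⟩
      upSum b (rate (λ _ → 1)) f μ * (weight μ * Ψ μ)
        ≡⟨ cong (_* (weight μ * Ψ μ)) (upSum-f-one n s eq (n<1+n (suc n))) ⟩
      suc n * f μ * (weight μ * Ψ μ)
        ≡⟨ lemma₂ (suc n) (f μ) (weight μ) (Ψ μ) ⟩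
      suc n * (weight μ * f μ * Ψ μ) ∎
      where
      lemma₁ : ∀ e w x y → e * w * x * y ≡ e * 1 * x * (w * y)
      lemma₁ = solve-∀
      lemma₂ : ∀ n x w y → n * x * (w * y) ≡ n * (w * x * y)
      lemma₂ = solve-∀

  moment-+ : ∀ n G G′ → moment n (λ λs → G λs + G′ λs) ≡ moment n G + moment n G′
  moment-+ n G G′ = trans
    (∑-cong (strictPartitions n) (λ {λs} _ → *-distribˡ-+ (weight λs * f λs) (G λs) (G′ λs)))
    (∑-+ (strictPartitions n) _ _)

  moment-upSum : ∀ n {g δ : ℕ → ℕ} → (∀ a → g (2 + a) ≡ g (1 + a) + δ (1 + a)) →
             ∀ {b} → 2 + n < b →
             moment (suc n) (upSum b (rate g) f) ≡
             suc n * moment n (upSum b (rate g) f) + moment (suc n) (λ λs → (g 1 + 2 * ∑ λs δ) * f λs)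
  moment-upSum n {g} {δ} g+ {b} 2+n<b = begin
    moment (suc n) (upSum b (rate g) f)
      ≡⟨ ∑-cong (strictPartitions (suc n)) (λ {λs} λs∈ → cong (weight λs * f λs *_) (step λs∈)) ⟩
    moment (suc n) (λ λs → downSum (upSum b (rate g) f) λs + (g 1 + 2 * ∑ λs δ) * f λs)
      ≡⟨ moment-+ (suc n) (downSum (upSum b (rate g) f)) _ ⟩
    moment (suc n) (downSum (upSum b (rate g) f)) + moment (suc n) (λ λs → (g 1 + 2 * ∑ λs δ) * f λs)
      ≡⟨ cong (_+ moment (suc n) (λ λs → (g 1 + 2 * ∑ λs δ) * f λs)) (moment-downSum n (upSum b (rate g) f)) ⟩
    suc n * moment n (upSum b (rate g) f) + moment (suc n) (λ λs → (g 1 + 2 * ∑ λs δ) * f λs) ∎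
    where
    open ≡-Reasoning
    step : ∀ {λs} → λs ∈ strictPartitions (suc n) →
           upSum b (rate g) f λs ≡ downSum (upSum b (rate g) f) λs + (g 1 + 2 * ∑ λs δ) * f λs
    step {λs} λs∈ with ∈-strictPartitions⁻ {b} (<-trans (n<1+n _) 2+n<b) λs∈
    ... | s , eq = upSum-f-recursion {g} {δ} g+ (≤-<-trans (s≤s (≤-trans (head≤sum λs) (≤-reflexive eq))) 2+n<b) s

  -- The second `f` is expanded by the branching rule and the sum is taken from below. The sum of
  -- `Γ` splits into its old value, which keeps the factor n + 1 of `upSum-f-one`, and `g x`, which
  -- changes the rate of the addition to that of `g`.
  moment-f-suc : ∀ n {Γ g : ℕ → ℕ} → Γ 0 ≡ 0 → (∀ a → Γ (suc a) ≡ Γ a + g (suc a)) →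
                 ∀ {b} → suc n < b →
                 moment (suc n) (λ λs → ∑ λs Γ * f λs) ≡
                 suc n * moment n (λ λs → ∑ λs Γ * f λs) + moment n (upSum b (rate g) f)
  moment-f-suc n {Γ} {g} Γ0 Γ+ {b} 1+n<b = begin
    moment (suc n) (λ λs → ∑ λs Γ * f λs)
      ≡⟨ ∑-cong (strictPartitions (suc n)) start ⟩
    ∑ (strictPartitions (suc n)) (λ λs → ∑ (downs λs) (λ (x , μ) → weight λs * f λs * (∑ λs Γ * f μ)))
      ≡⟨ downs-ups-adjoint (λ λs x μ → weight λs * f λs * (∑ λs Γ * f μ)) 1+n<b ⟩
    ∑ (strictPartitions n) (λ μ → ∑ (ups b μ) (λ (x , λs) → weight λs * f λs * (∑ λs Γ * f μ)))
      ≡⟨ ∑-cong (strictPartitions n) step ⟩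
    ∑ (strictPartitions n) (λ μ → suc n * (weight μ * f μ * (∑ μ Γ * f μ)) + weight μ * f μ * upSum b (rate g) f μ)
      ≡⟨ ∑-+ (strictPartitions n) _ _ ⟩
    ∑ (strictPartitions n) (λ μ → suc n * (weight μ * f μ * (∑ μ Γ * f μ))) + moment n (upSum b (rate g) f)
      ≡⟨ cong (_+ moment n (upSum b (rate g) f)) (∑-*ˡ (strictPartitions n) (suc n) _) ⟩
    suc n * moment n (λ λs → ∑ λs Γ * f λs) + moment n (upSum b (rate g) f) ∎
    where
    open ≡-Reasoning
    start : ∀ {λs} → λs ∈ strictPartitions (suc n) →
            weight λs * f λs * (∑ λs Γ * f λs) ≡ ∑ (downs λs) (λ (x , μ) → weight λs * f λs * (∑ λs Γ * f μ))
    start {λs} λs∈ with ∈-strictPartitions⁻ {b} 1+n<b λs∈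
    ... | s@(_∷_ {ν = ν} _ _) , _ = begin
      weight λs * f λs * (∑ λs Γ * f λs)
        ≡⟨ cong (λ y → weight λs * f λs * (∑ λs Γ * y)) (f-downs s) ⟩
      weight λs * f λs * (∑ λs Γ * downSum f λs)
        ≡⟨ cong (weight λs * f λs *_) (∑-*ˡ (downs λs) (∑ λs Γ) (f ∘ proj₂)) ⟨
      weight λs * f λs * ∑ (downs λs) (λ (x , μ) → ∑ λs Γ * f μ)
        ≡⟨ ∑-*ˡ (downs λs) (weight λs * f λs) _ ⟨
      ∑ (downs λs) (λ (x , μ) → weight λs * f λs * (∑ λs Γ * f μ)) ∎
    step : ∀ {μ} → μ ∈ strictPartitions n →
           ∑ (ups b μ) (λ (x , λs) → weight λs * f λs * (∑ λs Γ * f μ)) ≡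
           suc n * (weight μ * f μ * (∑ μ Γ * f μ)) + weight μ * f μ * upSum b (rate g) f μ
    step {μ} μ∈ with ∈-strictPartitions⁻ {b} (<-trans (n<1+n _) 1+n<b) μ∈
    ... | s , eq = begin
      ∑ (ups b μ) (λ (x , λs) → weight λs * f λs * (∑ λs Γ * f μ))
        ≡⟨ ∑-cong (ups b μ) (λ {p} p∈ → let r = ups-removal s p∈ in
             trans (cong₂ (λ w G → w * f (proj₂ p) * (G * f μ)) (weight-removal r) (∑-removal {Γ} {g} Γ0 Γ+ r))
             (lemma₁ (2 ^ ε (proj₁ p)) (weight μ) (f (proj₂ p)) (∑ μ Γ) (g (proj₁ p)) (f μ))) ⟩
      ∑ (ups b μ) (λ (x , λs) → rate (λ _ → 1) x * f λs * (weight μ * (∑ μ Γ * f μ)) + rate g x * f λs *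
          (weight μ * f μ))
        ≡⟨ trans (∑-+ (ups b μ) _ _) (cong₂ _+_ (∑-*ʳ (ups b μ) _ _) (∑-*ʳ (ups b μ) _ _)) ⟩
      upSum b (rate (λ _ → 1)) f μ * (weight μ * (∑ μ Γ * f μ)) + upSum b (rate g) f μ * (weight μ * f μ)
        ≡⟨ cong (λ d → d * (weight μ * (∑ μ Γ * f μ)) + upSum b (rate g) f μ * (weight μ * f μ))
             (upSum-f-one n s eq 1+n<b) ⟩
      suc n * f μ * (weight μ * (∑ μ Γ * f μ)) + upSum b (rate g) f μ * (weight μ * f μ)
        ≡⟨ lemma₂ (suc n) (f μ) (weight μ) (∑ μ Γ * f μ) (upSum b (rate g) f μ) ⟩
      suc n * (weight μ * f μ * (∑ μ Γ * f μ)) + weight μ * f μ * upSum b (rate g) f μ ∎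
      where
      lemma₁ : ∀ e w x G h y → e * w * x * ((G + h) * y) ≡ e * 1 * x * (w * (G * y)) + e * h * x * (w * y)
      lemma₁ = solve-∀
      lemma₂ : ∀ n x w y d → n * x * (w * y) + d * (w * x) ≡ n * (w * x * y) + w * x * d
      lemma₂ = solve-∀

  -- `boxMoment k n` is Xₖ(n), with the boxes already summed row by row. `diagonalMoment` is the
  -- inhomogeneity that the commutator for `boxTerm k` produces: n! for k = 0 and 2 Xₖ₋₁(n)
  -- afterwards.
  boxMoment diagonalMoment : ℕ → ℕ → ℕ
  boxMoment k n = moment n (λ λs → ∑ λs (rowTerm k) * f λs)
  diagonalMoment k n = moment n (λ λs → (boxTerm k 1 + 2 * ∑ λs (rowDifference k)) * f λs)

  -- The analogue for strict partitions of the identity that the squares of the numbers of standard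
  -- Young tableaux add up to n!.
  moment-f : ∀ n → moment n f ≡ n !
  moment-f zero rewrite f-[] = refl
  moment-f (suc n) = trans (∑-cong (strictPartitions (suc n)) λ {λs} λs∈ → cong (weight λs * f λs *_) (step λs∈))
    (trans (moment-downSum n f) (cong (suc n *_) (moment-f n)))
    where
    step : ∀ {λs} → λs ∈ strictPartitions (suc n) → f λs ≡ downSum f λs
    step λs∈ with ∈-strictPartitions⁻ (n<1+n (suc n)) λs∈
    ... | s@(_ ∷ _) , _ = f-downs s

  diagonalMoment-zero : ∀ n → diagonalMoment 0 n ≡ n !
  diagonalMoment-zero n = trans (∑-cong (strictPartitions n) (λ {λs} _ → cong (weight λs * f λs *_)
      (trans (cong₂ (λ x y → (x + 2 * y) * f λs) (nC0≡1 0) (∑-zero λs)) (*-identityˡ (f λs)))))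
    (moment-f n)

  diagonalMoment-suc : ∀ k n → diagonalMoment (suc k) n ≡ 2 * boxMoment k n
  diagonalMoment-suc k n = trans
    (∑-cong (strictPartitions n) λ {λs} _ →
      trans (cong (λ x → weight λs * f λs * ((x + 2 * ∑ λs (rowTerm k)) * f λs)) (boxTerm-suc-one k))
            (lemma (weight λs * f λs) (∑ λs (rowTerm k)) (f λs)))
    (∑-*ˡ (strictPartitions n) 2 _)
    where
    lemma : ∀ w x y → w * ((0 + 2 * x) * y) ≡ 2 * (w * (x * y))
    lemma = solve-∀

  -- Divided by n!, the recursion of `moment-upSum` is a running sum of the terms 2^k C(n, k) / k!,
  -- and Pascal's rule performs the hockey-stick summation.
  moment-upSum-closed : ∀ k → (∀ n → diagonalMoment k n * k ! ≡ 2 ^ k * n ! * (n C k)) →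
                    ∀ {b} n → suc n < b →
                    moment n (upSum b (rate (boxTerm k)) f) * k ! ≡ 2 ^ k * n ! * (suc n C suc k)
  moment-upSum-closed k diagonal {b} zero 1<b = begin
    moment 0 (upSum b (rate (boxTerm k)) f) * k !
      -- From the empty partition nothing can be removed, so only the commutator term remains.
      ≡⟨ cong (λ d → (1 * f [] * d + 0) * k !) (upSum-f-recursion {boxTerm k} {rowDifference k}
           (boxTerm-suc k) 1<b []) ⟩
    diagonalMoment k 0 * k !
      ≡⟨ diagonal 0 ⟩
    2 ^ k * 0 ! * (0 C k)
      ≡⟨ cong (2 ^ k * 0 ! *_) (trans (sym (+-identityʳ (0 C k)))
           (trans (cong ((0 C k) +_) (sym (k>n⇒nCk≡0 {0} {suc k} (s≤s z≤n)))) (nCk+nC[k+1]≡[n+1]C[k+1] 0 k))) ⟩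
    2 ^ k * 0 ! * (1 C suc k) ∎
    where open ≡-Reasoning
  moment-upSum-closed k diagonal {b} (suc n) 2+n<b = begin
    moment (suc n) (upSum b (rate (boxTerm k)) f) * k !
      ≡⟨ cong (_* k !) (moment-upSum n {boxTerm k} {rowDifference k} (boxTerm-suc k) 2+n<b) ⟩
    (suc n * moment n (upSum b (rate (boxTerm k)) f) + diagonalMoment k (suc n)) * k !
      ≡⟨ lemma₁ (suc n) (moment n (upSum b (rate (boxTerm k)) f)) (diagonalMoment k (suc n)) (k !) ⟩
    suc n * (moment n (upSum b (rate (boxTerm k)) f) * k !) + diagonalMoment k (suc n) * k !
      ≡⟨ cong₂ (λ x y → suc n * x + y) (moment-upSum-closed k diagonal n (<-trans (n<1+n _) 2+n<b))
           (diagonal (suc n)) ⟩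
    suc n * (2 ^ k * n ! * (suc n C suc k)) + 2 ^ k * (suc n) ! * (suc n C k)
      ≡⟨ lemma₂ (suc n) (2 ^ k) (n !) (suc n C suc k) (suc n C k) ⟩
    2 ^ k * (suc n) ! * ((suc n C k) + (suc n C suc k))
      ≡⟨ cong (2 ^ k * (suc n) ! *_) (nCk+nC[k+1]≡[n+1]C[k+1] (suc n) k) ⟩
    2 ^ k * (suc n) ! * ((2 + n) C suc k) ∎
    where
    open ≡-Reasoning
    lemma₁ : ∀ n x y z → (n * x + y) * z ≡ n * (x * z) + y * z
    lemma₁ = solve-∀
    lemma₂ : ∀ n p q x y → n * (p * q * x) + p * (n * q) * y ≡ p * (n * q) * (y + x)
    lemma₂ = solve-∀

  -- Divided by (n + 1)!, the recursion of `moment-f-suc` has the increment Y / (n + 1)!, which is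
  -- again a multiple of C(n, k).
  boxMoment-closed′ : ∀ k → (∀ n → diagonalMoment k n * k ! ≡ 2 ^ k * n ! * (n C k)) →
                     ∀ n → boxMoment k n * (suc k) ! ≡ 2 ^ k * n ! * (n C suc k)
  boxMoment-closed′ k diagonal zero = begin
    (1 * f [] * 0 + 0) * (suc k) !   ≡⟨ cong (λ x → (x + 0) * (suc k) !) (*-zeroʳ (1 * f [])) ⟩
    0                                ≡⟨ *-zeroʳ (2 ^ k * 0 !) ⟨
    2 ^ k * 0 ! * 0                  ≡⟨ cong (2 ^ k * 0 ! *_) (k>n⇒nCk≡0 {0} {suc k} (s≤s z≤n)) ⟨
    2 ^ k * 0 ! * (0 C suc k)        ∎
    where open ≡-Reasoning
  boxMoment-closed′ k diagonal (suc n) = begin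
    boxMoment k (suc n) * (suc k) !
      ≡⟨ cong (_* (suc k) !) (moment-f-suc n {rowTerm k} {boxTerm k} (rowTerm-zero k) (rowTerm-suc k)
           (n<1+n (suc n))) ⟩
    (suc n * boxMoment k n + Y) * (suc k * k !)
      ≡⟨ lemma₁ (suc n) (boxMoment k n) Y (suc k) (k !) ⟩
    suc n * (boxMoment k n * (suc k) !) + suc k * (Y * k !)
      ≡⟨ cong₂ (λ x y → suc n * x + suc k * y) (boxMoment-closed′ k diagonal n)
           (moment-upSum-closed k diagonal n (n<1+n (suc n))) ⟩
    suc n * (2 ^ k * n ! * (n C suc k)) + suc k * (2 ^ k * n ! * (suc n C suc k))
      ≡⟨ lemma₂ (suc n) (2 ^ k) (n !) (n C suc k) (suc k) (suc n C suc k) ⟩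
    2 ^ k * n ! * (suc n * (n C suc k) + suc k * (suc n C suc k))
      -- Absorption trades the k + 1 from (k + 1)! for the n + 1 that is needed to complete (n +
      -- 1)!.
      ≡⟨ cong (λ x → 2 ^ k * n ! * (suc n * (n C suc k) + x)) ([k+1]*[n+1]C[k+1]≡[n+1]*nCk n k) ⟩
    2 ^ k * n ! * (suc n * (n C suc k) + suc n * (n C k))
      ≡⟨ lemma₃ (2 ^ k) (n !) (suc n) (n C suc k) (n C k) ⟩
    2 ^ k * (suc n) ! * ((n C k) + (n C suc k))
      ≡⟨ cong (2 ^ k * (suc n) ! *_) (nCk+nC[k+1]≡[n+1]C[k+1] n k) ⟩
    2 ^ k * (suc n) ! * (suc n C suc k) ∎
    where
    open ≡-Reasoning
    Y : ℕ
    Y = moment n (upSum (2 + n) (rate (boxTerm k)) f)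
    lemma₁ : ∀ n x y k z → (n * x + y) * (k * z) ≡ n * (x * (k * z)) + k * (y * z)
    lemma₁ = solve-∀
    lemma₂ : ∀ n p q x k y → n * (p * q * x) + k * (p * q * y) ≡ p * q * (n * x + k * y)
    lemma₂ = solve-∀
    lemma₃ : ∀ p q n x y → p * q * (n * x + n * y) ≡ p * (n * q) * (y + x)
    lemma₃ = solve-∀

  -- Doubled, the formula for k is precisely the hypothesis on `diagonalMoment` for k + 1.
  boxMoment-closed : ∀ k n → boxMoment k n * (suc k) ! ≡ 2 ^ k * n ! * (n C suc k)
  boxMoment-closed zero = boxMoment-closed′ 0 λ n → begin
    diagonalMoment 0 n * 1     ≡⟨ cong (_* 1) (diagonalMoment-zero n) ⟩
    n ! * 1                    ≡⟨ cong₂ _*_ (sym (*-identityˡ (n !))) (sym (nC0≡1 n)) ⟩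
    1 * n ! * (n C 0)          ∎
    where open ≡-Reasoning
  boxMoment-closed (suc k) = boxMoment-closed′ (suc k) λ n → begin
    diagonalMoment (suc k) n * (suc k) !    ≡⟨ cong (_* (suc k) !) (diagonalMoment-suc k n) ⟩
    2 * boxMoment k n * (suc k) !           ≡⟨ *-assoc 2 (boxMoment k n) _ ⟩
    2 * (boxMoment k n * (suc k) !)         ≡⟨ cong (2 *_) (boxMoment-closed k n) ⟩
    2 * (2 ^ k * n ! * (n C suc k))         ≡⟨ lemma (2 ^ k) (n !) (n C suc k) ⟩
    2 ^ suc k * n ! * (n C suc k)           ∎
    where
    open ≡-Reasoning
    lemma : ∀ p q r → 2 * (p * q * r) ≡ 2 * p * q * r
    lemma = solve-∀

-- Hook lengths

∏ : ℕ → (ℕ → ℕ) → ℕ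
∏ zero    F = 1
∏ (suc n) F = F 0 * ∏ n (F ∘ suc)

product-upTo : ∀ n F → product (map F (upTo n)) ≡ ∏ n F
product-upTo n F = trans (cong product (map-upTo F n)) (go n F)
  where
  go : ∀ n F → product (applyUpTo F n) ≡ ∏ n F
  go zero    F = refl
  go (suc n) F = cong (F 0 *_) (go n (F ∘ suc))

∏-cong : ∀ n {F G : ℕ → ℕ} → (∀ {d} → d < n → F d ≡ G d) → ∏ n F ≡ ∏ n G
∏-cong zero    eq = refl
∏-cong (suc n) eq = cong₂ _*_ (eq (s≤s z≤n)) (∏-cong n (eq ∘ s≤s))

∏-+ : ∀ m n F → ∏ (m + n) F ≡ ∏ m F * ∏ n (F ∘ (m +_))
∏-+ zero    n F = sym (+-identityʳ _)
∏-+ (suc m) n F = trans (cong (F 0 *_) (∏-+ m n (F ∘ suc))) (sym (*-assoc (F 0) (∏ m (F ∘ suc)) _))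

∏-! : ∀ n → ∏ n (n ∸_) ≡ n !
∏-! zero    = refl
∏-! (suc n) = cong (suc n *_) (∏-! n)

product-map-∈ : ∀ (xs : List A) {F G : A → ℕ} → (∀ {x} → x ∈ xs → F x ≡ G x) → product (map F xs) ≡ product (map G xs)
product-map-∈ []       eq = refl
product-map-∈ (x ∷ xs) eq = cong₂ _*_ (eq (here refl)) (product-map-∈ xs (eq ∘ there))

count-upTo : ∀ {P : ℕ → Set} (P? : Decidable P) a → length (filter P? (upTo (suc a))) ≡
             length (filter P? (upTo a)) + length (guard (P? a) a)
count-upTo P? a = begin
  length (filter P? (upTo (suc a)))               ≡⟨ cong (length ∘ filter P?) (sym (upTo-∷ʳ a)) ⟩
  length (filter P? (upTo a ++ a ∷ []))           ≡⟨ cong length (filter-++ P? (upTo a) (a ∷ [])) ⟩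
  length (filter P? (upTo a) ++ filter P? (a ∷ []))  ≡⟨ length-++ (filter P? (upTo a)) ⟩
  length (filter P? (upTo a)) + length (filter P? (a ∷ []))  ≡⟨ cong (length (filter P? (upTo a)) +_) last ⟩
  length (filter P? (upTo a)) + length (guard (P? a) a)  ∎
  where
  open ≡-Reasoning
  last : length (filter P? (a ∷ [])) ≡ length (guard (P? a) a)
  last with P? a
  ... | yes _ = refl
  ... | no _ = refl

count-above : ∀ d a → length (filter (d <?_) (upTo a)) ≡ a ∸ suc d
count-above d zero = refl
count-above d (suc a) with count-upTo (d <?_) a
... | eq with d <? a
...   | yes d<a = trans eq (trans (cong (_+ 1) (count-above d a)) (trans (+-comm _ 1) (sym (+-∸-assoc 1 d<a))))
...   | no d≮a = trans eq (trans (+-identityʳ _) (trans (count-above d a)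
          (trans (m≤n⇒m∸n≡0 (m≤n⇒m≤1+n (≮⇒≥ d≮a))) (sym (m≤n⇒m∸n≡0 (≮⇒≥ d≮a))))))

count-equal : ∀ d a → length (filter (_≟ d) (upTo a)) ≡ length (guard (d <? a) d)
count-equal d zero with d <? 0
... | no _ = refl
count-equal d (suc a) with count-upTo (_≟ d) a
... | eq with a ≟ d
...   | yes refl with a <? suc a
...     | no a≮ = contradiction (n<1+n a) a≮
...     | yes _ = trans eq (cong (_+ 1) (trans (count-equal a a) (irr (a <? a))))
  where
  irr : (d : Dec (a < a)) → length (guard d a) ≡ 0
  irr (yes a<a) = contradiction a<a (<-irrefl refl)
  irr (no _) = refl
count-equal d (suc a) | eq | no a≢d = trans eq (trans (+-identityʳ _)
    (trans (count-equal d a) (same (d <? a) (d <? suc a))))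
  where
  same : (x : Dec (d < a)) (y : Dec (d < suc a)) → length (guard x d) ≡ length (guard y d)
  same (yes _) (yes _) = refl
  same (no _) (no _) = refl
  same (yes d<a) (no d≮) = contradiction (m≤n⇒m≤1+n d<a) d≮
  same (no d≮a) (yes (s≤s d≤a)) = contradiction (≤∧≢⇒< d≤a (a≢d ∘ sym)) d≮a

length-filter-map : ∀ {B : Set} {P : B → Set} {Q : A → Set} (P? : Decidable P) (Q? : Decidable Q) (g : A → B) xs →
  (∀ {x} → x ∈ xs → P (g x) → Q x) → (∀ {x} → x ∈ xs → Q x → P (g x)) →
  length (filter P? (map g xs)) ≡ length (filter Q? xs)
length-filter-map P? Q? g xs to from =
  trans (cong length (filter-map P? Q? g xs to from)) (length-map g (filter Q? xs))

length-filter-diagram : ∀ {P : Box → Set} (P? : Decidable P) a ν →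
  length (filter P? (diagram (a ∷ ν))) ≡ length (filter P? (firstRow a)) + length (filter P? (map shift (diagram ν)))
length-filter-diagram P? a ν = begin
  length (filter P? (diagram (a ∷ ν)))                          ≡⟨ cong (length ∘ filter P?) (diagram-∷ a ν) ⟩
  length (filter P? (firstRow a ++ map shift (diagram ν)))      ≡⟨ cong length (filter-++ P? (firstRow a) _) ⟩
  length (filter P? (firstRow a) ++ filter P? (map shift (diagram ν)))  ≡⟨ length-++ (filter P? (firstRow a)) ⟩
  length (filter P? (firstRow a)) + length (filter P? (map shift (diagram ν)))  ∎
  where open ≡-Reasoning

colCount : List ℕ → ℕ → ℕ
colCount λs j = length (filter (λ b → col b ≟ j) (diagram λs))

colCount-zero : ∀ {λs j} → (∀ {b} → b ∈ diagram λs → col b ≢ j) → colCount λs j ≡ 0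
colCount-zero {λs} {j} col≢ = cong length (filter-empty (λ b → col b ≟ j) (diagram λs) col≢)

colCount-∷ : ∀ c ν d → colCount (c ∷ ν) (2 + d) ≡ length (guard (d <? c) d) + colCount ν (suc d)
colCount-∷ c ν d = trans (length-filter-diagram (λ b → col b ≟ 2 + d) c ν) (cong₂ _+_
  (trans (length-filter-map (λ b → col b ≟ 2 + d) (_≟ d) firstBox (upTo c)
      (λ _ → suc-injective ∘ suc-injective) (λ _ → cong (λ n → suc (suc n)))) (count-equal d c))
  (length-filter-map (λ b → col b ≟ 2 + d) (λ b → col b ≟ suc d) shift (diagram ν) (λ _ → suc-injective)
      (λ _ → cong suc)))

-- The hook of `firstBox d` in `a ∷ ν`: `a ∸ d` counts the box and its arm, and the column 2 + d, as
-- a column and as the index of a part, becomes 1 + d in `ν`.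
firstHook : ℕ → List ℕ → ℕ → ℕ
firstHook a ν d = (a ∸ d) + colCount ν (suc d) + part ν (suc d)

module _ {a ν} (s : StrictBelow a ν) where

  private
    row>0 : ∀ {b} → b ∈ diagram ν → 0 < row b
    row>0 = proj₁ ∘ diagram-bounds s

  hook-firstBox : ∀ {d} → d < a → hook (a ∷ ν) (firstBox d) ≡ firstHook a ν d
  hook-firstBox {d} d<a = begin
    suc (arm (a ∷ ν) (firstBox d) + leg (a ∷ ν) (firstBox d) + part ν (suc d))
      ≡⟨ cong₂ (λ x y → suc (x + y + part ν (suc d))) arm≡ leg≡ ⟩
    suc (a ∸ suc d) + colCount ν (suc d) + part ν (suc d)
      ≡⟨ cong (λ x → x + colCount ν (suc d) + part ν (suc d)) (sym (+-∸-assoc 1 d<a)) ⟩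
    firstHook a ν d ∎
    where
    open ≡-Reasoning
    arm? : Decidable (λ b → row b ≡ 1 × 2 + d < col b)
    arm? b = (row b ≟ 1) ×-dec (2 + d <? col b)
    leg? : Decidable (λ b → col b ≡ 2 + d × 1 < row b)
    leg? b = (col b ≟ 2 + d) ×-dec (1 <? row b)
    arm≡ : arm (a ∷ ν) (firstBox d) ≡ a ∸ suc d
    arm≡ = begin
      length (filter arm? (diagram (a ∷ ν)))
        ≡⟨ length-filter-diagram arm? a ν ⟩
      length (filter arm? (firstRow a)) + length (filter arm? (map shift (diagram ν)))
        ≡⟨ cong₂ _+_ (length-filter-map arm? (d <?_) firstBox (upTo a) (λ { _ (_ , s≤s (s≤s d<)) → d< })
             (λ _ d< → refl , s≤s (s≤s d<)))
             (cong length (filter-empty arm? (map shift (diagram ν)) notFirst)) ⟩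
      length (filter (d <?_) (upTo a)) + 0
        ≡⟨ trans (+-identityʳ _) (count-above d a) ⟩
      a ∸ suc d ∎
      where
      notFirst : ∀ {b} → b ∈ map shift (diagram ν) → ¬ (row b ≡ 1 × 2 + d < col b)
      notFirst b∈ (r≡ , _) with ∈-map⁻ shift b∈
      ... | _ , b∈′ , refl = <-irrefl (sym (suc-injective r≡)) (row>0 b∈′)
    leg≡ : leg (a ∷ ν) (firstBox d) ≡ colCount ν (suc d)
    leg≡ = begin
      length (filter leg? (diagram (a ∷ ν)))
        ≡⟨ length-filter-diagram leg? a ν ⟩
      length (filter leg? (firstRow a)) + length (filter leg? (map shift (diagram ν)))
        ≡⟨ cong₂ _+_ (cong length (filter-empty leg? (firstRow a) first))
             (length-filter-map leg? (λ b → col b ≟ suc d) shift (diagram ν)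
                 (λ _ (c≡ , _) → suc-injective c≡) (λ b∈ c≡ → cong suc c≡ , s≤s (row>0 b∈))) ⟩
      colCount ν (suc d) ∎
      where
      first : ∀ {b} → b ∈ firstRow a → ¬ (col b ≡ 2 + d × 1 < row b)
      first b∈ (_ , 1<r) with ∈-firstRow⁻ b∈
      ... | _ , _ , refl = <-irrefl refl 1<r

  -- Arm and leg look only to the right and downwards, and the index of the extra part moves
  -- together with the column.
  hook-shift : ∀ {b} → b ∈ diagram ν → hook (a ∷ ν) (shift b) ≡ hook ν b
  hook-shift {b@(i , suc j)} b∈ = cong suc (cong (_+ part ν (suc j)) (cong₂ _+_ arm≡ leg≡))
    where
    open ≡-Reasoning
    arm? : Decidable (λ b′ → row b′ ≡ row (shift b) × col (shift b) < col b′)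
    arm? b′ = (row b′ ≟ row (shift b)) ×-dec (col (shift b) <? col b′)
    leg? : Decidable (λ b′ → col b′ ≡ col (shift b) × row (shift b) < row b′)
    leg? b′ = (col b′ ≟ col (shift b)) ×-dec (row (shift b) <? row b′)
    arm≡ : arm (a ∷ ν) (shift b) ≡ arm ν b
    arm≡ = trans (length-filter-diagram arm? a ν) (cong₂ _+_
      (cong length (filter-empty arm? (firstRow a) first))
      (length-filter-map arm? _ shift (diagram ν) (λ { _ (r≡ , s≤s c<) → suc-injective r≡ , c< })
          (λ { _ (r≡ , c<) → cong suc r≡ , s≤s c< })))
      where
      first : ∀ {b′} → b′ ∈ firstRow a → ¬ (row b′ ≡ suc i × suc (suc j) < col b′)
      first b′∈ (r≡ , _) with ∈-firstRow⁻ b′∈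
      ... | _ , _ , refl = <-irrefl (suc-injective r≡) (row>0 b∈)
    leg≡ : leg (a ∷ ν) (shift b) ≡ leg ν b
    leg≡ = trans (length-filter-diagram leg? a ν) (cong₂ _+_
      (cong length (filter-empty leg? (firstRow a) first))
      (length-filter-map leg? _ shift (diagram ν) (λ { _ (c≡ , s≤s r<) → suc-injective c≡ , r< })
          (λ { _ (c≡ , r<) → cong suc c≡ , s≤s r< })))
      where
      first : ∀ {b′} → b′ ∈ firstRow a → ¬ (col b′ ≡ suc (suc j) × suc i < row b′)
      first b′∈ (_ , r<) with ∈-firstRow⁻ b′∈
      ... | _ , _ , refl with r<
      ...   | s≤s ()
  hook-shift {i , zero} b∈ with diagram-bounds s b∈
  ... | _ , () , _

  hookProduct-∷ : hookProduct (a ∷ ν) ≡ ∏ a (firstHook a ν) * hookProduct ν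
  hookProduct-∷ = begin
    product (map (hook (a ∷ ν)) (diagram (a ∷ ν)))
      ≡⟨ cong (product ∘ map (hook (a ∷ ν))) (diagram-∷ a ν) ⟩
    product (map (hook (a ∷ ν)) (firstRow a ++ map shift (diagram ν)))
      ≡⟨ trans (cong product (map-++ (hook (a ∷ ν)) (firstRow a) _))
           (product-++ (map (hook (a ∷ ν)) (firstRow a)) _) ⟩
    product (map (hook (a ∷ ν)) (firstRow a)) * product (map (hook (a ∷ ν)) (map shift (diagram ν)))
      ≡⟨ cong₂ (λ x y → product x * product y) (sym (map-∘ (upTo a))) (sym (map-∘ (diagram ν))) ⟩
    product (map (hook (a ∷ ν) ∘ firstBox) (upTo a)) * product (map (hook (a ∷ ν) ∘ shift) (diagram ν))
      ≡⟨ cong₂ _*_ (trans (product-upTo a _) (∏-cong a hook-firstBox)) (product-map-∈ (diagram ν) hook-shift) ⟩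
    ∏ a (firstHook a ν) * hookProduct ν ∎
    where open ≡-Reasoning

-- Distinct positive parts below `c` leave no room for a part with index `c` or beyond.
part-zero : ∀ {c ν} d → StrictBelow c ν → c ≤ suc d → part ν (suc d) ≡ 0
part-zero d [] _ = refl
part-zero zero ((0<x , x<c) ∷ _) c≤ = contradiction (≤-trans x<c c≤) (≤⇒≯ 0<x)
part-zero (suc d) ((_ , x<c) ∷ s) c≤ = part-zero d s (≤-pred (≤-trans x<c c≤))

firstHook-beyond : ∀ {c ν} a d → 0 < c → StrictBelow c ν → c ≤ d → firstHook a ν d ≡ a ∸ d
firstHook-beyond {c} {ν} a d 0<c s c≤d rewrite part-zero d s (m≤n⇒m≤1+n c≤d)
  | colCount-zero {ν} {suc d} (λ b∈ c≡ → <-irrefl c≡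
      (≤-<-trans (proj₂ (proj₂ (diagram-bounds s b∈))) (s≤s (<-≤-trans (head-< 0<c s) c≤d)))) =
  trans (+-identityʳ _) (+-identityʳ _)

-- Inserting `c` shifts the tail by one column. The arm at the shifted position is shorter by one,
-- and the box of the new row in that column compensates.
firstHook-∷-within : ∀ {c ν} a d → d < c → d ≤ a → firstHook (suc a) (c ∷ ν) (suc d) ≡ firstHook (suc a) ν d
firstHook-∷-within {c} {ν} a d d<c d≤a rewrite colCount-∷ c ν d with d <? c
... | no d≮c = contradiction d<c d≮c
... | yes _ = cong (_+ part ν (suc d)) (trans (lemma (a ∸ d) (colCount ν (suc d)))
    (cong (_+ colCount ν (suc d)) (sym (+-∸-assoc 1 d≤a))))
  where
  lemma : ∀ x y → x + (1 + y) ≡ 1 + x + y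
  lemma = solve-∀

firstHook-∷-beyond : ∀ {c ν} a d → 0 < c → StrictBelow c ν → c ≤ d → firstHook (suc a) (c ∷ ν) (suc d) ≡ a ∸ d
firstHook-∷-beyond {c} {ν} a d 0<c s c≤d = trans (cong (λ n → (a ∸ d) + n + part ν (suc d)) eq)
    (firstHook-beyond a d 0<c s c≤d)
  where
  eq : colCount (c ∷ ν) (2 + d) ≡ colCount ν (suc d)
  eq rewrite colCount-∷ c ν d with d <? c
  ... | yes d<c = contradiction d<c (≤⇒≯ c≤d)
  ... | no _ = refl

firstHooks-[] : ∀ a → ∏ a (firstHook a []) ≡ a !
firstHooks-[] a = trans (∏-cong a {G = a ∸_} (λ _ → trans (+-identityʳ _) (+-identityʳ _))) (∏-! a)

-- As a multiset, the hooks of the first row gain a + c, at the first box, and lose a - c. The other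
-- hooks move by one column while the inserted row covers them, and beyond it they run down to 1. By
-- iteration their product is a! times the product of (a + c) / (a - c) over the lower parts c.
firstHooks-∷ : ∀ {a c ν} → StrictBelow a (c ∷ ν) →
               ∏ a (firstHook a (c ∷ ν)) * (a ∸ c) ≡ (a + c) * ∏ a (firstHook a ν)
firstHooks-∷ {suc a} {c} {ν} s′@((0<c , s≤s c≤a) ∷ s) = begin
  firstHook (suc a) (c ∷ ν) 0 * ∏ a (firstHook (suc a) (c ∷ ν) ∘ suc) * (suc a ∸ c)
    ≡⟨ cong₂ (λ x y → x * y * (suc a ∸ c)) first≡ rest≡ ⟩
  (suc a + c) * (∏ c (firstHook (suc a) ν) * e !) * (suc a ∸ c)
    ≡⟨ cong ((suc a + c) * (∏ c (firstHook (suc a) ν) * e !) *_) (+-∸-assoc 1 c≤a) ⟩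
  (suc a + c) * (∏ c (firstHook (suc a) ν) * e !) * suc e
    ≡⟨ lemma (suc a + c) (∏ c (firstHook (suc a) ν)) (e !) (suc e) ⟩
  (suc a + c) * (∏ c (firstHook (suc a) ν) * (suc e) !)
    ≡⟨ cong ((suc a + c) *_) (sym all≡) ⟩
  (suc a + c) * ∏ (suc a) (firstHook (suc a) ν) ∎
  where
  open ≡-Reasoning
  e : ℕ
  e = a ∸ c
  c+e≡a : c + e ≡ a
  c+e≡a = m+[n∸m]≡n c≤a
  lemma : ∀ x y z w → x * (y * z) * w ≡ x * (y * (w * z))
  lemma = solve-∀
  a∸[c+d] : ∀ d → a ∸ (c + d) ≡ e ∸ d
  a∸[c+d] d = sym (∸-+-assoc a c d)
  first≡ : firstHook (suc a) (c ∷ ν) 0 ≡ suc a + c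
  first≡ = trans
    (cong (λ n → suc a + n + c) (colCount-zero {c ∷ ν} {1}
        (λ b∈ c≡ → <-irrefl (sym c≡) (proj₁ (proj₂ (diagram-bounds s′ b∈))))))
    (cong (_+ c) (+-identityʳ (suc a)))
  rest≡ : ∏ a (firstHook (suc a) (c ∷ ν) ∘ suc) ≡ ∏ c (firstHook (suc a) ν) * e !
  rest≡ = begin
    ∏ a F
      ≡⟨ cong (λ n → ∏ n F) (sym c+e≡a) ⟩
    ∏ (c + e) F
      ≡⟨ ∏-+ c e F ⟩
    ∏ c F * ∏ e (F ∘ (c +_))
      ≡⟨ cong₂ _*_ (∏-cong c (λ {d} d<c → firstHook-∷-within {c} {ν} a d d<c (≤-trans (<⇒≤ d<c) c≤a)))
           (trans (∏-cong e (λ {d} _ → trans (firstHook-∷-beyond a (c + d) 0<c s (m≤m+n c d)) (a∸[c+d] d))) (∏-! e)) ⟩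
    ∏ c (firstHook (suc a) ν) * e ! ∎
    where
    F : ℕ → ℕ
    F = firstHook (suc a) (c ∷ ν) ∘ suc
  all≡ : ∏ (suc a) (firstHook (suc a) ν) ≡ ∏ c (firstHook (suc a) ν) * (suc e) !
  all≡ = begin
    ∏ (suc a) G
      ≡⟨ cong (λ n → ∏ n G) (sym (trans (+-suc c e) (cong suc c+e≡a))) ⟩
    ∏ (c + suc e) G
      ≡⟨ ∏-+ c (suc e) G ⟩
    ∏ c G * ∏ (suc e) (G ∘ (c +_))
      ≡⟨ cong (∏ c G *_) (trans (∏-cong (suc e) (λ {d} d<1+e → trans
           (firstHook-beyond (suc a) (c + d) 0<c s (m≤m+n c d)) (shifted d))) (∏-! (suc e))) ⟩
    ∏ c G * (suc e) ! ∎
    where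
    G : ℕ → ℕ
    G = firstHook (suc a) ν
    shifted : ∀ d → suc a ∸ (c + d) ≡ suc e ∸ d
    shifted d = trans (sym (∸-+-assoc (suc a) c d)) (cong (_∸ d) (+-∸-assoc 1 c≤a))

-- Partial fractions

ℚ-ring : ACR.AlmostCommutativeRing 0ℓ 0ℓ
ℚ-ring = ACR.fromCommutativeRing ℚ.+-*-commutativeRing (λ x → dec⇒maybe (0ℚ ℚ.≟ x))

fromℚᵘ-homo-+ : ∀ p q → ℚ.fromℚᵘ p ℚ.+ ℚ.fromℚᵘ q ≡ ℚ.fromℚᵘ (p ℚᵘ.+ q)
fromℚᵘ-homo-+ p q = ℚ.toℚᵘ-injective (ℚᵘ.≃-trans (ℚ.toℚᵘ-homo-+ (ℚ.fromℚᵘ p) (ℚ.fromℚᵘ q))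
  (ℚᵘ.≃-trans (ℚᵘ.+-cong (ℚ.toℚᵘ-fromℚᵘ p) (ℚ.toℚᵘ-fromℚᵘ q)) (ℚᵘ.≃-sym (ℚ.toℚᵘ-fromℚᵘ (p ℚᵘ.+ q)))))

fromℚᵘ-homo-* : ∀ p q → ℚ.fromℚᵘ p ℚ.* ℚ.fromℚᵘ q ≡ ℚ.fromℚᵘ (p ℚᵘ.* q)
fromℚᵘ-homo-* p q = ℚ.toℚᵘ-injective (ℚᵘ.≃-trans (ℚ.toℚᵘ-homo-* (ℚ.fromℚᵘ p) (ℚ.fromℚᵘ q))
  (ℚᵘ.≃-trans (ℚᵘ.*-cong (ℚ.toℚᵘ-fromℚᵘ p) (ℚ.toℚᵘ-fromℚᵘ q)) (ℚᵘ.≃-sym (ℚ.toℚᵘ-fromℚᵘ (p ℚᵘ.* q)))))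

integer : ℕ → ℚᵘ.ℚᵘ
integer n = ℚᵘ.mkℚᵘ (ℤ.+ n) 0

abstract
  ι : ℕ → ℚ
  ι n = ℤ.+ n / 1

  ι≡/1 : ∀ n → ι n ≡ ℤ.+ n / 1
  ι≡/1 n = refl

  ι-zero : ι 0 ≡ 0ℚ
  ι-zero = refl

  ι-one : ι 1 ≡ 1ℚ
  ι-one = refl

  ι-+ : ∀ m n → ι (m + n) ≡ ι m ℚ.+ ι n
  ι-+ m n = sym (trans (fromℚᵘ-homo-+ (integer m) (integer n))
    (ℚ.fromℚᵘ-cong {integer m ℚᵘ.+ integer n} {integer (m + n)}
      (ℚᵘ.*≡* (cong (ℤ._* ℤ.+ 1) (cong₂ ℤ._+_ (ℤ.*-identityʳ (ℤ.+ m)) (ℤ.*-identityʳ (ℤ.+ n)))))))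

  ι-* : ∀ m n → ι (m * n) ≡ ι m ℚ.* ι n
  ι-* m n = sym (trans (fromℚᵘ-homo-* (integer m) (integer n))
    (ℚ.fromℚᵘ-cong {integer m ℚᵘ.* integer n} {integer (m * n)} (ℚᵘ.*≡* (cong (ℤ._* ℤ.+ 1) (sym (ℤ.pos-* m n))))))

  ι-injective : ∀ {m n} → ι m ≡ ι n → m ≡ n
  ι-injective {m} {n} eq with ℚ.fromℚᵘ-injective {integer m} {integer n} eq
  ... | ℚᵘ.*≡* eq′ = ℤ.+-injective (trans (sym (ℤ.*-identityʳ (ℤ.+ m))) (trans eq′ (ℤ.*-identityʳ (ℤ.+ n))))

  /-*-ι : ∀ m d .{{_ : NonZero d}} → (ℤ.+ m / d) ℚ.* ι d ≡ ι m
  /-*-ι m (suc d) = trans (fromℚᵘ-homo-* (ℚᵘ.mkℚᵘ (ℤ.+ m) d) (integer (suc d)))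
    (ℚ.fromℚᵘ-cong {ℚᵘ.mkℚᵘ (ℤ.+ m) d ℚᵘ.* integer (suc d)} {integer m}
      (ℚᵘ.*≡* (trans (ℤ.*-identityʳ (ℤ.+ m ℤ.* ℤ.+ suc d)) (cong (λ n → ℤ.+ m ℤ.* ℤ.+ suc n) (sym (*-identityʳ d))))))

ι-suc : ∀ n → ι (suc n) ≡ 1ℚ ℚ.+ ι n
ι-suc n = trans (ι-+ 1 n) (cong (ℚ._+ ι n) ι-one)

ι≢0 : ∀ n → ι (suc n) ≢ 0ℚ
ι≢0 n eq with ι-injective {suc n} {0} (trans eq (sym ι-zero))
... | ()

-- The inverse of 0 is taken to be 0.
abstract
  inv : ℚ → ℚ
  inv x with x ℚ.≟ 0ℚ
  ... | yes _ = 0ℚ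
  ... | no x≢0 = (ℚ.1/ x) {{ℚ.≢-nonZero x≢0}}

  inv-inverseʳ : ∀ {x} → x ≢ 0ℚ → x ℚ.* inv x ≡ 1ℚ
  inv-inverseʳ {x} x≢0 with x ℚ.≟ 0ℚ
  ... | yes x≡0 = contradiction x≡0 x≢0
  ... | no x≢0′ = ℚ.*-inverseʳ x {{ℚ.≢-nonZero x≢0′}}

unit≢0 : ∀ {x y} → x ℚ.* y ≡ 1ℚ → x ≢ 0ℚ
unit≢0 {y = y} xy≡1 refl with trans (sym (ℚ.*-zeroˡ y)) xy≡1
... | ()

inv-unique : ∀ {x y} → x ℚ.* y ≡ 1ℚ → inv x ≡ y
inv-unique {x} {y} xy≡1 = begin
  inv x              ≡⟨ ℚ.*-identityʳ (inv x) ⟨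
  inv x ℚ.* 1ℚ         ≡⟨ cong (inv x ℚ.*_) xy≡1 ⟨
  inv x ℚ.* (x ℚ.* y)    ≡⟨ lemma (inv x) x y ⟩
  x ℚ.* inv x ℚ.* y      ≡⟨ cong (ℚ._* y) (inv-inverseʳ {x} (unit≢0 {x} {y} xy≡1)) ⟩
  1ℚ ℚ.* y             ≡⟨ ℚ.*-identityˡ y ⟩
  y                  ∎
  where
  open ≡-Reasoning
  lemma : ∀ z x y → z ℚ.* (x ℚ.* y) ≡ x ℚ.* z ℚ.* y
  lemma = RingSolver.solve-∀ ℚ-ring

inv-ι : ∀ {n} → 0 < n → ι n ℚ.* inv (ι n) ≡ 1ℚ
inv-ι {suc n} _ = inv-inverseʳ (ι≢0 n)

ι-∸ : ∀ {m n} → n ≤ m → ι (m ∸ n) ≡ ι m ℚ.- ι n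
ι-∸ {m} {n} n≤m = begin
  ι (m ∸ n)                  ≡⟨ lemma (ι (m ∸ n)) (ι n) ⟨
  ι (m ∸ n) ℚ.+ ι n ℚ.- ι n      ≡⟨ cong (ℚ._- ι n) (sym (ι-+ (m ∸ n) n)) ⟩
  ι (m ∸ n + n) ℚ.- ι n      ≡⟨ cong (λ k → ι k ℚ.- ι n) (m∸n+n≡m n≤m) ⟩
  ι m ℚ.- ι n                  ∎
  where
  open ≡-Reasoning
  lemma : ∀ x y → x ℚ.+ y ℚ.- y ≡ x
  lemma = RingSolver.solve-∀ ℚ-ring

inv-difference : ∀ {m n} → n < m → (ι m ℚ.- ι n) ℚ.* inv (ι m ℚ.- ι n) ≡ 1ℚ
inv-difference {m} {n} n<m = subst (λ x → x ℚ.* inv x ≡ 1ℚ) (ι-∸ (<⇒≤ n<m)) (inv-ι (m<n⇒0<n∸m n<m))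

inv-sum : ∀ {m n} → 0 < m + n → (ι m ℚ.+ ι n) ℚ.* inv (ι m ℚ.+ ι n) ≡ 1ℚ
inv-sum {m} {n} 0<m+n = subst (λ x → x ℚ.* inv x ≡ 1ℚ) (ι-+ m n) (inv-ι 0<m+n)

∑ℚ-++ : ∀ (xs ys : List A) (g : A → ℚ) → ∑ℚ (xs ++ ys) g ≡ ∑ℚ xs g ℚ.+ ∑ℚ ys g
∑ℚ-++ []       ys g = sym (ℚ.+-identityˡ _)
∑ℚ-++ (x ∷ xs) ys g = trans (cong (g x ℚ.+_) (∑ℚ-++ xs ys g)) (sym (ℚ.+-assoc (g x) _ _))

∑ℚ-map : ∀ (k : A → B) xs (g : B → ℚ) → ∑ℚ (map k xs) g ≡ ∑ℚ xs (g ∘ k)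
∑ℚ-map k []       g = refl
∑ℚ-map k (x ∷ xs) g = cong (g (k x) ℚ.+_) (∑ℚ-map k xs g)

∑ℚ-cong : ∀ (xs : List A) {f g : A → ℚ} → (∀ {x} → x ∈ xs → f x ≡ g x) → ∑ℚ xs f ≡ ∑ℚ xs g
∑ℚ-cong []       eq = refl
∑ℚ-cong (x ∷ xs) eq = cong₂ ℚ._+_ (eq (here refl)) (∑ℚ-cong xs (eq ∘ there))

∑ℚ-*ˡ : ∀ (xs : List A) k (f : A → ℚ) → ∑ℚ xs (λ x → k ℚ.* f x) ≡ k ℚ.* ∑ℚ xs f
∑ℚ-*ˡ []       k f = sym (ℚ.*-zeroʳ k)
∑ℚ-*ˡ (x ∷ xs) k f = trans (cong (k ℚ.* f x ℚ.+_) (∑ℚ-*ˡ xs k f)) (sym (ℚ.*-distribˡ-+ k (f x) _))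

ι-∑ : ∀ (xs : List A) (f : A → ℕ) → ι (∑ xs f) ≡ ∑ℚ xs (ι ∘ f)
ι-∑ []       f = ι-zero
ι-∑ (x ∷ xs) f = trans (ι-+ (f x) (∑ xs f)) (cong (ι (f x) ℚ.+_) (ι-∑ xs f))

-- Partial fractions of z ↦ ∏ₚ (1 + 2 p / (node p − z)), where node p = p (p − 1);
-- poleSum ps h is the sum of h over its poles, weighted by half of minus the residues.

node : ℕ → ℚ
node p = ι p ℚ.* (ι p ℚ.- 1ℚ)

gapInv : ℕ → ℕ → ℚ
gapInv p q = inv (node p ℚ.- node q)

factor : ℕ → ℕ → ℚ
factor p x = 1ℚ ℚ.+ (ι p ℚ.+ ι p) ℚ.* gapInv p x

factors : List ℕ → ℕ → ℚ
factors []       z = 1ℚ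
factors (p ∷ ps) z = factor p z ℚ.* factors ps z

poleSum : List ℕ → (ℕ → ℚ) → ℚ
poleSum []       h = 0ℚ
poleSum (p ∷ ps) h = ι p ℚ.* factors ps p ℚ.* h p ℚ.+ poleSum ps (λ x → h x ℚ.* factor p x)

poleSum-linear : ∀ ps {α β} {h h₁ h₂ : ℕ → ℚ} → (∀ {x} → x ∈ ps → h x ≡ α ℚ.* h₁ x ℚ.+ β ℚ.* h₂ x) →
           poleSum ps h ≡ α ℚ.* poleSum ps h₁ ℚ.+ β ℚ.* poleSum ps h₂
poleSum-linear [] {α} {β} _ = sym (trans (cong₂ ℚ._+_ (ℚ.*-zeroʳ α) (ℚ.*-zeroʳ β)) (ℚ.+-identityˡ 0ℚ))
poleSum-linear (p ∷ ps) {α} {β} {h} {h₁} {h₂} eq = begin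
  c ℚ.* h p ℚ.+ poleSum ps (λ x → h x ℚ.* factor p x)
    ≡⟨ cong₂ (λ y s → c ℚ.* y ℚ.+ s) (eq (here refl))
         (poleSum-linear ps {α} {β} {_} {λ x → h₁ x ℚ.* factor p x} {λ x → h₂ x ℚ.* factor p x} λ {x} x∈ →
           trans (cong (ℚ._* factor p x) (eq (there x∈))) (lemma₁ α β (h₁ x) (h₂ x) (factor p x))) ⟩
  c ℚ.* (α ℚ.* h₁ p ℚ.+ β ℚ.* h₂ p) ℚ.+ (α ℚ.* poleSum ps (λ x → h₁ x ℚ.* factor p x) ℚ.+ β ℚ.* poleSum ps
      (λ x → h₂ x ℚ.* factor p x))
    ≡⟨ lemma₂ c α β (h₁ p) (h₂ p) (poleSum ps (λ x → h₁ x ℚ.* factor p x)) (poleSum ps (λ x → h₂ x ℚ.* factor p x)) ⟩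
  α ℚ.* poleSum (p ∷ ps) h₁ ℚ.+ β ℚ.* poleSum (p ∷ ps) h₂ ∎
  where
  open ≡-Reasoning
  c : ℚ
  c = ι p ℚ.* factors ps p
  lemma₁ : ∀ α β x y t → (α ℚ.* x ℚ.+ β ℚ.* y) ℚ.* t ≡ α ℚ.* (x ℚ.* t) ℚ.+ β ℚ.* (y ℚ.* t)
  lemma₁ = RingSolver.solve-∀ ℚ-ring
  lemma₂ : ∀ c α β x y s t → c ℚ.* (α ℚ.* x ℚ.+ β ℚ.* y) ℚ.+ (α ℚ.* s ℚ.+ β ℚ.* t) ≡ α ℚ.* (c ℚ.* x ℚ.+ s)
      ℚ.+ β ℚ.* (c ℚ.* y ℚ.+ t)
  lemma₂ = RingSolver.solve-∀ ℚ-ring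

Apart : ℕ → ℕ → Set
Apart p q = (node p ℚ.- node q) ℚ.* gapInv p q ≡ 1ℚ

-- The difference of the nodes is (p - q)(p + q - 1). Positivity of `q` excludes the coincidence of
-- the nodes of 0 and 1.
apart-> : ∀ {p q} → 0 < q → q < p → Apart p q
apart-> {suc p} {suc q} _ q<p = inv-inverseʳ {node (suc p) ℚ.- node (suc q)} (unit≢0 {y = inv Δ ℚ.* inv Σ} (begin
  (node (suc p) ℚ.- node (suc q)) ℚ.* (inv Δ ℚ.* inv Σ)
    ≡⟨ cong (ℚ._* (inv Δ ℚ.* inv Σ)) (cong₂ (λ x y → x ℚ.* (x ℚ.- 1ℚ) ℚ.- y ℚ.* (y ℚ.- 1ℚ)) (ι-suc p) (ι-suc q)) ⟩
  ((1ℚ ℚ.+ ι p) ℚ.* (1ℚ ℚ.+ ι p ℚ.- 1ℚ) ℚ.- (1ℚ ℚ.+ ι q) ℚ.* (1ℚ ℚ.+ ι q ℚ.- 1ℚ)) ℚ.* (inv Δ ℚ.* inv Σ)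
    ≡⟨ lemma (ι p) (ι q) (inv Δ) (inv Σ) ⟩
  ((1ℚ ℚ.+ ι p) ℚ.- (1ℚ ℚ.+ ι q)) ℚ.* inv Δ ℚ.* ((1ℚ ℚ.+ ι p ℚ.+ ι q) ℚ.* inv Σ)
    ≡⟨ cong₂ (λ x y → (x ℚ.- y) ℚ.* inv Δ ℚ.* ((x ℚ.+ ι q) ℚ.* inv Σ)) (sym (ι-suc p)) (sym (ι-suc q)) ⟩
  Δ ℚ.* inv Δ ℚ.* (Σ ℚ.* inv Σ)
    ≡⟨ cong₂ ℚ._*_ (inv-difference q<p) (inv-sum {suc p} {q} (s≤s z≤n)) ⟩
  1ℚ ∎))
  where
  open ≡-Reasoning
  Δ Σ : ℚ
  Δ = ι (suc p) ℚ.- ι (suc q)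
  Σ = ι (suc p) ℚ.+ ι q
  lemma : ∀ x y d s → ((1ℚ ℚ.+ x) ℚ.* (1ℚ ℚ.+ x ℚ.- 1ℚ) ℚ.- (1ℚ ℚ.+ y) ℚ.* (1ℚ ℚ.+ y ℚ.- 1ℚ)) ℚ.* (d ℚ.* s) ≡
                      ((1ℚ ℚ.+ x) ℚ.- (1ℚ ℚ.+ y)) ℚ.* d ℚ.* ((1ℚ ℚ.+ x ℚ.+ y) ℚ.* s)
  lemma = RingSolver.solve-∀ ℚ-ring

gapInv-antisym : ∀ {p q} → Apart p q → gapInv q p ≡ ℚ.- gapInv p q
gapInv-antisym {p} {q} apart = inv-unique (trans (lemma (node p) (node q) (gapInv p q)) apart)
  where
  lemma : ∀ x y i → (y ℚ.- x) ℚ.* ℚ.- i ≡ (x ℚ.- y) ℚ.* i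
  lemma = RingSolver.solve-∀ ℚ-ring

apart-sym : ∀ {p q} → Apart p q → Apart q p
apart-sym {p} {q} apart = trans (cong ((node q ℚ.- node p) ℚ.*_) (gapInv-antisym {p} {q} apart))
    (trans (lemma (node p) (node q) (gapInv p q)) apart)
  where
  lemma : ∀ x y i → (y ℚ.- x) ℚ.* ℚ.- i ≡ (x ℚ.- y) ℚ.* i
  lemma = RingSolver.solve-∀ ℚ-ring

-- The two gaps on the left add up to the gap between p and a; dividing this by all three gaps
-- splits a product of two poles.
gapInv-product : ∀ {x a p} → Apart x a → Apart p x → Apart p a → gapInv x a ℚ.* gapInv p x ≡ gapInv p a ℚ.*
    (gapInv x a ℚ.+ gapInv p x)
gapInv-product {x} {a} {p} xa px pa = begin
  u ℚ.* v                                          ≡⟨ ℚ.*-identityˡ (u ℚ.* v) ⟨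
  1ℚ ℚ.* (u ℚ.* v)                                   ≡⟨ cong (ℚ._* (u ℚ.* v)) pa ⟨
  (node p ℚ.- node a) ℚ.* w ℚ.* (u ℚ.* v)                      ≡⟨ lemma (node x) (node a) (node p) u v w ⟩
  w ℚ.* ((node x ℚ.- node a) ℚ.* u ℚ.* v ℚ.+ (node p ℚ.- node x) ℚ.* v ℚ.* u)
      ≡⟨ cong₂ (λ y z → w ℚ.* (y ℚ.* v ℚ.+ z ℚ.* u)) xa px ⟩
  w ℚ.* (1ℚ ℚ.* v ℚ.+ 1ℚ ℚ.* u)                          ≡⟨ lemma′ u v w ⟩
  w ℚ.* (u ℚ.+ v)                                    ∎
  where
  open ≡-Reasoning
  u v w : ℚ
  u = gapInv x a
  v = gapInv p x
  w = gapInv p a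
  lemma : ∀ x a p u v w → (p ℚ.- a) ℚ.* w ℚ.* (u ℚ.* v) ≡ w ℚ.* ((x ℚ.- a) ℚ.* u ℚ.* v ℚ.+ (p ℚ.- x) ℚ.* v ℚ.* u)
  lemma = RingSolver.solve-∀ ℚ-ring
  lemma′ : ∀ u v w → w ℚ.* (1ℚ ℚ.* v ℚ.+ 1ℚ ℚ.* u) ≡ w ℚ.* (u ℚ.+ v)
  lemma′ = RingSolver.solve-∀ ℚ-ring

strict-apart : ∀ {b ps x} → StrictBelow b ps → x ∈ ps → 0 < x × x < b
strict-apart ((0<a , a<b) ∷ s) (here refl) = 0<a , a<b
strict-apart ((_ , a<b) ∷ s) (there x∈) = let 0<x , x<a = strict-apart s x∈ in 0<x , <-trans x<a a<b

-- The variable z is evaluated at `node a` only. Multiplication by the factor of p splits each old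
-- pole x into a pole seen from a and one seen from p. The latter cancel against the residue at p,
-- once `factors ps p` has been expanded as well; hence the induction hypothesis is used at both a
-- and p.
partialFractions : ∀ {b ps a} → StrictBelow b ps → (∀ {x} → x ∈ ps → Apart x a) →
                   factors ps a ≡ 1ℚ ℚ.+ (poleSum ps (λ x → gapInv x a) ℚ.+ poleSum ps (λ x → gapInv x a))
partialFractions [] _ = refl
partialFractions {ps = p ∷ ps} {a} (_ ∷ s) apart = sym (begin
  1ℚ ℚ.+ (poleSum (p ∷ ps) (λ x → gapInv x a) ℚ.+ poleSum (p ∷ ps) (λ x → gapInv x a))
    ≡⟨ cong₂ (λ r t → 1ℚ ℚ.+ ((ι p ℚ.* r ℚ.* i ℚ.+ t) ℚ.+ (ι p ℚ.* r ℚ.* i ℚ.+ t)))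
         (partialFractions s below) (poleSum-linear ps {1ℚ ℚ.+ (ι p ℚ.+ ι p) ℚ.* i}
         { ℚ.- ((ι p ℚ.+ ι p) ℚ.* i)} split) ⟩
  1ℚ ℚ.+ ((ι p ℚ.* (1ℚ ℚ.+ (Sₚ ℚ.+ Sₚ)) ℚ.* i ℚ.+ ((1ℚ ℚ.+ (ι p ℚ.+ ι p) ℚ.* i) ℚ.* Sₐ ℚ.+ ℚ.-
      ((ι p ℚ.+ ι p) ℚ.* i) ℚ.* Sₚ))
      ℚ.+ (ι p ℚ.* (1ℚ ℚ.+ (Sₚ ℚ.+ Sₚ)) ℚ.* i ℚ.+ ((1ℚ ℚ.+ (ι p ℚ.+ ι p) ℚ.* i) ℚ.* Sₐ ℚ.+ ℚ.-
          ((ι p ℚ.+ ι p) ℚ.* i) ℚ.* Sₚ)))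
    ≡⟨ lemma (ι p) i Sₐ Sₚ ⟩
  (1ℚ ℚ.+ (ι p ℚ.+ ι p) ℚ.* i) ℚ.* (1ℚ ℚ.+ (Sₐ ℚ.+ Sₐ))
    ≡⟨ cong (factor p a ℚ.*_) (partialFractions s (apart ∘ there)) ⟨
  factors (p ∷ ps) a ∎)
  where
  open ≡-Reasoning
  i Sₐ Sₚ : ℚ
  i = gapInv p a
  Sₐ = poleSum ps (λ x → gapInv x a)
  Sₚ = poleSum ps (λ x → gapInv x p)
  above : ∀ {x} → x ∈ ps → Apart p x
  above x∈ = let 0<x , x<p = strict-apart s x∈ in apart-> 0<x x<p
  below : ∀ {x} → x ∈ ps → Apart x p
  below {x} x∈ = apart-sym {p} {x} (above x∈)
  lemma : ∀ p i Sₐ Sₚ → 1ℚ ℚ.+ ((p ℚ.* (1ℚ ℚ.+ (Sₚ ℚ.+ Sₚ)) ℚ.* i ℚ.+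
      ((1ℚ ℚ.+ (p ℚ.+ p) ℚ.* i) ℚ.* Sₐ ℚ.+ ℚ.- ((p ℚ.+ p) ℚ.* i) ℚ.* Sₚ))
      ℚ.+ (p ℚ.* (1ℚ ℚ.+ (Sₚ ℚ.+ Sₚ)) ℚ.* i ℚ.+ ((1ℚ ℚ.+ (p ℚ.+ p) ℚ.* i) ℚ.* Sₐ ℚ.+ ℚ.- ((p ℚ.+ p) ℚ.* i)
          ℚ.* Sₚ))) ≡ (1ℚ ℚ.+ (p ℚ.+ p) ℚ.* i) ℚ.* (1ℚ ℚ.+ (Sₐ ℚ.+ Sₐ))
  lemma = RingSolver.solve-∀ ℚ-ring
  split : ∀ {x} → x ∈ ps → gapInv x a ℚ.* factor p x ≡ (1ℚ ℚ.+ (ι p ℚ.+ ι p) ℚ.* i) ℚ.* gapInv x a ℚ.+ ℚ.-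
      ((ι p ℚ.+ ι p) ℚ.* i) ℚ.* gapInv x p
  split {x} x∈ = begin
    gapInv x a ℚ.* (1ℚ ℚ.+ (ι p ℚ.+ ι p) ℚ.* gapInv p x)
      ≡⟨ lemma₁ (gapInv x a) (ι p) (gapInv p x) ⟩
    gapInv x a ℚ.+ (ι p ℚ.+ ι p) ℚ.* (gapInv x a ℚ.* gapInv p x)
      ≡⟨ cong (λ y → gapInv x a ℚ.+ (ι p ℚ.+ ι p) ℚ.* y)
           (gapInv-product {x} {a} {p} (apart (there x∈)) (above x∈) (apart (here refl))) ⟩
    gapInv x a ℚ.+ (ι p ℚ.+ ι p) ℚ.* (i ℚ.* (gapInv x a ℚ.+ gapInv p x))
      ≡⟨ cong (λ y → gapInv x a ℚ.+ (ι p ℚ.+ ι p) ℚ.* (i ℚ.* (gapInv x a ℚ.+ y)))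
           (gapInv-antisym {x} {p} (below x∈)) ⟩
    gapInv x a ℚ.+ (ι p ℚ.+ ι p) ℚ.* (i ℚ.* (gapInv x a ℚ.+ ℚ.- gapInv x p))
      ≡⟨ lemma₂ (gapInv x a) (ι p) i (gapInv x p) ⟩
    (1ℚ ℚ.+ (ι p ℚ.+ ι p) ℚ.* i) ℚ.* gapInv x a ℚ.+ ℚ.- ((ι p ℚ.+ ι p) ℚ.* i) ℚ.* gapInv x p ∎
    where
    lemma₁ : ∀ u p v → u ℚ.* (1ℚ ℚ.+ (p ℚ.+ p) ℚ.* v) ≡ u ℚ.+ (p ℚ.+ p) ℚ.* (u ℚ.* v)
    lemma₁ = RingSolver.solve-∀ ℚ-ring
    lemma₂ : ∀ u p i v → u ℚ.+ (p ℚ.+ p) ℚ.* (i ℚ.* (u ℚ.+ ℚ.- v)) ≡ (1ℚ ℚ.+ (p ℚ.+ p) ℚ.* i) ℚ.* u ℚ.+ ℚ.-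
        ((p ℚ.+ p) ℚ.* i) ℚ.* v
    lemma₂ = RingSolver.solve-∀ ℚ-ring

-- A comparison of the coefficients of 1/z at infinity, carried out inductively: expanding the
-- residue at p cancels the correction of the residues at the other poles, and p is left over.
poleSum-one : ∀ {b ps} → StrictBelow b ps → poleSum ps (λ _ → 1ℚ) ≡ ι (sum ps)
poleSum-one [] = sym ι-zero
poleSum-one {ps = p ∷ ps} (_ ∷ s) = begin
  ι p ℚ.* factors ps p ℚ.* 1ℚ ℚ.+ poleSum ps (λ x → 1ℚ ℚ.* factor p x)
    ≡⟨ cong₂ (λ r t → ι p ℚ.* r ℚ.* 1ℚ ℚ.+ t) (partialFractions s below)
         (poleSum-linear ps {1ℚ} { ℚ.- (ι p ℚ.+ ι p)} split) ⟩
  ι p ℚ.* (1ℚ ℚ.+ (Sₚ ℚ.+ Sₚ)) ℚ.* 1ℚ ℚ.+ (1ℚ ℚ.* poleSum ps (λ _ → 1ℚ) ℚ.+ ℚ.- (ι p ℚ.+ ι p) ℚ.* Sₚ)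
    ≡⟨ lemma (ι p) Sₚ (poleSum ps (λ _ → 1ℚ)) ⟩
  ι p ℚ.+ poleSum ps (λ _ → 1ℚ)
    ≡⟨ cong (ι p ℚ.+_) (poleSum-one s) ⟩
  ι p ℚ.+ ι (sum ps)
    ≡⟨ ι-+ p (sum ps) ⟨
  ι (p + sum ps) ∎
  where
  open ≡-Reasoning
  Sₚ : ℚ
  Sₚ = poleSum ps (λ x → gapInv x p)
  below : ∀ {x} → x ∈ ps → Apart x p
  below {x} x∈ = let 0<x , x<p = strict-apart s x∈ in apart-sym {p} {x} (apart-> 0<x x<p)
  lemma : ∀ p Sₚ s → p ℚ.* (1ℚ ℚ.+ (Sₚ ℚ.+ Sₚ)) ℚ.* 1ℚ ℚ.+ (1ℚ ℚ.* s ℚ.+ ℚ.- (p ℚ.+ p) ℚ.* Sₚ) ≡ p ℚ.+ s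
  lemma = RingSolver.solve-∀ ℚ-ring
  split : ∀ {x} → x ∈ ps → 1ℚ ℚ.* factor p x ≡ 1ℚ ℚ.* 1ℚ ℚ.+ ℚ.- (ι p ℚ.+ ι p) ℚ.* gapInv x p
  split {x} x∈ = trans (cong (λ y → 1ℚ ℚ.* (1ℚ ℚ.+ (ι p ℚ.+ ι p) ℚ.* y))
      (gapInv-antisym {x} {p} (below x∈))) (lemma₁ (ι p) (gapInv x p))
    where
    lemma₁ : ∀ p i → 1ℚ ℚ.* (1ℚ ℚ.+ (p ℚ.+ p) ℚ.* ℚ.- i) ≡ 1ℚ ℚ.* 1ℚ ℚ.+ ℚ.- (p ℚ.+ p) ℚ.* i
    lemma₁ = RingSolver.solve-∀ ℚ-ring

-- The hook formula

ratio : ℕ → ℕ → ℚ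
ratio a b = (ι a ℚ.- ι b) ℚ.* inv (ι a ℚ.+ ι b)

-- The inverse of the product of the hooks in the first row. As a formula it also makes sense if `a`
-- occurs in the list, and is then 0.
rowWeight : ℕ → List ℕ → ℚ
rowWeight a []      = inv (ι (a !))
rowWeight a (b ∷ ν) = ratio a b ℚ.* rowWeight a ν

-- This is 1 / H(λ) in Schur's form: the product of all 1 / λᵢ! and of (λᵢ - λⱼ) / (λᵢ + λⱼ) for i <
-- j.
hookWeight : List ℕ → ℚ
hookWeight []      = 1ℚ
hookWeight (a ∷ ν) = rowWeight a ν ℚ.* hookWeight ν

0<n! : ∀ n → 0 < n !
0<n! n = >-nonZero⁻¹ (n !) {{n !≢0}}

strict-tail : ∀ {a c ν} → StrictBelow a (c ∷ ν) → StrictBelow a ν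
strict-tail ((0<c , c<a) ∷ s) = tighten (<-trans (head-< 0<c s) c<a) s

rowWeight-firstHooks : ∀ {a ν} → StrictBelow a ν → rowWeight a ν ℚ.* ι (∏ a (firstHook a ν)) ≡ 1ℚ
rowWeight-firstHooks {a} [] = trans (cong (λ n → inv (ι (a !)) ℚ.* ι n) (firstHooks-[] a))
  (trans (ℚ.*-comm (inv (ι (a !))) (ι (a !))) (inv-ι (0<n! a)))
rowWeight-firstHooks {a} {c ∷ ν} s@((0<c , c<a) ∷ _) = begin
  (ι a ℚ.- ι c) ℚ.* i ℚ.* v ℚ.* ι P
    ≡⟨ cong (λ x → x ℚ.* i ℚ.* v ℚ.* ι P) (sym (ι-∸ (<⇒≤ c<a))) ⟩
  ι (a ∸ c) ℚ.* i ℚ.* v ℚ.* ι P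
    ≡⟨ lemma₁ (ι (a ∸ c)) i v (ι P) ⟩
  i ℚ.* v ℚ.* (ι P ℚ.* ι (a ∸ c))
    ≡⟨ cong (i ℚ.* v ℚ.*_) (trans (sym (ι-* P (a ∸ c)))
         (trans (cong ι (firstHooks-∷ s)) (trans (ι-* (a + c) Q) (cong (ℚ._* ι Q) (ι-+ a c))))) ⟩
  i ℚ.* v ℚ.* ((ι a ℚ.+ ι c) ℚ.* ι Q)
    ≡⟨ lemma₂ i v (ι a ℚ.+ ι c) (ι Q) ⟩
  (ι a ℚ.+ ι c) ℚ.* i ℚ.* (v ℚ.* ι Q)
    ≡⟨ cong₂ ℚ._*_ (inv-sum {a} {c} (<-≤-trans 0<c (m≤n+m c a))) (rowWeight-firstHooks (strict-tail s)) ⟩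
  1ℚ ∎
  where
  open ≡-Reasoning
  i v : ℚ
  i = inv (ι a ℚ.+ ι c)
  v = rowWeight a ν
  P Q : ℕ
  P = ∏ a (firstHook a (c ∷ ν))
  Q = ∏ a (firstHook a ν)
  lemma₁ : ∀ x i v p → x ℚ.* i ℚ.* v ℚ.* p ≡ i ℚ.* v ℚ.* (p ℚ.* x)
  lemma₁ = RingSolver.solve-∀ ℚ-ring
  lemma₂ : ∀ i v x q → i ℚ.* v ℚ.* (x ℚ.* q) ≡ x ℚ.* i ℚ.* (v ℚ.* q)
  lemma₂ = RingSolver.solve-∀ ℚ-ring

hookWeight-hookProduct : ∀ {b λs} → StrictBelow b λs → hookWeight λs ℚ.* ι (hookProduct λs) ≡ 1ℚ
hookWeight-hookProduct [] = trans (ℚ.*-identityˡ (ι 1)) ι-one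
hookWeight-hookProduct {λs = a ∷ ν} (_ ∷ s) = begin
  rowWeight a ν ℚ.* hookWeight ν ℚ.* ι (hookProduct (a ∷ ν))
    ≡⟨ cong (λ h → rowWeight a ν ℚ.* hookWeight ν ℚ.* h)
         (trans (cong ι (hookProduct-∷ s)) (ι-* (∏ a (firstHook a ν)) (hookProduct ν))) ⟩
  rowWeight a ν ℚ.* hookWeight ν ℚ.* (ι (∏ a (firstHook a ν)) ℚ.* ι (hookProduct ν))
    ≡⟨ lemma (rowWeight a ν) (hookWeight ν) (ι (∏ a (firstHook a ν))) (ι (hookProduct ν)) ⟩
  (rowWeight a ν ℚ.* ι (∏ a (firstHook a ν))) ℚ.* (hookWeight ν ℚ.* ι (hookProduct ν))
    ≡⟨ cong₂ ℚ._*_ (rowWeight-firstHooks s) (hookWeight-hookProduct s) ⟩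
  1ℚ ∎
  where
  open ≡-Reasoning
  lemma : ∀ v w x y → v ℚ.* w ℚ.* (x ℚ.* y) ≡ (v ℚ.* x) ℚ.* (w ℚ.* y)
  lemma = RingSolver.solve-∀ ℚ-ring

private
  node-lower : ∀ a x → node a ℚ.- node (suc x) ≡ (ι a ℚ.- ι (suc x)) ℚ.* (ι a ℚ.+ ι x)
  node-lower a x = trans (cong (λ y → ι a ℚ.* (ι a ℚ.- 1ℚ) ℚ.- y ℚ.* (y ℚ.- 1ℚ)) (ι-suc x))
    (trans (lemma (ι a) (ι x)) (cong (λ y → (ι a ℚ.- y) ℚ.* (ι a ℚ.+ ι x)) (sym (ι-suc x))))
    where
    lemma : ∀ a x → a ℚ.* (a ℚ.- 1ℚ) ℚ.- (1ℚ ℚ.+ x) ℚ.* (1ℚ ℚ.+ x ℚ.- 1ℚ) ≡ (a ℚ.- (1ℚ ℚ.+ x)) ℚ.* (a ℚ.+ x)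
    lemma = RingSolver.solve-∀ ℚ-ring

  inv-product : ∀ {x y x′ y′} → x ℚ.* x′ ≡ 1ℚ → y ℚ.* y′ ≡ 1ℚ → inv (x ℚ.* y) ≡ x′ ℚ.* y′
  inv-product {x} {y} {x′} {y′} xx′ yy′ = inv-unique {x ℚ.* y} {x′ ℚ.* y′}
      (trans (lemma x y x′ y′) (cong₂ ℚ._*_ xx′ yy′))
    where
    lemma : ∀ x y x′ y′ → x ℚ.* y ℚ.* (x′ ℚ.* y′) ≡ (x ℚ.* x′) ℚ.* (y ℚ.* y′)
    lemma = RingSolver.solve-∀ ℚ-ring

ratio-zero : ∀ {a} → 0 < a → ratio a 0 ≡ 1ℚ
ratio-zero {a} 0<a = trans (cong (λ z → (ι a ℚ.- z) ℚ.* inv (ι a ℚ.+ z)) ι-zero)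
  (trans (cong₂ (λ x y → x ℚ.* inv y) (ℚ.+-identityʳ (ι a)) (ℚ.+-identityʳ (ι a))) (inv-ι 0<a))

-- With q = 1 + x, `factor a q` equals (a + q)(a - q + 1) / ((a - q)(a + q - 1)), which is exactly
-- the effect on the ratio of lowering the smaller part.
ratio-lower : ∀ {a x} → suc x < a → ratio a (suc x) ℚ.* factor a (suc x) ≡ ratio a x
ratio-lower {a} {x} 1+x<a = begin
  (ι a ℚ.- ι (suc x)) ℚ.* m ℚ.* (1ℚ ℚ.+ (ι a ℚ.+ ι a) ℚ.* gapInv a (suc x))
    ≡⟨ cong (λ i → (ι a ℚ.- ι (suc x)) ℚ.* m ℚ.* (1ℚ ℚ.+ (ι a ℚ.+ ι a) ℚ.* i))
         (trans (cong inv (node-lower a x)) (inv-product {ι a ℚ.- ι (suc x)} {ι a ℚ.+ ι x} {p′} {q′} pp′ qq′)) ⟩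
  (ι a ℚ.- ι (suc x)) ℚ.* m ℚ.* (1ℚ ℚ.+ (ι a ℚ.+ ι a) ℚ.* (p′ ℚ.* q′))
    ≡⟨ cong (λ y → (ι a ℚ.- y) ℚ.* m ℚ.* (1ℚ ℚ.+ (ι a ℚ.+ ι a) ℚ.* (p′ ℚ.* q′))) (ι-suc x) ⟩
  (ι a ℚ.- (1ℚ ℚ.+ ι x)) ℚ.* m ℚ.* (1ℚ ℚ.+ (ι a ℚ.+ ι a) ℚ.* (p′ ℚ.* q′))
    ≡⟨ cong (λ y → (ι a ℚ.- (1ℚ ℚ.+ ι x)) ℚ.* m ℚ.* (y ℚ.+ (ι a ℚ.+ ι a) ℚ.* (p′ ℚ.* q′)))
         (sym (cong₂ ℚ._*_ pp″ qq′)) ⟩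
  (ι a ℚ.- (1ℚ ℚ.+ ι x)) ℚ.* m ℚ.* ((ι a ℚ.- (1ℚ ℚ.+ ι x)) ℚ.* p′ ℚ.* ((ι a ℚ.+ ι x) ℚ.* q′) ℚ.+
      (ι a ℚ.+ ι a) ℚ.* (p′ ℚ.* q′))
    ≡⟨ lemma (ι a) (ι x) m p′ q′ ⟩
  (ι a ℚ.- (1ℚ ℚ.+ ι x)) ℚ.* p′ ℚ.* ((ι a ℚ.+ (1ℚ ℚ.+ ι x)) ℚ.* m) ℚ.* ((ι a ℚ.- ι x) ℚ.* q′)
    ≡⟨ cong₂ (λ y z → y ℚ.* z ℚ.* ((ι a ℚ.- ι x) ℚ.* q′)) pp″ mm″ ⟩
  1ℚ ℚ.* 1ℚ ℚ.* ((ι a ℚ.- ι x) ℚ.* q′)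
    ≡⟨ ℚ.*-identityˡ ((ι a ℚ.- ι x) ℚ.* q′) ⟩
  ratio a x ∎
  where
  open ≡-Reasoning
  m p′ q′ : ℚ
  m = inv (ι a ℚ.+ ι (suc x))
  p′ = inv (ι a ℚ.- ι (suc x))
  q′ = inv (ι a ℚ.+ ι x)
  0<a : 0 < a
  0<a = ≤-trans (s≤s z≤n) 1+x<a
  pp′ : (ι a ℚ.- ι (suc x)) ℚ.* p′ ≡ 1ℚ
  pp′ = inv-difference 1+x<a
  pp″ : (ι a ℚ.- (1ℚ ℚ.+ ι x)) ℚ.* p′ ≡ 1ℚ
  pp″ = trans (cong (λ y → (ι a ℚ.- y) ℚ.* p′) (sym (ι-suc x))) pp′
  qq′ : (ι a ℚ.+ ι x) ℚ.* q′ ≡ 1ℚ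
  qq′ = inv-sum {a} {x} (<-≤-trans 0<a (m≤m+n a x))
  mm″ : (ι a ℚ.+ (1ℚ ℚ.+ ι x)) ℚ.* m ≡ 1ℚ
  mm″ = trans (cong (λ y → (ι a ℚ.+ y) ℚ.* m) (sym (ι-suc x))) (inv-sum {a} {suc x} (<-≤-trans 0<a (m≤m+n a (suc x))))
  lemma : ∀ a x m p q → (a ℚ.- (1ℚ ℚ.+ x)) ℚ.* m ℚ.*
      ((a ℚ.- (1ℚ ℚ.+ x)) ℚ.* p ℚ.* ((a ℚ.+ x) ℚ.* q) ℚ.+ (a ℚ.+ a) ℚ.* (p ℚ.* q)) ≡
                        (a ℚ.- (1ℚ ℚ.+ x)) ℚ.* p ℚ.* ((a ℚ.+ (1ℚ ℚ.+ x)) ℚ.* m) ℚ.* ((a ℚ.- x) ℚ.* q)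
  lemma = RingSolver.solve-∀ ℚ-ring

-- The same factors describe the lowering of the larger part: numerator and denominator both change
-- sign. For p = α the new ratio is 0.
ratio-lowered : ∀ {α p} → 0 < p → p < suc α → ratio (suc α) p ℚ.* factor p (suc α) ≡ ratio α p
ratio-lowered {α} {p} 0<p p<1+α = begin
  (ι (suc α) ℚ.- ι p) ℚ.* m ℚ.* (1ℚ ℚ.+ (ι p ℚ.+ ι p) ℚ.* gapInv p (suc α))
    ≡⟨ cong (λ i → (ι (suc α) ℚ.- ι p) ℚ.* m ℚ.* (1ℚ ℚ.+ (ι p ℚ.+ ι p) ℚ.* i))
         (trans (cong inv (node-lower p α)) (inv-product {ι p ℚ.- ι (suc α)} {ι p ℚ.+ ι α} { ℚ.- d′} {q′} dd′ qq′)) ⟩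
  (ι (suc α) ℚ.- ι p) ℚ.* m ℚ.* (1ℚ ℚ.+ (ι p ℚ.+ ι p) ℚ.* (ℚ.- d′ ℚ.* q′))
    ≡⟨ cong (λ y → (y ℚ.- ι p) ℚ.* m ℚ.* (1ℚ ℚ.+ (ι p ℚ.+ ι p) ℚ.* (ℚ.- d′ ℚ.* q′))) (ι-suc α) ⟩
  (1ℚ ℚ.+ ι α ℚ.- ι p) ℚ.* m ℚ.* (1ℚ ℚ.+ (ι p ℚ.+ ι p) ℚ.* (ℚ.- d′ ℚ.* q′))
    ≡⟨ cong (λ y → (1ℚ ℚ.+ ι α ℚ.- ι p) ℚ.* m ℚ.* (y ℚ.+ (ι p ℚ.+ ι p) ℚ.* (ℚ.- d′ ℚ.* q′)))
         (sym (cong₂ ℚ._*_ dd″ qq′)) ⟩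
  (1ℚ ℚ.+ ι α ℚ.- ι p) ℚ.* m ℚ.* ((1ℚ ℚ.+ ι α ℚ.- ι p) ℚ.* d′ ℚ.* ((ι p ℚ.+ ι α) ℚ.* q′) ℚ.+ (ι p ℚ.+ ι p)
      ℚ.* (ℚ.- d′ ℚ.* q′))
    ≡⟨ lemma (ι α) (ι p) m d′ q′ ⟩
  (1ℚ ℚ.+ ι α ℚ.- ι p) ℚ.* d′ ℚ.* ((1ℚ ℚ.+ ι α ℚ.+ ι p) ℚ.* m) ℚ.* ((ι α ℚ.- ι p) ℚ.* q′)
    ≡⟨ cong₂ (λ y z → y ℚ.* z ℚ.* ((ι α ℚ.- ι p) ℚ.* q′)) dd″ mm″ ⟩
  1ℚ ℚ.* 1ℚ ℚ.* ((ι α ℚ.- ι p) ℚ.* q′)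
    ≡⟨ ℚ.*-identityˡ ((ι α ℚ.- ι p) ℚ.* q′) ⟩
  (ι α ℚ.- ι p) ℚ.* inv (ι p ℚ.+ ι α)
    ≡⟨ cong (λ y → (ι α ℚ.- ι p) ℚ.* inv y) (ℚ.+-comm (ι p) (ι α)) ⟩
  ratio α p ∎
  where
  open ≡-Reasoning
  m d′ q′ : ℚ
  m = inv (ι (suc α) ℚ.+ ι p)
  d′ = inv (ι (suc α) ℚ.- ι p)
  q′ = inv (ι p ℚ.+ ι α)
  dd″ : (1ℚ ℚ.+ ι α ℚ.- ι p) ℚ.* d′ ≡ 1ℚ
  dd″ = trans (cong (λ y → (y ℚ.- ι p) ℚ.* d′) (sym (ι-suc α))) (inv-difference p<1+α)
  dd′ : (ι p ℚ.- ι (suc α)) ℚ.* ℚ.- d′ ≡ 1ℚ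
  dd′ = trans (flip (ι p) (ι (suc α)) d′) (inv-difference p<1+α)
    where
    flip : ∀ x y d → (x ℚ.- y) ℚ.* ℚ.- d ≡ (y ℚ.- x) ℚ.* d
    flip = RingSolver.solve-∀ ℚ-ring
  qq′ : (ι p ℚ.+ ι α) ℚ.* q′ ≡ 1ℚ
  qq′ = inv-sum {p} {α} (<-≤-trans 0<p (m≤m+n p α))
  mm″ : (1ℚ ℚ.+ ι α ℚ.+ ι p) ℚ.* m ≡ 1ℚ
  mm″ = trans (cong (λ y → (y ℚ.+ ι p) ℚ.* m) (sym (ι-suc α))) (inv-sum {suc α} {p} (s≤s z≤n))
  lemma : ∀ α p m d q → (1ℚ ℚ.+ α ℚ.- p) ℚ.* m ℚ.* ((1ℚ ℚ.+ α ℚ.- p) ℚ.* d ℚ.* ((p ℚ.+ α) ℚ.* q) ℚ.+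
      (p ℚ.+ p) ℚ.* (ℚ.- d ℚ.* q)) ≡
                        (1ℚ ℚ.+ α ℚ.- p) ℚ.* d ℚ.* ((1ℚ ℚ.+ α ℚ.+ p) ℚ.* m) ℚ.* ((α ℚ.- p) ℚ.* q)
  lemma = RingSolver.solve-∀ ℚ-ring

rowWeight-removal : ∀ {a ν x μ} → StrictBelow a ν → Box-removal x ν μ → rowWeight a μ ≡ rowWeight a ν ℚ.* factor a x
-- Deleting a part 1 amounts to lowering it to 0, where the ratio is 1.
rowWeight-removal {a} ((_ , 1<a) ∷ []) single = begin
  v                          ≡⟨ ℚ.*-identityˡ v ⟨
  1ℚ ℚ.* v                     ≡⟨ cong (ℚ._* v) (ratio-zero (<-trans (s≤s z≤n) 1<a)) ⟨
  ratio a 0 ℚ.* v              ≡⟨ cong (ℚ._* v) (ratio-lower 1<a) ⟨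
  ratio a 1 ℚ.* factor a 1 ℚ.* v      ≡⟨ lemma (ratio a 1) (factor a 1) v ⟩
  ratio a 1 ℚ.* v ℚ.* factor a 1      ∎
  where
  open ≡-Reasoning
  v : ℚ
  v = rowWeight a []
  lemma : ∀ r t v → r ℚ.* t ℚ.* v ≡ r ℚ.* v ℚ.* t
  lemma = RingSolver.solve-∀ ℚ-ring
rowWeight-removal {a} ((_ , c<a) ∷ s) (here {c} {ν} _) =
  trans (cong (ℚ._* rowWeight a ν) (sym (ratio-lower c<a)))
      (lemma (ratio a (2 + c)) (factor a (2 + c)) (rowWeight a ν))
  where
  lemma : ∀ r t v → r ℚ.* t ℚ.* v ≡ r ℚ.* v ℚ.* t
  lemma = RingSolver.solve-∀ ℚ-ring
rowWeight-removal {a} {x = x} s (there {a = c} r) =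
  trans (cong (ratio a c ℚ.*_) (rowWeight-removal (strict-tail s) r)) (sym (ℚ.*-assoc (ratio a c) _ (factor a x)))

-- The factorial contributes 1 + α and every lower part its factor; together they are the residue
-- that `poleSum` attaches to the first part.
rowWeight-lowered : ∀ {α ν} → StrictBelow (suc α) ν → rowWeight α ν ≡ rowWeight (suc α) ν ℚ.*
    (ι (suc α) ℚ.* factors ν (suc α))
rowWeight-lowered {α} [] = inv-unique (begin
  ι (α !) ℚ.* (i ℚ.* (ι (suc α) ℚ.* 1ℚ))    ≡⟨ lemma (ι (α !)) i (ι (suc α)) ⟩
  (ι (suc α) ℚ.* ι (α !)) ℚ.* i           ≡⟨ cong (ℚ._* i) (sym (ι-* (suc α) (α !))) ⟩
  ι ((suc α) !) ℚ.* i                   ≡⟨ inv-ι (0<n! (suc α)) ⟩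
  1ℚ                                  ∎)
  where
  open ≡-Reasoning
  i : ℚ
  i = inv (ι ((suc α) !))
  lemma : ∀ x i y → x ℚ.* (i ℚ.* (y ℚ.* 1ℚ)) ≡ (y ℚ.* x) ℚ.* i
  lemma = RingSolver.solve-∀ ℚ-ring
rowWeight-lowered {α} {p ∷ ν} s@((0<p , p<1+α) ∷ _) = trans
  (cong₂ ℚ._*_ (sym (ratio-lowered 0<p p<1+α)) (rowWeight-lowered (strict-tail s)))
  (lemma (ratio (suc α) p) (factor p (suc α)) (rowWeight (suc α) ν) (ι (suc α)) (factors ν (suc α)))
  where
  lemma : ∀ r t v y factors → r ℚ.* t ℚ.* (v ℚ.* (y ℚ.* factors)) ≡ r ℚ.* v ℚ.* (y ℚ.* (t ℚ.* factors))
  lemma = RingSolver.solve-∀ ℚ-ring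

-- The removal from the first row yields the first term of `poleSum`, and if it is blocked, that
-- term is 0.
hookWeight-lower : ∀ {a ν} (h : ℕ → ℚ) → 0 < a → StrictBelow a ν →
  ∑ℚ (lower a ν) (λ (x , μ) → hookWeight μ ℚ.* h x) ≡ rowWeight a ν ℚ.* hookWeight ν ℚ.* (ι a ℚ.* factors ν a ℚ.* h a)
hookWeight-lower {suc zero} h _ ((s≤s _ , s≤s ()) ∷ _)
hookWeight-lower {suc zero} h _ [] = begin
  1ℚ ℚ.* h 1 ℚ.+ 0ℚ                            ≡⟨ lemma₁ (h 1) ⟩
  1ℚ ℚ.* 1ℚ ℚ.* h 1                            ≡⟨ cong (λ x → x ℚ.* 1ℚ ℚ.* h 1)
      (trans (sym (inv-unique (trans (ℚ.*-identityʳ (ι 1)) ι-one))) (rowWeight-lowered {0} [])) ⟩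
  v ℚ.* (ι 1 ℚ.* 1ℚ) ℚ.* 1ℚ ℚ.* h 1                ≡⟨ lemma₂ v (ι 1) (h 1) ⟩
  v ℚ.* 1ℚ ℚ.* (ι 1 ℚ.* 1ℚ ℚ.* h 1)                ∎
  where
  open ≡-Reasoning
  v : ℚ
  v = rowWeight 1 []
  lemma₁ : ∀ y → 1ℚ ℚ.* y ℚ.+ 0ℚ ≡ 1ℚ ℚ.* 1ℚ ℚ.* y
  lemma₁ = RingSolver.solve-∀ ℚ-ring
  lemma₂ : ∀ v x y → v ℚ.* (x ℚ.* 1ℚ) ℚ.* 1ℚ ℚ.* y ≡ v ℚ.* 1ℚ ℚ.* (x ℚ.* 1ℚ ℚ.* y)
  lemma₂ = RingSolver.solve-∀ ℚ-ring
hookWeight-lower {suc (suc a)} {ν} h 0<a s with head ν <? suc a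
... | yes _ = trans (cong (λ v → v ℚ.* hookWeight ν ℚ.* h (2 + a) ℚ.+ 0ℚ) (rowWeight-lowered s))
    (lemma (rowWeight (2 + a) ν) (ι (2 + a)) (factors ν (2 + a)) (hookWeight ν) (h (2 + a)))
  where
  lemma : ∀ v y factors w h → v ℚ.* (y ℚ.* factors) ℚ.* w ℚ.* h ℚ.+ 0ℚ ≡ v ℚ.* w ℚ.* (y ℚ.* factors ℚ.* h)
  lemma = RingSolver.solve-∀ ℚ-ring
... | no h≮ = begin
    0ℚ
      ≡⟨ ℚ.*-zeroˡ (hookWeight ν ℚ.* h (2 + a)) ⟨
    0ℚ ℚ.* (hookWeight ν ℚ.* h (2 + a))
      ≡⟨ cong (ℚ._* (hookWeight ν ℚ.* h (2 + a))) (trans (sym (blocked ν s h≮)) (rowWeight-lowered s)) ⟩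
    rowWeight (2 + a) ν ℚ.* (ι (2 + a) ℚ.* factors ν (2 + a)) ℚ.* (hookWeight ν ℚ.* h (2 + a))
      ≡⟨ lemma (rowWeight (2 + a) ν) (ι (2 + a)) (factors ν (2 + a)) (hookWeight ν) (h (2 + a)) ⟩
    rowWeight (2 + a) ν ℚ.* hookWeight ν ℚ.* (ι (2 + a) ℚ.* factors ν (2 + a) ℚ.* h (2 + a)) ∎
  where
  open ≡-Reasoning
  lemma : ∀ v y factors w h → v ℚ.* (y ℚ.* factors) ℚ.* (w ℚ.* h) ≡ v ℚ.* w ℚ.* (y ℚ.* factors ℚ.* h)
  lemma = RingSolver.solve-∀ ℚ-ring
  -- The forbidden lowering would create two equal parts, whose ratio is 0.
  blocked : ∀ ν → StrictBelow (2 + a) ν → ¬ head ν < suc a → rowWeight (suc a) ν ≡ 0ℚ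
  blocked [] _ h≮ = contradiction (s≤s z≤n) h≮
  blocked (d ∷ ρ) ((_ , s≤s d≤) ∷ _) d≮ with ≤-antisym d≤ (≮⇒≥ d≮)
  ... | refl = trans (cong (λ z → z ℚ.* inv (ι d ℚ.+ ι d) ℚ.* rowWeight d ρ) (ℚ.+-inverseʳ (ι d)))
                     (zero* (inv (ι d ℚ.+ ι d)) (rowWeight d ρ))
    where
    zero* : ∀ x y → 0ℚ ℚ.* x ℚ.* y ≡ 0ℚ
    zero* = RingSolver.solve-∀ ℚ-ring

-- Removal from a lower row also changes the ratios with the rows above. The free function `h`
-- collects these factors on the way down, as in the recursion of `poleSum`.
hookWeight-downs : ∀ {b λs} (h : ℕ → ℚ) → StrictBelow b λs →
  ∑ℚ (downs λs) (λ (x , μ) → hookWeight μ ℚ.* h x) ≡ hookWeight λs ℚ.* poleSum λs h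
hookWeight-downs h [] = refl
hookWeight-downs {λs = a ∷ ν} h ((0<a , _) ∷ s) = begin
  ∑ℚ (lower a ν ++ map (map₂ (a ∷_)) (downs ν)) (λ (x , μ) → hookWeight μ ℚ.* h x)
    ≡⟨ trans (∑ℚ-++ (lower a ν) _ _) (cong (∑ℚ (lower a ν) (λ (x , μ) → hookWeight μ ℚ.* h x) ℚ.+_)
         (∑ℚ-map (map₂ (a ∷_)) (downs ν) _)) ⟩
  ∑ℚ (lower a ν) (λ (x , μ) → hookWeight μ ℚ.* h x) ℚ.+ ∑ℚ (downs ν)
      (λ (x , μ) → rowWeight a μ ℚ.* hookWeight μ ℚ.* h x)
    ≡⟨ cong₂ ℚ._+_ (hookWeight-lower h 0<a s) (∑ℚ-cong (downs ν) (λ {p} p∈ →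
         trans (cong (λ v → v ℚ.* hookWeight (proj₂ p) ℚ.* h (proj₁ p)) (rowWeight-removal s (downs-removal s p∈)))
           (lemma₁ (rowWeight a ν) (factor a (proj₁ p)) (hookWeight (proj₂ p)) (h (proj₁ p))))) ⟩
  rowWeight a ν ℚ.* hookWeight ν ℚ.* (ι a ℚ.* factors ν a ℚ.* h a)
    ℚ.+ ∑ℚ (downs ν) (λ (x , μ) → rowWeight a ν ℚ.* (hookWeight μ ℚ.* (h x ℚ.* factor a x)))
    ≡⟨ cong (λ y → rowWeight a ν ℚ.* hookWeight ν ℚ.* (ι a ℚ.* factors ν a ℚ.* h a) ℚ.+ y)
         (trans (∑ℚ-*ˡ (downs ν) (rowWeight a ν) _)
             (cong (rowWeight a ν ℚ.*_) (hookWeight-downs (λ x → h x ℚ.* factor a x) s))) ⟩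
  rowWeight a ν ℚ.* hookWeight ν ℚ.* (ι a ℚ.* factors ν a ℚ.* h a) ℚ.+ rowWeight a ν ℚ.*
      (hookWeight ν ℚ.* poleSum ν (λ x → h x ℚ.* factor a x))
    ≡⟨ lemma₂ (rowWeight a ν) (hookWeight ν) (ι a ℚ.* factors ν a ℚ.* h a) (poleSum ν (λ x → h x ℚ.* factor a x)) ⟩
  hookWeight (a ∷ ν) ℚ.* poleSum (a ∷ ν) h ∎
  where
  open ≡-Reasoning
  lemma₁ : ∀ v t w h → v ℚ.* t ℚ.* w ℚ.* h ≡ v ℚ.* (w ℚ.* (h ℚ.* t))
  lemma₁ = RingSolver.solve-∀ ℚ-ring
  lemma₂ : ∀ v w x y → v ℚ.* w ℚ.* x ℚ.+ v ℚ.* (w ℚ.* y) ≡ v ℚ.* w ℚ.* (x ℚ.+ y)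
  lemma₂ = RingSolver.solve-∀ ℚ-ring

-- `poleSum-one` supplies the factor |λ| = n + 1 that turns n! into (n + 1)!.
hookFormula : ∀ n {b λs} → StrictBelow b λs → sum λs ≡ n → ι (#standardTableaux λs) ≡ ι (n !) ℚ.* hookWeight λs
hookFormula zero [] _ = trans ι-one (sym (trans (ℚ.*-identityʳ (ι 1)) ι-one))
hookFormula zero {λs = suc _ ∷ _} _ ()
hookFormula zero {λs = zero ∷ _} ((() , _) ∷ _) _
hookFormula (suc n) {λs = λs@(_ ∷ _)} s eq = begin
  ι (#standardTableaux λs)
    ≡⟨ trans (cong ι (#standardTableaux-downs s)) (ι-∑ (downs λs) (#standardTableaux ∘ proj₂)) ⟩
  ∑ℚ (downs λs) (λ p → ι (#standardTableaux (proj₂ p)))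
    ≡⟨ ∑ℚ-cong (downs λs) (λ {p} p∈ → let r = downs-removal s p∈ in
         trans (hookFormula n (removal-strict s r) (suc-injective (trans (sym (removal-sum r)) eq)))
           (cong (ι (n !) ℚ.*_) (sym (ℚ.*-identityʳ (hookWeight (proj₂ p)))))) ⟩
  ∑ℚ (downs λs) (λ p → ι (n !) ℚ.* (hookWeight (proj₂ p) ℚ.* 1ℚ))
    ≡⟨ trans (∑ℚ-*ˡ (downs λs) (ι (n !)) _) (cong (ι (n !) ℚ.*_) (hookWeight-downs (λ _ → 1ℚ) s)) ⟩
  ι (n !) ℚ.* (hookWeight λs ℚ.* poleSum λs (λ _ → 1ℚ))
    ≡⟨ cong (λ y → ι (n !) ℚ.* (hookWeight λs ℚ.* y)) (trans (poleSum-one s) (cong ι eq)) ⟩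
  ι (n !) ℚ.* (hookWeight λs ℚ.* ι (suc n))
    ≡⟨ lemma (ι (n !)) (hookWeight λs) (ι (suc n)) ⟩
  ι (suc n) ℚ.* ι (n !) ℚ.* hookWeight λs
    ≡⟨ cong (ℚ._* hookWeight λs) (ι-* (suc n) (n !)) ⟨
  ι ((suc n) !) ℚ.* hookWeight λs ∎
  where
  open ≡-Reasoning
  lemma : ∀ x w y → x ℚ.* (w ℚ.* y) ≡ y ℚ.* x ℚ.* w
  lemma = RingSolver.solve-∀ ℚ-ring

-- Sums over the boxes and clearing of denominators

open Growth #standardTableaux #standardTableaux-[] #standardTableaux-downs

∑-boxTerm-row : ∀ k a → ∑ (upTo a) (boxTerm k ∘ suc) ≡ rowTerm k a
∑-boxTerm-row k zero = sym (rowTerm-zero k)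
∑-boxTerm-row k (suc a) = begin
  ∑ (upTo (suc a)) (boxTerm k ∘ suc)
    ≡⟨ cong (λ ds → ∑ ds (boxTerm k ∘ suc)) (upTo-∷ʳ a) ⟨
  ∑ (upTo a ++ a ∷ []) (boxTerm k ∘ suc)
    ≡⟨ ∑-++ (upTo a) (a ∷ []) (boxTerm k ∘ suc) ⟩
  ∑ (upTo a) (boxTerm k ∘ suc) + (boxTerm k (suc a) + 0)
    ≡⟨ cong₂ _+_ (∑-boxTerm-row k a) (+-identityʳ (boxTerm k (suc a))) ⟩
  rowTerm k a + boxTerm k (suc a)
    ≡⟨ rowTerm-suc k a ⟨
  rowTerm k (suc a) ∎
  where open ≡-Reasoning

-- Each row has the contents 1, ..., λᵢ whatever its position, because `shift` preserves contents.
∑-diagram : ∀ k λs → ∑ (diagram λs) (boxTerm k ∘ content) ≡ ∑ λs (rowTerm k)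
∑-diagram k [] = refl
∑-diagram k (a ∷ ν) = begin
  ∑ (diagram (a ∷ ν)) (boxTerm k ∘ content)
    ≡⟨ cong (λ bs → ∑ bs (boxTerm k ∘ content)) (diagram-∷ a ν) ⟩
  ∑ (firstRow a ++ map shift (diagram ν)) (boxTerm k ∘ content)
    ≡⟨ ∑-++ (firstRow a) _ (boxTerm k ∘ content) ⟩
  ∑ (firstRow a) (boxTerm k ∘ content) + ∑ (map shift (diagram ν)) (boxTerm k ∘ content)
    ≡⟨ cong₂ _+_ (trans (∑-map firstBox (upTo a) (boxTerm k ∘ content)) (∑-boxTerm-row k a))
                   (trans (∑-map shift (diagram ν) (boxTerm k ∘ content)) (∑-diagram k ν)) ⟩
  rowTerm k a + ∑ ν (rowTerm k) ∎
  where open ≡-Reasoning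

weight-strict : ∀ {b λs} → StrictBelow b λs → 2 ^ (sum λs ∸ length λs) ≡ weight λs
weight-strict {λs = λs} s = cong (2 ^_) (trans (cong (_∸ length λs) (sym (excess s)))
    (m+n∸n≡m (∑ λs pred) (length λs)))
  where
  excess : ∀ {b λs} → StrictBelow b λs → ∑ λs pred + length λs ≡ sum λs
  excess [] = refl
  excess {λs = suc a ∷ ν} (_ ∷ s) = trans (lemma a (∑ ν pred) (length ν)) (cong (λ n → suc (a + n)) (excess s))
    where
    lemma : ∀ a x l → a + x + suc l ≡ suc (a + (x + l))
    lemma a x l = trans (+-suc (a + x) l) (cong suc (+-assoc a x l))

-- By the hook formula n! / H(λ) is the second factor of f², so multiplication by n! turns the
-- summand into a natural number, the term of `boxMoment`.
summand-*-n! : ∀ {b n λs} (k : ℕ) → StrictBelow b λs → sum λs ≡ n →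
  (_/_ (ℤ.+ (2 ^ (sum λs ∸ length λs) * #standardTableaux λs)) (hookProduct λs) {{hookProduct≢0 λs}})
    ℚ.* (ℤ.+ sum (map (λ b → (content b + k ∸ 1) C (2 * k)) (diagram λs)) / 1) ℚ.* ι (n !) ≡
  ι (weight λs * #standardTableaux λs * (∑ λs (rowTerm k) * #standardTableaux λs))
summand-*-n! {n = n} {λs} k s eq = begin
  q ℚ.* (ℤ.+ F / 1) ℚ.* ι (n !)
    ≡⟨ cong (λ y → q ℚ.* y ℚ.* ι (n !)) (trans (sym (ι≡/1 F)) (cong ι (∑-diagram k λs))) ⟩
  q ℚ.* ι G ℚ.* ι (n !)
    ≡⟨ cong (λ y → y ℚ.* ι G ℚ.* ι (n !)) q≡ ⟩
  ι (a * f) ℚ.* w ℚ.* ι G ℚ.* ι (n !)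
    ≡⟨ lemma (ι (a * f)) w (ι G) (ι (n !)) ⟩
  ι (a * f) ℚ.* (ι G ℚ.* (ι (n !) ℚ.* w))
    ≡⟨ cong (λ y → ι (a * f) ℚ.* (ι G ℚ.* y)) (sym (hookFormula n s eq)) ⟩
  ι (a * f) ℚ.* (ι G ℚ.* ι f)
    ≡⟨ trans (cong (ι (a * f) ℚ.*_) (sym (ι-* G f))) (sym (ι-* (a * f) (G * f))) ⟩
  ι (a * f * (G * f))
    ≡⟨ cong (λ y → ι (y * f * (G * f))) (weight-strict s) ⟩
  ι (weight λs * f * (G * f)) ∎
  where
  open ≡-Reasoning
  a f F G : ℕ
  a = 2 ^ (sum λs ∸ length λs)
  f = #standardTableaux λs
  F = ∑ (diagram λs) (boxTerm k ∘ content)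
  G = ∑ λs (rowTerm k)
  q w : ℚ
  q = _/_ (ℤ.+ (a * f)) (hookProduct λs) {{hookProduct≢0 λs}}
  w = hookWeight λs
  lemma : ∀ x w g n → x ℚ.* w ℚ.* g ℚ.* n ≡ x ℚ.* (g ℚ.* (n ℚ.* w))
  lemma = RingSolver.solve-∀ ℚ-ring
  lemma′ : ∀ q w h → q ℚ.* (w ℚ.* h) ≡ q ℚ.* h ℚ.* w
  lemma′ = RingSolver.solve-∀ ℚ-ring
  q≡ : q ≡ ι (a * f) ℚ.* w
  q≡ = begin
    q                                    ≡⟨ ℚ.*-identityʳ q ⟨
    q ℚ.* 1ℚ                               ≡⟨ cong (q ℚ.*_) (hookWeight-hookProduct s) ⟨
    q ℚ.* (w ℚ.* ι (hookProduct λs))         ≡⟨ lemma′ q w (ι (hookProduct λs)) ⟩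
    q ℚ.* ι (hookProduct λs) ℚ.* w           ≡⟨ cong (ℚ._* w) (/-*-ι (a * f) (hookProduct λs) {{hookProduct≢0 λs}}) ⟩
    ι (a * f) ℚ.* w                      ∎

∑ℚ-*ʳ : ∀ {A : Set} (xs : List A) c (g : A → ℚ) → ∑ℚ xs g ℚ.* c ≡ ∑ℚ xs (λ x → g x ℚ.* c)
∑ℚ-*ʳ []       c g = ℚ.*-zeroˡ c
∑ℚ-*ʳ (x ∷ xs) c g = trans (ℚ.*-distribʳ-+ c (g x) _) (cong (g x ℚ.* c ℚ.+_) (∑ℚ-*ʳ xs c g))

*-cancelʳ-ι : ∀ {x y} n → 0 < n → x ℚ.* ι n ≡ y ℚ.* ι n → x ≡ y
*-cancelʳ-ι {x} {y} n 0<n eq = begin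
  x                        ≡⟨ expand x ⟩
  x ℚ.* ι n ℚ.* inv (ι n)      ≡⟨ cong (ℚ._* inv (ι n)) eq ⟩
  y ℚ.* ι n ℚ.* inv (ι n)      ≡⟨ expand y ⟨
  y                        ∎
  where
  open ≡-Reasoning
  expand : ∀ z → z ≡ z ℚ.* ι n ℚ.* inv (ι n)
  expand z = trans (sym (ℚ.*-identityʳ z)) (trans (cong (z ℚ.*_) (sym (inv-ι 0<n)))
      (sym (ℚ.*-assoc z (ι n) (inv (ι n)))))

open import Data.Integer.Base using (+_)

theorem1p2 : (k n : ℕ) →
    ∑ℚ (strictPartitions n) (λ λs →
    (_/_ (+ (2 ^ (sum λs ∸ length λs) * #standardTableaux λs)) (hookProduct λs) {{hookProduct≢0 λs}})
    ℚ.* (+ sum (map (λ b → (content b + k ∸ 1) C (2 * k)) (diagram λs)) / 1))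
    ≡ (_/_ (+ (2 ^ k)) ((k + 1) !) {{(k + 1) !≢0}}) ℚ.* (+ (n C (k + 1)) / 1)
-- Multiplying both sides by n! and (k + 1)! reduces the claim to `boxMoment-closed` in ℕ.
theorem1p2 k n = *-cancelʳ-ι (n !) (0<n! n) (*-cancelʳ-ι ((k + 1) !) (0<n! (k + 1)) (begin
  ∑ℚ (strictPartitions n) summand ℚ.* ι (n !) ℚ.* ι ((k + 1) !)
    ≡⟨ cong (ℚ._* ι ((k + 1) !)) (trans (∑ℚ-*ʳ (strictPartitions n) (ι (n !)) summand)
         (trans (∑ℚ-cong (strictPartitions n) (λ λs∈ → let s , eq = ∈-strictPartitions⁻ (n<1+n n) λs∈ in summand-*-n! k s eq))
           (sym (ι-∑ (strictPartitions n) _)))) ⟩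
  ι (boxMoment k n) ℚ.* ι ((k + 1) !)
    ≡⟨ ι-* (boxMoment k n) ((k + 1) !) ⟨
  ι (boxMoment k n * (k + 1) !)
    ≡⟨ cong ι (trans (cong (λ j → boxMoment k n * j !) (+-comm k 1))
         (trans (boxMoment-closed k n) (cong (λ j → 2 ^ k * n ! * (n C j)) (+-comm 1 k)))) ⟩
  ι (2 ^ k * n ! * c)
    ≡⟨ trans (ι-* (2 ^ k * n !) c) (cong (ℚ._* ι c) (ι-* (2 ^ k) (n !))) ⟩
  ι (2 ^ k) ℚ.* ι (n !) ℚ.* ι c
    ≡⟨ cong₂ (λ x y → x ℚ.* ι (n !) ℚ.* y) (sym (/-*-ι (2 ^ k) ((k + 1) !) {{(k + 1) !≢0}})) (ι≡/1 c) ⟩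
  q ℚ.* ι ((k + 1) !) ℚ.* ι (n !) ℚ.* (+ c / 1)
    ≡⟨ lemma q (ι ((k + 1) !)) (ι (n !)) (+ c / 1) ⟩
  q ℚ.* (+ c / 1) ℚ.* ι (n !) ℚ.* ι ((k + 1) !) ∎))
  where
  open ≡-Reasoning
  summand : List ℕ → ℚ
  summand λs = (_/_ (+ (2 ^ (sum λs ∸ length λs) * #standardTableaux λs)) (hookProduct λs) {{hookProduct≢0 λs}})
    ℚ.* (+ sum (map (λ b → (content b + k ∸ 1) C (2 * k)) (diagram λs)) / 1)
  c : ℕ
  c = n C (k + 1)
  q : ℚ
  q = _/_ (+ (2 ^ k)) ((k + 1) !) {{(k + 1) !≢0}}
  lemma : ∀ q d m c → q ℚ.* d ℚ.* m ℚ.* c ≡ q ℚ.* c ℚ.* m ℚ.* d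
  lemma = RingSolver.solve-∀ ℚ-ring
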